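{- For every integer $s\ge 1$ there exists an integer $k\ge 2$ such that, if $M$ is a claw-free matroid with $\omega(M)\le s$, then $M$ is isomorphic to an iterated lift-join $(\cdots((M_1\otimes M_2)\otimes M_3)\cdots)\otimes M_{2s+1}$ of $2s+1$ matroids $M_1,\dots,M_{2s+1}$, each of which either is even-plane or has dimension at most $k$.
   Context: A matroid is a pair $M=(E,G)$ where $G$ is the set of nonzero vectors of a finite-dimensional $\mathbb F_2$-vector space $V(G)=G\cup\{0\}\cong\mathbb F_2^n$ and $E\subseteq G$; $n\ge 0$ is the dimension of $M$ (dimension $0$, i.e. $G=\varnothing$, is allowed). Matroids $(E_1,G_1),(E_2,G_2)$ are isomorphic if a linear isomorphism $V(G_1)\to V(G_2)$ maps $E_1$ onto $E_2$. A flat of $G$ is a set $F\subseteq G$ with $F\cup\{0\}$ a subspace; its dimension is that of the subspace; planes are $3$-dimensional flats. $M|F=(E\cap F,F)$ for a flat $F$. A claw is $(B,G)$ with $\dim G=3$ and $B$ a basis; $M$ is claw-free if no $M|F$ is isomorphic to a claw. $\omega(M)$ is the largest dimension of a flat of $G$ contained in $E$. $M$ is even-plane if $|E\cap P|$ is even for every plane $P$ of $G$. Lift-join: for $M_1=(E_1,G_1)$, $M_2=(E_2,G_2)$, let $G_1\oplus G_2$ be the set of nonzero vectors of $V(G_1)\oplus V(G_2)$ (each $V(G_i)$ identified with its copy); $M_1\otimes M_2=(E_1\cup(E_2+V(G_1)),G_1\oplus G_2)$, where $X+Y=\{x+y:x\in X,y\in Y\}$. -}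

module Defs where

open import Data.Bool using (Bool; true; false; _∧_; _∨_; not; _xor_)
open import Data.Nat using (ℕ; zero; suc; _+_; _≤_)
open import Data.Nat.Divisibility using (_∣_)
open import Data.Vec using (Vec; []; _∷_; replicate; zipWith; take; drop)
open import Data.List using (List; []; _∷_; map; _++_)
open import Data.Product using (Σ; _×_; _,_; ∃)
open import Data.Empty using (⊥)
open import Relation.Nullary using (¬_)
open import Relation.Binary.PropositionalEquality using (_≡_; refl)

-- The vector space F₂ⁿ, modelled as Vec Bool n (true = 1, xor = addition).
V : ℕ → Set
V n = Vec Bool n

0v : (n : ℕ) → V n
0v n = replicate n false

_⊕_ : {n : ℕ} → V n → V n → V n
_⊕_ = zipWith _xor_

nz : {n : ℕ} → V n → Bool
nz [] = false
nz (b ∷ x) = b ∨ nz x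

nz-0 : (n : ℕ) → nz (0v n) ≡ false
nz-0 zero = refl
nz-0 (suc n) = nz-0 n

-- A matroid (E, G) with G = F₂ⁿ ∖ {0}; E is given as a decidable subset of
-- V n which does not contain 0 (so E ⊆ G).  n = dim is the dimension.
record Matroid : Set where
  constructor mkMatroid
  field
    dim   : ℕ
    E     : V dim → Bool
    0∉E   : E (0v dim) ≡ false
open Matroid public

-- Additive maps between F₂-vector spaces (= F₂-linear maps).
IsLinear : {m n : ℕ} → (V m → V n) → Set
IsLinear f = ∀ x y → f (x ⊕ y) ≡ f x ⊕ f y

IsInjective : {m n : ℕ} → (V m → V n) → Set
IsInjective f = ∀ x y → f x ≡ f y → x ≡ y

Iso : Matroid → Matroid → Set
Iso M₁ M₂ =
  Σ (V (dim M₁) → V (dim M₂)) λ f →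
  Σ (V (dim M₂) → V (dim M₁)) λ g →
    IsLinear f × (∀ x → g (f x) ≡ x) × (∀ y → f (g y) ≡ y)
    × (∀ x → E M₂ (f x) ≡ E M₁ x)

-- A d-dimensional flat F of G = F₂ⁿ∖{0} is given by an injective linear map
-- L : F₂ᵈ → F₂ⁿ whose image is F ∪ {0}.  The restriction M|F is, up to the
-- linear isomorphism L : F₂ᵈ ≅ F ∪ {0}, the matroid (L⁻¹(E), F₂ᵈ∖{0}).
restrict : (M : Matroid) {d : ℕ} (L : V d → V (dim M)) → Matroid
restrict M {d} L = mkMatroid d (λ x → nz x ∧ E M (L x)) (helper (nz-0 d))
  where
  helper : ∀ {b c} → b ≡ false → b ∧ c ≡ false
  helper refl = refl

Independent3 : {n : ℕ} → V n → V n → V n → Set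
Independent3 {n} b₁ b₂ b₃ = ∀ (c₁ c₂ c₃ : Bool) →
  ((c₁ ∷ c₂ ∷ c₃ ∷ []) ≢0) →
  ¬ (sc c₁ b₁ ⊕ (sc c₂ b₂ ⊕ sc c₃ b₃) ≡ 0v n)
  where
  _≢0 : V 3 → Set
  c ≢0 = nz c ≡ true
  sc : Bool → V n → V n
  sc true v = v
  sc false _ = 0v n

eqV : {n : ℕ} → V n → V n → Bool
eqV [] [] = true
eqV (a ∷ x) (b ∷ y) = not (a xor b) ∧ eqV x y

claw : (b₁ b₂ b₃ : V 3) → Matroid
claw b₁ b₂ b₃ = mkMatroid 3
  (λ x → nz x ∧ (eqV x b₁ ∨ eqV x b₂ ∨ eqV x b₃)) refl

ClawFree : Matroid → Set
ClawFree M = ∀ (L : V 3 → V (dim M)) → IsLinear L → IsInjective L →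
  ∀ (b₁ b₂ b₃ : V 3) → Independent3 b₁ b₂ b₃ →
  ¬ Iso (restrict M L) (claw b₁ b₂ b₃)

ω≤ : Matroid → ℕ → Set
ω≤ M s = ∀ (d : ℕ) (L : V d → V (dim M)) → IsLinear L → IsInjective L →
  (∀ x → nz x ≡ true → E M (L x) ≡ true) → d ≤ s

allV : (n : ℕ) → List (V n)
allV zero = [] ∷ []
allV (suc n) = map (false ∷_) (allV n) ++ map (true ∷_) (allV n)

countT : List Bool → ℕ
countT [] = 0
countT (true ∷ bs) = suc (countT bs)
countT (false ∷ bs) = countT bs

-- Even-plane: |E ∩ P| is even for every plane P (P ∪ {0} = image of an
-- injective linear L : F₂³ → F₂ⁿ; |E ∩ P| = #{x ≠ 0 : L x ∈ E}).
EvenPlane : Matroid → Set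
EvenPlane M = ∀ (L : V 3 → V (dim M)) → IsLinear L → IsInjective L →
  2 ∣ countT (map (λ x → nz x ∧ E M (L x)) (allV 3))

-- Lift-join: V(G₁) ⊕ V(G₂) = F₂^(n₁+n₂), vectors written u ++ v.
-- E = E₁ ∪ (E₂ + V(G₁)) : (u,0) with u ∈ E₁, or (u,v) with v ∈ E₂.
_⊗_ : Matroid → Matroid → Matroid
M₁ ⊗ M₂ = mkMatroid (dim M₁ + dim M₂) Ej (helper (nz-0 (dim M₁ + dim M₂)))
  where
  Ej : V (dim M₁ + dim M₂) → Bool
  Ej w = nz w ∧ ((not (nz (drop (dim M₁) w)) ∧ E M₁ (take (dim M₁) w))
                 ∨ E M₂ (drop (dim M₁) w))
  helper : ∀ {b c} → b ≡ false → b ∧ c ≡ false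
  helper refl = refl

iterJoin : {m : ℕ} → Vec Matroid (suc m) → Matroid
iterJoin (M ∷ Ms) = go M Ms
  where
  go : {j : ℕ} → Matroid → Vec Matroid j → Matroid
  go acc [] = acc
  go acc (N ∷ Ns) = go (acc ⊗ N) Ns

-- Let f be the indicator of E. A proper nonzero subspace W with f (x + w) = f x for all x ∉ W and w ∈ W (a decomposer)
-- splits M as a lift-join, so it suffices to show that a claw-free M of large dimension with ω(M) ≤ s has a decomposer or
-- is even-plane. By Ramsey's theorem over F₂ there is a subspace F missing E of dimension > s; take F maximal. Claw-freeness
-- makes E ∩ (v + F) a coset of a subspace Dir v ≤ F for v ∈ E, and two incomparable Dir v, Dir w meet in index 2 in both.
-- A subspace 0 < U < F comparable with every Dir v (a cut) yields a decomposer. If there is none, then the Dir v of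
-- order 2 fill F and produce a flat in E of dimension > s, which is impossible, or do not occur at all. Then the v with
-- Dir v = 0 form a decomposer together with 0, and if there are none, every Dir v has index at most 2 in F, so that
-- β x u = f x + f (x + u) is linear in u ∈ F. Either the failure of linearity in x gives a decomposer, or β is bilinear;
-- then x, y, z can be shifted inside their cosets of F until claw-freeness shows that the third differences of f at 0
-- vanish, that is, that M is even-plane. In the resulting iterated lift-join each term with E ≠ ∅ contributes one dimension
-- to a flat in E, so there are at most s of them; the terms with E = ∅ between them are merged.
module Submission where

open import Defs
open import Data.Bool using (Bool; true; false; _xor_; _∧_; _∨_; not; if_then_else_)
import Data.Bool.Properties as Boolₚ
open import Data.Empty using (⊥; ⊥-elim)
open import Data.Fin using (Fin; zero; suc; splitAt; _↑ˡ_; _↑ʳ_)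
open import Data.Fin.Properties using (splitAt-↑ˡ; splitAt-↑ʳ; splitAt⁻¹-↑ˡ; splitAt⁻¹-↑ʳ; pigeonhole; <⇒≢)
open import Data.List as List using (List; []; _∷_; filter)
open import Data.List.Membership.Propositional using () renaming (_∈_ to _∈ₗ_)
import Data.List.Membership.Propositional.Properties as ∈ₗ
open import Data.List.Relation.Unary.Any using (here; there)
open import Data.Nat using (ℕ; zero; suc; _+_; _*_; _∸_; _≤_; _<_; _≤?_; z≤n; s≤s)
open import Data.Nat.Divisibility using (_∣_; _∣0; ∣m∣n⇒∣m+n; ∣-refl)
open import Data.Nat.Properties using (≤-refl; ≤-trans; ≤-pred; ≰⇒>; 1+n≰n; m≤m+n; m≤n+m; m<m+n; m<n+m; m∸n+n≡m; +-suc; +-monoˡ-≤)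
open import Data.Product using (Σ; _×_; _,_; ∃; proj₁; proj₂)
open import Data.Sum using (_⊎_; inj₁; inj₂; [_,_]′)
open import Data.Vec using (Vec; []; _∷_; lookup; take; drop; _++_)
import Data.Vec.Properties as Vecₚ
open import Data.Vec.Relation.Unary.All using (All; []; _∷_)
open import Function using (_∘_; id)
open import Level using (Level)
open import Relation.Binary.PropositionalEquality using (_≡_; _≢_; refl; sym; trans; cong; cong₂; subst; setoid; module ≡-Reasoning)
open import Relation.Nullary using (¬_; Dec; yes; no)
open import Relation.Nullary.Decidable using (map′; ¬?; _×-dec_; _⊎-dec_; _→-dec_; decidable-stable)

-- Maximality of F says that every coset of F other than F itself meets E, so any vector outside F
-- can be moved into E inside its coset; all the case analysis lives on these cosets. E misses F, so
-- two elements of E in one coset never have their sum in E, and claw-freeness then applies with few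
-- conditions left to check. The order of Dir v decides the case distinction. Index 2 of the
-- intersection guarantees a nonzero vector common to two incomparable directions only when these
-- have order at least 4, and such a vector is what builds the cuts; orders 1 and 2 therefore need
-- arguments of their own. The dimension s + 1 of the E-free subspace is chosen so that a linear
-- section over it, in the case of order 2, is a flat that the bound on ω forbids.

-- A solver for identities between sums in a group of exponent 2: it compares the F₂-coefficients of both sides.
module ExponentTwo {A : Set} (_∙_ : A → A → A) (ε : A)
  (assoc : ∀ x y z → (x ∙ y) ∙ z ≡ x ∙ (y ∙ z))
  (comm : ∀ x y → x ∙ y ≡ y ∙ x)
  (identityʳ : ∀ x → x ∙ ε ≡ x)
  (self : ∀ x → x ∙ x ≡ ε) where

  infixr 6 _:+_

  data Expr (n : ℕ) : Set where
    var  : Fin n → Expr n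
    :0   : Expr n
    _:+_ : Expr n → Expr n → Expr n

  ⟦_⟧ : ∀ {n} → Expr n → Vec A n → A
  ⟦ var i ⟧ ρ = lookup ρ i
  ⟦ :0 ⟧ ρ = ε
  ⟦ e :+ e′ ⟧ ρ = ⟦ e ⟧ ρ ∙ ⟦ e′ ⟧ ρ

  unit : ∀ {n} → Fin n → Vec Bool n
  unit {suc n} zero = true ∷ 0v n
  unit (suc i) = false ∷ unit i

  coefficients : ∀ {n} → Expr n → Vec Bool n
  coefficients (var i) = unit i
  coefficients {n} :0 = 0v n
  coefficients (e :+ e′) = coefficients e ⊕ coefficients e′

  combination : ∀ {n} → Vec Bool n → Vec A n → A
  combination [] [] = ε
  combination (true ∷ cs) (x ∷ xs) = x ∙ combination cs xs
  combination (false ∷ cs) (x ∷ xs) = combination cs xs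

  identityˡ : ∀ x → ε ∙ x ≡ x
  identityˡ x = trans (comm ε x) (identityʳ x)

  combination-0 : ∀ {n} (xs : Vec A n) → combination (0v n) xs ≡ ε
  combination-0 [] = refl
  combination-0 (x ∷ xs) = combination-0 xs

  combination-unit : ∀ {n} (i : Fin n) (xs : Vec A n) → combination (unit i) xs ≡ lookup xs i
  combination-unit zero (x ∷ xs) = trans (cong (x ∙_) (combination-0 xs)) (identityʳ x)
  combination-unit (suc i) (x ∷ xs) = combination-unit i xs

  exchange : ∀ w x y z → (w ∙ x) ∙ (y ∙ z) ≡ (w ∙ y) ∙ (x ∙ z)
  exchange w x y z = begin
    (w ∙ x) ∙ (y ∙ z) ≡⟨ assoc w x (y ∙ z) ⟩
    w ∙ (x ∙ (y ∙ z)) ≡⟨ cong (w ∙_) (sym (assoc x y z)) ⟩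
    w ∙ ((x ∙ y) ∙ z) ≡⟨ cong (λ t → w ∙ (t ∙ z)) (comm x y) ⟩
    w ∙ ((y ∙ x) ∙ z) ≡⟨ cong (w ∙_) (assoc y x z) ⟩
    w ∙ (y ∙ (x ∙ z)) ≡⟨ sym (assoc w y (x ∙ z)) ⟩
    (w ∙ y) ∙ (x ∙ z) ∎
    where open ≡-Reasoning

  combination-⊕ : ∀ {n} (cs ds : Vec Bool n) (xs : Vec A n) →
    combination (cs ⊕ ds) xs ≡ combination cs xs ∙ combination ds xs
  combination-⊕ [] [] [] = sym (identityʳ ε)
  combination-⊕ (false ∷ cs) (false ∷ ds) (x ∷ xs) = combination-⊕ cs ds xs
  combination-⊕ (true ∷ cs) (false ∷ ds) (x ∷ xs) =
    trans (cong (x ∙_) (combination-⊕ cs ds xs)) (sym (assoc x _ _))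
  combination-⊕ (false ∷ cs) (true ∷ ds) (x ∷ xs) = begin
    x ∙ combination (cs ⊕ ds) xs ≡⟨ cong (x ∙_) (combination-⊕ cs ds xs) ⟩
    x ∙ (c ∙ d)                  ≡⟨ sym (assoc x c d) ⟩
    (x ∙ c) ∙ d                  ≡⟨ cong (_∙ d) (comm x c) ⟩
    (c ∙ x) ∙ d                  ≡⟨ assoc c x d ⟩
    c ∙ (x ∙ d) ∎
    where
    open ≡-Reasoning
    c = combination cs xs
    d = combination ds xs
  combination-⊕ (true ∷ cs) (true ∷ ds) (x ∷ xs) = begin
    combination (cs ⊕ ds) xs ≡⟨ combination-⊕ cs ds xs ⟩
    c ∙ d                    ≡⟨ sym (identityˡ (c ∙ d)) ⟩
    ε ∙ (c ∙ d)              ≡⟨ cong (_∙ (c ∙ d)) (sym (self x)) ⟩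
    (x ∙ x) ∙ (c ∙ d)        ≡⟨ exchange x x c d ⟩
    (x ∙ c) ∙ (x ∙ d) ∎
    where
    open ≡-Reasoning
    c = combination cs xs
    d = combination ds xs

  correct : ∀ {n} (e : Expr n) (ρ : Vec A n) → combination (coefficients e) ρ ≡ ⟦ e ⟧ ρ
  correct (var i) ρ = combination-unit i ρ
  correct :0 ρ = combination-0 ρ
  correct (e :+ e′) ρ = trans (combination-⊕ (coefficients e) (coefficients e′) ρ)
    (cong₂ _∙_ (correct e ρ) (correct e′ ρ))

  open import Relation.Binary.Reflection (setoid A) var ⟦_⟧ (combination ∘ coefficients) correct
    public using (solve; _⊜_)

-- Vectors over F₂

⊕-assoc : ∀ {n} (x y z : V n) → (x ⊕ y) ⊕ z ≡ x ⊕ (y ⊕ z)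
⊕-assoc = Vecₚ.zipWith-assoc Boolₚ.xor-assoc

⊕-comm : ∀ {n} (x y : V n) → x ⊕ y ≡ y ⊕ x
⊕-comm = Vecₚ.zipWith-comm Boolₚ.xor-comm

⊕-identityʳ : ∀ {n} (x : V n) → x ⊕ 0v n ≡ x
⊕-identityʳ = Vecₚ.zipWith-identityʳ Boolₚ.xor-identityʳ

⊕-self : ∀ {n} (x : V n) → x ⊕ x ≡ 0v n
⊕-self [] = refl
⊕-self (b ∷ x) = cong₂ _∷_ (Boolₚ.xor-same b) (⊕-self x)

module VSolver {n : ℕ} = ExponentTwo (_⊕_ {n}) (0v n) ⊕-assoc ⊕-comm ⊕-identityʳ ⊕-self
module BSolver = ExponentTwo _xor_ false Boolₚ.xor-assoc Boolₚ.xor-comm Boolₚ.xor-identityʳ Boolₚ.xor-same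

open VSolver using (_:+_; :0; _⊜_; solve)

⊕-identityˡ : ∀ {n} (x : V n) → 0v n ⊕ x ≡ x
⊕-identityˡ {n} = VSolver.identityˡ

⊕-cancel : ∀ {n} (x y : V n) → (x ⊕ y) ⊕ y ≡ x
⊕-cancel = solve 2 (λ x y → (x :+ y) :+ y ⊜ x) refl

≢⇒⊕≢0 : ∀ {n} {x y : V n} → x ≢ y → x ⊕ y ≢ 0v n
≢⇒⊕≢0 {n} {x} {y} x≢y eq = x≢y (trans (sym (⊕-cancel x y)) (trans (cong (_⊕ y) eq) (⊕-identityˡ y)))

infix 4 _≟ᵥ_
_≟ᵥ_ : ∀ {n} (x y : V n) → Dec (x ≡ y)
_≟ᵥ_ = Vecₚ.≡-dec Boolₚ._≟_

nz-false : ∀ {n} (x : V n) → nz x ≡ false → x ≡ 0v n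
nz-false [] _ = refl
nz-false (false ∷ x) eq = cong (false ∷_) (nz-false x eq)

nz-true : ∀ {n} {x : V n} → nz x ≡ true → x ≢ 0v n
nz-true {n} nzx refl with trans (sym nzx) (nz-0 n)
... | ()

≢0⇒nz : ∀ {n} {x : V n} → x ≢ 0v n → nz x ≡ true
≢0⇒nz {x = x} x≢0 with nz x in eq
... | true = refl
... | false = ⊥-elim (x≢0 (nz-false x eq))

bool-cases : (b : Bool) → b ≡ true ⊎ b ≡ false
bool-cases true = inj₁ refl
bool-cases false = inj₂ refl

true≢false : ∀ {b} → b ≡ true → b ≡ false → ⊥
true≢false refl ()

¬true⇒false : ∀ {b} → ¬ b ≡ true → b ≡ false
¬true⇒false = Boolₚ.¬-not

¬false⇒true : ∀ {b} → ¬ b ≡ false → b ≡ true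
¬false⇒true = Boolₚ.¬-not

-- Finite search, subspaces and spans

private variable
  ℓ ℓ′ : Level

∃? : ∀ {n} {P : V n → Set ℓ} → (∀ x → Dec (P x)) → Dec (∃ P)
∃? {n = zero} P? = map′ ([] ,_) (λ { ([] , p) → p }) (P? [])
∃? {n = suc n} P? =
  map′ [ (λ (x , p) → false ∷ x , p) , (λ (x , p) → true ∷ x , p) ]′
       (λ { (false ∷ x , p) → inj₁ (x , p) ; (true ∷ x , p) → inj₂ (x , p) })
       (∃? (λ x → P? (false ∷ x)) ⊎-dec ∃? (λ x → P? (true ∷ x)))

∀? : ∀ {n} {P : V n → Set ℓ} → (∀ x → Dec (P x)) → Dec (∀ x → P x)
∀? P? = map′ (λ ¬∃ x → decidable-stable (P? x) (λ ¬p → ¬∃ (x , ¬p)))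
             (λ all (x , ¬p) → ¬p (all x))
             (¬? (∃? (λ x → ¬? (P? x))))

-- Serves where the first alternative, such as `Decomposer f`, comes without a decision procedure,
-- so that `∃?` cannot search for it.
choose : ∀ {n} {A : Set ℓ} {P : V n → Set ℓ′} → (∀ x → A ⊎ P x) → A ⊎ (∀ x → P x)
choose {n = zero} h with h []
... | inj₁ a = inj₁ a
... | inj₂ p = inj₂ λ { [] → p }
choose {n = suc n} h with choose (λ x → h (false ∷ x)) | choose (λ x → h (true ∷ x))
... | inj₁ a | _ = inj₁ a
... | inj₂ _ | inj₁ a = inj₁ a
... | inj₂ p | inj₂ q = inj₂ λ { (false ∷ x) → p x ; (true ∷ x) → q x }

record Subspace (n : ℕ) : Set₁ where
  field
    Mem  : V n → Set
    Mem? : ∀ x → Dec (Mem x)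
    0∈   : Mem (0v n)
    ⊕∈   : ∀ {x y} → Mem x → Mem y → Mem (x ⊕ y)

allV-complete : ∀ {n} (x : V n) → x ∈ₗ allV n
allV-complete [] = here refl
allV-complete (false ∷ x) = ∈ₗ.∈-++⁺ˡ (∈ₗ.∈-map⁺ (false ∷_) (allV-complete x))
allV-complete {suc n} (true ∷ x) =
  ∈ₗ.∈-++⁺ʳ (List.map (false ∷_) (allV n)) (∈ₗ.∈-map⁺ (true ∷_) (allV-complete x))

-- Using each generator at most once gives all combinations over F₂, and membership is decided by
-- recursion on the list.
Span : ∀ {n} → List (V n) → V n → Set
Span {n} [] x = x ≡ 0v n
Span (g ∷ gs) x = Span gs x ⊎ Span gs (x ⊕ g)

Span? : ∀ {n} (gs : List (V n)) x → Dec (Span gs x)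
Span? [] x = x ≟ᵥ _
Span? (g ∷ gs) x = Span? gs x ⊎-dec Span? gs (x ⊕ g)

0∈Span : ∀ {n} (gs : List (V n)) → Span gs (0v n)
0∈Span [] = refl
0∈Span (g ∷ gs) = inj₁ (0∈Span gs)

Span-⊕ : ∀ {n} (gs : List (V n)) {x y} → Span gs x → Span gs y → Span gs (x ⊕ y)
Span-⊕ [] refl refl = ⊕-self _
Span-⊕ (g ∷ gs) (inj₁ p) (inj₁ q) = inj₁ (Span-⊕ gs p q)
Span-⊕ (g ∷ gs) {x} {y} (inj₁ p) (inj₂ q) =
  inj₂ (subst (Span gs) (sym (⊕-assoc x y g)) (Span-⊕ gs p q))
Span-⊕ (g ∷ gs) {x} {y} (inj₂ p) (inj₁ q) =
  inj₂ (subst (Span gs) (solve 3 (λ x y g → (x :+ g) :+ y ⊜ (x :+ y) :+ g) refl x y g) (Span-⊕ gs p q))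
Span-⊕ (g ∷ gs) {x} {y} (inj₂ p) (inj₂ q) =
  inj₁ (subst (Span gs) (solve 3 (λ x y g → (x :+ g) :+ (y :+ g) ⊜ x :+ y) refl x y g) (Span-⊕ gs p q))

Span-ind : ∀ {n} {P : V n → Set ℓ} (gs : List (V n)) → P (0v n) →
  (∀ {x g} → g ∈ₗ gs → P x → P (x ⊕ g)) → ∀ {x} → Span gs x → P x
Span-ind [] p0 step refl = p0
Span-ind (g ∷ gs) p0 step (inj₁ s) = Span-ind gs p0 (step ∘ there) s
Span-ind {P = P} (g ∷ gs) p0 step {x} (inj₂ s) =
  subst P (⊕-cancel x g) (step (here refl) (Span-ind {P = P} gs p0 (step ∘ there) s))

∈⇒Span : ∀ {n} {gs : List (V n)} {g} → g ∈ₗ gs → Span gs g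
∈⇒Span {gs = g ∷ gs} (here refl) = inj₂ (subst (Span gs) (sym (⊕-self g)) (0∈Span gs))
∈⇒Span (there i) = inj₁ (∈⇒Span i)

span : ∀ {n} → List (V n) → Subspace n
span gs = record { Mem = Span gs ; Mem? = Span? gs ; 0∈ = 0∈Span gs ; ⊕∈ = Span-⊕ gs }

-- Claw-free functions, decomposers and third differences

ClawFreeFun : ∀ {n} → (V n → Bool) → Set
ClawFreeFun f = ∀ {a b c} → a ≢ b → a ≢ c → b ≢ c →
  f a ≡ true → f b ≡ true → f c ≡ true →
  f (a ⊕ b) ≡ false → f (a ⊕ c) ≡ false → f (b ⊕ c) ≡ false →
  f (a ⊕ (b ⊕ c)) ≡ true

-- A homogeneous subspace: E is a union of cosets off W, which is what a lift-join decomposition amounts to.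
record Decomposer {n} (f : V n → Bool) : Set₁ where
  field
    W         : Subspace n
  open Subspace W public
  field
    inside    : V n
    inside∈   : Mem inside
    inside≢0  : inside ≢ 0v n
    outside   : V n
    outside∉  : ¬ Mem outside
    invariant : ∀ {x w} → ¬ Mem x → Mem w → f (x ⊕ w) ≡ f x

module _ {n : ℕ} (f : V n → Bool) where
  open BSolver using () renaming (_:+_ to _∔_; _⊜_ to _≜_; solve to solveᵇ)

  -- The third difference of f at 0, up to f 0; it vanishes identically iff f + f 0 is a quadratic form.
  cubic : V n → V n → V n → Bool
  cubic x y z = f (x ⊕ (y ⊕ z)) xor (f (x ⊕ y) xor (f (x ⊕ z) xor (f (y ⊕ z) xor (f x xor (f y xor f z)))))

  cubic-args : ∀ {x y z p q r s} → x ⊕ (y ⊕ z) ≡ p → x ⊕ y ≡ q → x ⊕ z ≡ r → y ⊕ z ≡ s →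
    cubic x y z ≡ f p xor (f q xor (f r xor (f s xor (f x xor (f y xor f z)))))
  cubic-args refl refl refl refl = refl

  cubic-swap₁₂ : ∀ x y z → cubic x y z ≡ cubic y x z
  cubic-swap₁₂ x y z = trans
    (cubic-args (solve 3 (λ x y z → x :+ (y :+ z) ⊜ y :+ (x :+ z)) refl x y z) (⊕-comm x y) refl refl)
    (solveᵇ 7 (λ p q r s a b c → p ∔ (q ∔ (r ∔ (s ∔ (a ∔ (b ∔ c))))) ≜ p ∔ (q ∔ (s ∔ (r ∔ (b ∔ (a ∔ c))))))
      refl (f (y ⊕ (x ⊕ z))) (f (y ⊕ x)) (f (x ⊕ z)) (f (y ⊕ z)) (f x) (f y) (f z))

  cubic-swap₂₃ : ∀ x y z → cubic x y z ≡ cubic x z y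
  cubic-swap₂₃ x y z = trans
    (cubic-args (cong (x ⊕_) (⊕-comm y z)) refl refl (⊕-comm y z))
    (solveᵇ 7 (λ p q r s a b c → p ∔ (q ∔ (r ∔ (s ∔ (a ∔ (b ∔ c))))) ≜ p ∔ (r ∔ (q ∔ (s ∔ (a ∔ (c ∔ b))))))
      refl (f (x ⊕ (z ⊕ y))) (f (x ⊕ y)) (f (x ⊕ z)) (f (z ⊕ y)) (f x) (f y) (f z))

  cubic-0 : f (0v n) ≡ false → ∀ y z → cubic (0v n) y z ≡ false
  cubic-0 f0 y z = trans (cubic-args (⊕-identityˡ (y ⊕ z)) (⊕-identityˡ y) (⊕-identityˡ z) refl)
    (trans (cong (λ b → f (y ⊕ z) xor (f y xor (f z xor (f (y ⊕ z) xor (b xor (f y xor f z)))))) f0)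
      (solveᵇ 3 (λ p y z → p ∔ (y ∔ (z ∔ (p ∔ (y ∔ z)))) ≜ BSolver.:0) refl (f (y ⊕ z)) (f y) (f z)))

  -- `cubic` sums `f` over the seven nonzero combinations of its arguments, and the substitution
  -- only permutes these.
  cubic-+₂ : ∀ x y z → cubic (x ⊕ y) y z ≡ cubic x y z
  cubic-+₂ x y z = trans
    (cubic-args (solve 3 (λ x y z → (x :+ y) :+ (y :+ z) ⊜ x :+ z) refl x y z) (⊕-cancel x y) (⊕-assoc x y z) refl)
    (solveᵇ 7 (λ p q r s a b c → r ∔ (a ∔ (p ∔ (s ∔ (q ∔ (b ∔ c))))) ≜ p ∔ (q ∔ (r ∔ (s ∔ (a ∔ (b ∔ c))))))
      refl (f (x ⊕ (y ⊕ z))) (f (x ⊕ y)) (f (x ⊕ z)) (f (y ⊕ z)) (f x) (f y) (f z))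

  cubic-+₃ : ∀ x y z → cubic (x ⊕ z) y z ≡ cubic x y z
  cubic-+₃ x y z = trans (cubic-swap₂₃ (x ⊕ z) y z) (trans (cubic-+₂ x z y) (cubic-swap₂₃ x z y))

  -- Both sides equal the sum of `f` over the fifteen nonzero combinations of `x`, `w`, `y`, `z`,
  -- which is symmetric in the four vectors.
  fourth-difference : ∀ x w y z →
    cubic (x ⊕ w) y z xor (cubic x y z xor cubic w y z) ≡ cubic (x ⊕ y) w z xor (cubic x w z xor cubic y w z)
  fourth-difference x w y z = trans
    (cong₂ _xor_ (cubic-args (⊕-assoc x w (y ⊕ z)) (⊕-assoc x w y) (⊕-assoc x w z) refl) refl)
    (trans
      (solveᵇ 15 (λ x w y z xw xy xz wy wz yz xwy xwz xyz wyz xwyz →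
        (xwyz ∔ (xwy ∔ (xwz ∔ (yz ∔ (xw ∔ (y ∔ z))))))
          ∔ ((xyz ∔ (xy ∔ (xz ∔ (yz ∔ (x ∔ (y ∔ z)))))) ∔ (wyz ∔ (wy ∔ (wz ∔ (yz ∔ (w ∔ (y ∔ z)))))))
        ≜ (xwyz ∔ (xwy ∔ (xyz ∔ (wz ∔ (xy ∔ (w ∔ z))))))
          ∔ ((xwz ∔ (xw ∔ (xz ∔ (wz ∔ (x ∔ (w ∔ z)))))) ∔ (wyz ∔ (wy ∔ (yz ∔ (wz ∔ (y ∔ (w ∔ z)))))))) refl
        (f x) (f w) (f y) (f z) (f (x ⊕ w)) (f (x ⊕ y)) (f (x ⊕ z)) (f (w ⊕ y)) (f (w ⊕ z)) (f (y ⊕ z))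
        (f (x ⊕ (w ⊕ y))) (f (x ⊕ (w ⊕ z))) (f (x ⊕ (y ⊕ z))) (f (w ⊕ (y ⊕ z))) (f (x ⊕ (w ⊕ (y ⊕ z)))))
      (sym (cong₂ _xor_
        (cubic-args (solve 4 (λ x w y z → (x :+ y) :+ (w :+ z) ⊜ x :+ (w :+ (y :+ z))) refl x w y z)
          (solve 3 (λ x w y → (x :+ y) :+ w ⊜ x :+ (w :+ y)) refl x w y) (⊕-assoc x y z) refl)
        (cong (cubic x w z xor_)
          (cubic-args (solve 3 (λ w y z → y :+ (w :+ z) ⊜ w :+ (y :+ z)) refl w y z) (⊕-comm y w) refl refl)))))

-- Linear maps and flats inside E

++-⊕ : ∀ {m n} (p q : V m) (x y : V n) → (p ++ x) ⊕ (q ++ y) ≡ (p ⊕ q) ++ (x ⊕ y)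
++-⊕ p q x y = Vecₚ.zipWith-++ _xor_ p x q y

0++0 : ∀ m n → 0v m ++ 0v n ≡ 0v (m + n)
0++0 zero n = refl
0++0 (suc m) n = cong (false ∷_) (0++0 m n)

++≡0 : ∀ {m n} (p : V m) {x : V n} → p ++ x ≡ 0v (m + n) → p ≡ 0v m × x ≡ 0v n
++≡0 {m} {n} p eq = Vecₚ.++-injective p (0v m) (trans eq (sym (0++0 m n)))

scale : ∀ {n} → Bool → V n → V n
scale true v = v
scale false v = 0v _

scale-xor : ∀ {n} s t (v : V n) → scale (s xor t) v ≡ scale s v ⊕ scale t v
scale-xor true true v = sym (⊕-self v)
scale-xor true false v = sym (⊕-identityʳ v)
scale-xor false t v = sym (⊕-identityˡ _)

linear-0 : ∀ {m n} (L : V m → V n) → IsLinear L → L (0v m) ≡ 0v n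
linear-0 {m} L lin = trans (cong L (sym (⊕-self (0v m)))) (trans (lin _ _) (⊕-self _))

TrivialKernel : ∀ {m n} → (V m → V n) → Set
TrivialKernel {m} {n} L = ∀ h → L h ≡ 0v n → h ≡ 0v m

trivial-kernel⇒injective : ∀ {m n} {L : V m → V n} → IsLinear L → TrivialKernel L → IsInjective L
trivial-kernel⇒injective {L = L} lin inj x y eq with x ≟ᵥ y
... | yes p = p
... | no x≢y = ⊥-elim (≢⇒⊕≢0 x≢y (inj _ (trans (lin x y) (trans (cong (_⊕ L y) eq) (⊕-self _)))))

extendBy : ∀ {m n} → (V m → V n) → V n → V (suc m) → V n
extendBy L v (s ∷ h) = L h ⊕ scale s v

extendBy-linear : ∀ {m n} (L : V m → V n) v → IsLinear L → IsLinear (extendBy L v)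
extendBy-linear L v lin (s ∷ x) (t ∷ y) = trans (cong₂ _⊕_ (lin x y) (scale-xor s t v))
  (solve 4 (λ a b c d → (a :+ b) :+ (c :+ d) ⊜ (a :+ c) :+ (b :+ d)) refl (L x) (L y) (scale s v) (scale t v))

extendBy-kernel : ∀ {m n} (L : V m → V n) v → TrivialKernel L → (∀ h → L h ⊕ v ≢ 0v n) → TrivialKernel (extendBy L v)
extendBy-kernel L v inj off (false ∷ h) eq = cong (false ∷_) (inj h (trans (sym (⊕-identityʳ _)) eq))
extendBy-kernel L v inj off (true ∷ h) eq = ⊥-elim (off h eq)

-- When `f` vanishes at 0, such a `G` has trivial kernel, so exactly the t-dimensional flats inside
-- E are excluded.
NoFlat : ∀ {n} → (V n → Bool) → ℕ → Set
NoFlat {n} f t = ∀ (G : V t → V n) → IsLinear G → ¬ (∀ {h} → h ≢ 0v t → f (G h) ≡ true)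

NoFlat-∘ : ∀ {m n t} {f : V n → Bool} (L : V m → V n) → IsLinear L → NoFlat f t → NoFlat (f ∘ L) t
NoFlat-∘ L lin none G G-lin = none (L ∘ G) (λ x y → trans (cong L (G-lin x y)) (lin _ _))

-- Directions of E along the cosets of a maximal E-free subspace

module Cosets {n : ℕ} (f : V n → Bool) (f0 : f (0v n) ≡ false) (claw-free : ClawFreeFun f)
  (F : Subspace n)
  (F-empty : ∀ {u} → Subspace.Mem F u → f u ≡ false)
  (F-maximal : ∀ v → ¬ Subspace.Mem F v → ∃ λ d → Subspace.Mem F d × f (v ⊕ d) ≡ true) where

  open Subspace F renaming (Mem to InF; Mem? to InF?; 0∈ to 0∈F; ⊕∈ to ⊕∈F)

  at : ∀ {b x y} → x ≡ y → f x ≡ b → f y ≡ b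
  at eq p = trans (cong f (sym eq)) p

  -- For v ∈ E, the set E ∩ (v + F) is v + Dir v.
  Dir : V n → V n → Set
  Dir v d = InF d × f (v ⊕ d) ≡ true

  Dir? : ∀ v d → Dec (Dir v d)
  Dir? v d = InF? d ×-dec (f (v ⊕ d) Boolₚ.≟ true)

  ¬Dir⇒false : ∀ {v d} → InF d → ¬ Dir v d → f (v ⊕ d) ≡ false
  ¬Dir⇒false d∈F ¬dir = ¬true⇒false λ eq → ¬dir (d∈F , eq)

  E⇒∉F : ∀ {v} → f v ≡ true → ¬ InF v
  E⇒∉F fv v∈F = true≢false fv (F-empty v∈F)

  ∈F-⊕ʳ : ∀ {x y} → InF (x ⊕ y) → InF y → InF x
  ∈F-⊕ʳ {x} {y} p q = subst InF (⊕-cancel x y) (⊕∈F p q)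

  Dir-0 : ∀ {v} → f v ≡ true → Dir v (0v n)
  Dir-0 {v} fv = 0∈F , at (sym (⊕-identityʳ v)) fv

  -- The vectors `v`, `v ⊕ d`, `v ⊕ e` lie in E and their pairwise sums in `F`, so claw-freeness
  -- puts their total `v ⊕ (d ⊕ e)` into E.
  Dir-⊕ : ∀ {v d e} → f v ≡ true → Dir v d → Dir v e → Dir v (d ⊕ e)
  Dir-⊕ {v} {d} {e} fv (d∈ , fd) (e∈ , fe) with d ≟ᵥ 0v n | e ≟ᵥ 0v n | d ≟ᵥ e
  ... | yes refl | _ | _ = ⊕∈F d∈ e∈ , at (solve 2 (λ v e → v :+ e ⊜ v :+ (:0 :+ e)) refl v e) fe
  ... | no _ | yes refl | _ = ⊕∈F d∈ e∈ , at (solve 2 (λ v d → v :+ d ⊜ v :+ (d :+ :0)) refl v d) fd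
  ... | no _ | no _ | yes refl = ⊕∈F d∈ e∈ , at (solve 2 (λ v d → v ⊜ v :+ (d :+ d)) refl v d) fv
  ... | no d≢0 | no e≢0 | no d≢e = ⊕∈F d∈ e∈ ,
    at (solve 3 (λ v d e → v :+ ((v :+ d) :+ (v :+ e)) ⊜ v :+ (d :+ e)) refl v d e)
      (claw-free (λ eq → d≢0 (self-zero d eq)) (λ eq → e≢0 (self-zero e eq))
        (λ eq → d≢e (cancelˡ eq)) fv fd fe
        (at (solve 2 (λ v d → d ⊜ v :+ (v :+ d)) refl v d) (F-empty d∈))
        (at (solve 2 (λ v d → d ⊜ v :+ (v :+ d)) refl v e) (F-empty e∈))
        (at (solve 3 (λ v d e → d :+ e ⊜ (v :+ d) :+ (v :+ e)) refl v d e) (F-empty (⊕∈F d∈ e∈))))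
    where
    cancelˡ : v ⊕ d ≡ v ⊕ e → d ≡ e
    cancelˡ eq = trans (solve 2 (λ v d → d ⊜ v :+ (v :+ d)) refl v d)
      (trans (cong (v ⊕_) eq) (solve 2 (λ v d → v :+ (v :+ d) ⊜ d) refl v e))
    self-zero : ∀ d → v ≡ v ⊕ d → d ≡ 0v n
    self-zero d eq = trans (solve 2 (λ v d → d ⊜ v :+ (v :+ d)) refl v d)
      (trans (cong (v ⊕_) (sym eq)) (⊕-self v))

  Dir-shift : ∀ {v d e} → f v ≡ true → Dir v d → Dir v e → Dir (v ⊕ d) e
  Dir-shift {v} {d} {e} fv p q = proj₁ q , at (sym (⊕-assoc v d e)) (proj₂ (Dir-⊕ fv p q))

  Dir-unshift : ∀ {v d e} → f v ≡ true → Dir v d → Dir (v ⊕ d) e → Dir v e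
  Dir-unshift {v} {d} {e} fv p (e∈ , q) =
    subst (Dir v) (solve 2 (λ d e → d :+ (d :+ e) ⊜ e) refl d e)
      (Dir-⊕ fv p (⊕∈F (proj₁ p) e∈ , at (⊕-assoc v d e) q))

  Dir-split : ∀ {v d e} → f v ≡ true → Dir v d → ¬ Dir v e → ¬ Dir v (d ⊕ e)
  Dir-split {v} {d} {e} fv p ¬q r =
    ¬q (subst (Dir v) (solve 2 (λ d e → d :+ (d :+ e) ⊜ e) refl d e) (Dir-⊕ fv p r))

  -- Claw-freeness for `a`, `a ⊕ d`, `b`: the total `b ⊕ d` is outside E and so is
  -- `a ⊕ (a ⊕ d) = d`, hence one of the two other pairwise sums is in E.
  two-on-coset : ∀ {a b d} → f a ≡ true → f b ≡ true → Dir a d → InF d → f (b ⊕ d) ≡ false →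
    f (a ⊕ b) ≡ true ⊎ f ((a ⊕ b) ⊕ d) ≡ true
  two-on-coset {a} {b} {d} fa fb (_ , fad) d∈ fbd with bool-cases (f (a ⊕ b)) | bool-cases (f ((a ⊕ b) ⊕ d))
  ... | inj₁ p | _ = inj₁ p
  ... | inj₂ _ | inj₁ q = inj₂ q
  ... | inj₂ p | inj₂ q = ⊥-elim (true≢false
    (at (solve 3 (λ a b d → a :+ ((a :+ d) :+ b) ⊜ b :+ d) refl a b d)
      (claw-free a≢ad a≢b ad≢b fa fad fb
        (at (solve 2 (λ a d → d ⊜ a :+ (a :+ d)) refl a d) (F-empty d∈)) p
        (at (solve 3 (λ a b d → (a :+ b) :+ d ⊜ (a :+ d) :+ b) refl a b d) q)))
    fbd)
    where
    a≢ad : a ≢ a ⊕ d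
    a≢ad eq = true≢false fb (at (trans (cong (b ⊕_) d≡0) (⊕-identityʳ b)) fbd)
      where
      d≡0 : d ≡ 0v n
      d≡0 = trans (solve 2 (λ a d → d ⊜ a :+ (a :+ d)) refl a d) (trans (cong (a ⊕_) (sym eq)) (⊕-self a))
    a≢b : a ≢ b
    a≢b refl = true≢false fad fbd
    ad≢b : a ⊕ d ≢ b
    ad≢b refl = true≢false fa (at (⊕-cancel a d) fbd)

  -- The pairwise sums are `a ⊕ t`, `b ⊕ t`, `c ⊕ t`. If `t` were a direction of none of the three,
  -- these sums and the total `t ∈ F` would all avoid E, a claw.
  three-cosets : ∀ {a b c} → f a ≡ true → f b ≡ true → f c ≡ true → InF (a ⊕ (b ⊕ c)) →
    let t = a ⊕ (b ⊕ c) in Dir a t ⊎ Dir b t ⊎ Dir c t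
  three-cosets {a} {b} {c} fa fb fc t∈
    with Dir? a (a ⊕ (b ⊕ c)) | Dir? b (a ⊕ (b ⊕ c)) | Dir? c (a ⊕ (b ⊕ c))
  ... | yes p | _ | _ = inj₁ p
  ... | no _ | yes p | _ = inj₂ (inj₁ p)
  ... | no _ | no _ | yes p = inj₂ (inj₂ p)
  ... | no p | no q | no r = ⊥-elim (true≢false
    (claw-free
      (λ { refl → E⇒∉F fc (subst InF (solve 2 (λ a c → a :+ (a :+ c) ⊜ c) refl a c) t∈) })
      (λ { refl → E⇒∉F fb (subst InF (solve 2 (λ a b → a :+ (b :+ a) ⊜ b) refl a b) t∈) })
      (λ { refl → E⇒∉F fa (subst InF (solve 2 (λ a b → a :+ (b :+ b) ⊜ a) refl a b) t∈) })
      fa fb fc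
      (at (solve 3 (λ a b c → c :+ (a :+ (b :+ c)) ⊜ a :+ b) refl a b c) (¬Dir⇒false t∈ r))
      (at (solve 3 (λ a b c → b :+ (a :+ (b :+ c)) ⊜ a :+ c) refl a b c) (¬Dir⇒false t∈ q))
      (at (solve 3 (λ a b c → a :+ (a :+ (b :+ c)) ⊜ b :+ c) refl a b c) (¬Dir⇒false t∈ p)))
    (F-empty t∈))

  -- Cuts of F and their decomposers

  record Cut : Set₁ where
    field
      U : Subspace n
    open Subspace U public
    field
      U⊆F        : ∀ {d} → Mem d → InF d
      inside     : V n
      inside∈    : Mem inside
      inside≢0   : inside ≢ 0v n
      outside    : V n
      outside∈F  : InF outside
      outside∉   : ¬ Mem outside
      comparable : ∀ {v} → f v ≡ true → (∀ d → Mem d → Dir v d) ⊎ (∀ d → Dir v d → Mem d)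

  -- The decomposer is spanned by U and the v ∈ E with Dir v ⊊ U; it meets F exactly in U.
  module FromCut (C : Cut) where
    open Cut C

    Below : V n → Set
    Below v = f v ≡ true × (∀ d → Dir v d → Mem d) × ∃ λ d → Mem d × ¬ Dir v d

    Generator : V n → Set
    Generator v = Mem v ⊎ Below v

    Generator? : ∀ v → Dec (Generator v)
    Generator? v = Mem? v ⊎-dec ((f v Boolₚ.≟ true) ×-dec
      (∀? (λ d → Dir? v d →-dec Mem? d) ×-dec ∃? (λ d → Mem? d ×-dec ¬? (Dir? v d))))

    generators : List (V n)
    generators = filter Generator? (allV n)

    open Subspace (span generators) using () renaming (Mem to InW; Mem? to InW?; ⊕∈ to ⊕∈W)

    generator⇒W : ∀ {v} → Generator v → InW v
    generator⇒W {v} g = ∈⇒Span (∈ₗ.∈-filter⁺ Generator? (allV-complete v) g)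

    -- Modulo U, the elements of E over the span form a section of V → V / F.
    Located : V n → Set
    Located w = Mem w ⊎ (¬ InF w × ∃ λ c → f c ≡ true × Mem (c ⊕ w) × (∀ d → Dir c d → Mem d))

    -- The induction step of `located`. Maximality of `F` supplies `c` on the coset of `a ⊕ b`; once
    -- `Dir c` is known to lie in `U`, `three-cosets` puts `a ⊕ (b ⊕ c)` into `U`. If instead
    -- `U ⊆ Dir c`, a direction `e` of `c` outside `U` is refuted by `contra`.
    third : ∀ {a b} → f a ≡ true → (∀ d → Dir a d → Mem d) → Below b → ¬ InF (a ⊕ b) →
      ∃ λ c → f c ≡ true × Mem (c ⊕ (a ⊕ b)) × (∀ d → Dir c d → Mem d)
    third {a} {b} fa a⊆U (fb , b⊆U , d , d∈U , d∉b) ab∉F with F-maximal (a ⊕ b) ab∉F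
    ... | t , t∈F , fc = c , fc , subst Mem tt≡ t∈U , c⊆U
      where
      c = (a ⊕ b) ⊕ t
      tt≡ : a ⊕ (b ⊕ c) ≡ c ⊕ (a ⊕ b)
      tt≡ = solve 3 (λ a b t → a :+ (b :+ ((a :+ b) :+ t)) ⊜ ((a :+ b) :+ t) :+ (a :+ b)) refl a b t
      c⊆U : ∀ e → Dir c e → Mem e
      c⊆U with comparable fc
      ... | inj₂ h = h
      ... | inj₁ U⊆c = λ e e∈c → decidable-stable (Mem? e) (contra e e∈c)
        where
        -- Every s ∈ (E ∩ (c + F)) + b lies in E up to any element of Dir c ∖ Dir b, and E ∩ (a + F) is a coset of Dir a ⊆ U.
        contra : ∀ e → Dir c e → ¬ ¬ Mem e
        contra e e∈c e∉U = e∉U (subst Mem (solve 2 (λ d e → d :+ (d :+ e) ⊜ e) refl d e) (⊕∈ d∈U de∈U))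
          where
          e∉b : ¬ Dir b e
          e∉b p = e∉U (b⊆U e p)
          d∈c : Dir c d
          d∈c = U⊆c d d∈U
          T : V n → Set
          T x = f x ≡ true
          pair : ∀ {c′ x} → f c′ ≡ true → Dir c′ x → ¬ Dir b x → T (c′ ⊕ b) ⊎ T ((c′ ⊕ b) ⊕ x)
          pair fc′ x∈ x∉ = two-on-coset fc′ fb x∈ (proj₁ x∈) (¬Dir⇒false (proj₁ x∈) x∉)
          s = c ⊕ b
          s-a : InF (a ⊕ s)
          s-a = subst InF (solve 3 (λ a b t → t ⊜ a :+ (((a :+ b) :+ t) :+ b)) refl a b t) t∈F
          diff : ∀ {x y} → InF (a ⊕ x) → InF (a ⊕ y) → T x → T y → Mem (x ⊕ y)
          diff {x} {y} x∈ y∈ Tx Ty = subst Mem (solve 3 (λ a x y → (a :+ x) :+ (a :+ y) ⊜ x :+ y) refl a x y)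
            (⊕∈ (a⊆U _ (x∈ , at (solve 2 (λ a x → x ⊜ a :+ (a :+ x)) refl a x) Tx))
                (a⊆U _ (y∈ , at (solve 2 (λ a x → x ⊜ a :+ (a :+ x)) refl a y) Ty)))
          cosetF : ∀ {x u} → InF (a ⊕ x) → InF u → InF (a ⊕ (x ⊕ u))
          cosetF {x} {u} x∈ u∈ = subst InF (⊕-assoc a x u) (⊕∈F x∈ u∈)
          s,d : T s ⊎ T (s ⊕ d)
          s,d = pair fc d∈c d∉b
          s,e : T s ⊎ T (s ⊕ e)
          s,e = pair fc e∈c e∉b
          se,d : T (s ⊕ e) ⊎ T ((s ⊕ e) ⊕ d)
          se,d with pair (proj₂ e∈c) (Dir-shift fc e∈c d∈c) d∉b
          ... | inj₁ p = inj₁ (at (solve 3 (λ c b e → (c :+ e) :+ b ⊜ (c :+ b) :+ e) refl c b e) p)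
          ... | inj₂ p = inj₂ (at (cong (_⊕ d) (solve 3 (λ c b e → (c :+ e) :+ b ⊜ (c :+ b) :+ e) refl c b e)) p)
          d∈F = proj₁ d∈c
          e∈F = proj₁ e∈c
          -- In every case two of `s`, `s ⊕ d`, `s ⊕ e`, `(s ⊕ e) ⊕ d` lie in E on the coset of `a`,
          -- so their sum is in `U`. That sum is either `e`, which is excluded, or `d ⊕ e`.
          de∈U : Mem (d ⊕ e)
          de∈U with s,d | s,e | se,d
          ... | inj₁ p | _ | inj₁ q = ⊥-elim (e∉U (subst Mem (solve 2 (λ s e → s :+ (s :+ e) ⊜ e) refl s e)
                  (diff s-a (cosetF s-a e∈F) p q)))
          ... | inj₁ p | _ | inj₂ q = subst Mem (solve 3 (λ s d e → s :+ ((s :+ e) :+ d) ⊜ d :+ e) refl s d e)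
                  (diff s-a (cosetF (cosetF s-a e∈F) d∈F) p q)
          ... | inj₂ p | inj₁ q | inj₁ r = ⊥-elim (e∉U (subst Mem (solve 2 (λ s e → s :+ (s :+ e) ⊜ e) refl s e)
                  (diff s-a (cosetF s-a e∈F) q r)))
          ... | inj₂ p | inj₁ q | inj₂ r = subst Mem (solve 3 (λ s d e → s :+ ((s :+ e) :+ d) ⊜ d :+ e) refl s d e)
                  (diff s-a (cosetF (cosetF s-a e∈F) d∈F) q r)
          ... | inj₂ p | inj₂ q | _ = subst Mem (solve 3 (λ s d e → (s :+ d) :+ (s :+ e) ⊜ d :+ e) refl s d e)
                  (diff (cosetF s-a d∈F) (cosetF s-a e∈F) p q)
      t∈U : Mem (a ⊕ (b ⊕ c))
      t∈U with three-cosets fa fb fc (subst InF (solve 3 (λ a b t → t ⊜ a :+ (b :+ ((a :+ b) :+ t))) refl a b t) t∈F)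
      ... | inj₁ p = a⊆U _ p
      ... | inj₂ (inj₁ p) = b⊆U _ p
      ... | inj₂ (inj₂ p) = c⊆U _ p

    located : ∀ {w} → InW w → Located w
    located = Span-ind {P = Located} generators (inj₁ 0∈)
      (λ {w} g∈ loc → step loc (proj₂ (∈ₗ.∈-filter⁻ Generator? {xs = allV n} g∈)))
      where
      step : ∀ {w g} → Located w → Generator g → Located (w ⊕ g)
      step (inj₁ w∈U) (inj₁ g∈U) = inj₁ (⊕∈ w∈U g∈U)
      step {w} {g} (inj₂ (w∉F , c , fc , cw , c⊆U)) (inj₁ g∈U) =
        inj₂ ((λ wg → w∉F (∈F-⊕ʳ wg (U⊆F g∈U))) , c , fc , subst Mem (⊕-assoc c w g) (⊕∈ cw g∈U) , c⊆U)
      step {w} {g} (inj₁ w∈U) (inj₂ (fg , g⊆U , _)) =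
        inj₂ ((λ wg → E⇒∉F fg (∈F-⊕ʳ (subst InF (⊕-comm w g) wg) (U⊆F w∈U))) , g , fg ,
          subst Mem (solve 2 (λ w g → w ⊜ g :+ (w :+ g)) refl w g) w∈U , g⊆U)
      step {w} {g} (inj₂ (w∉F , c , fc , cw , c⊆U)) (inj₂ b@(fg , g⊆U , _)) with InF? (c ⊕ g)
      ... | yes cg = inj₁ (subst Mem (solve 3 (λ c w g → (c :+ w) :+ (c :+ g) ⊜ w :+ g) refl c w g)
              (⊕∈ cw (g⊆U _ (cg , at (solve 2 (λ c g → c ⊜ g :+ (c :+ g)) refl c g) fc))))
      ... | no cg with third fc c⊆U b cg
      ... | c′ , fc′ , m , c′⊆U = inj₂
              ( (λ wg → cg (subst InF (solve 3 (λ c w g → (w :+ g) :+ (c :+ w) ⊜ c :+ g) refl c w g) (⊕∈F wg (U⊆F cw))))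
              , c′ , fc′
              , subst Mem (solve 4 (λ c w g c′ → (c′ :+ (c :+ g)) :+ (c :+ w) ⊜ c′ :+ (w :+ g)) refl c w g c′) (⊕∈ m cw)
              , c′⊆U)

    W∩F⊆U : ∀ {w} → InW w → InF w → Mem w
    W∩F⊆U w∈W w∈F with located w∈W
    ... | inj₁ p = p
    ... | inj₂ (w∉F , _) = ⊥-elim (w∉F w∈F)

    ∉W-⊕ : ∀ {y w} → ¬ InW y → InW w → ¬ InW (y ⊕ w)
    ∉W-⊕ {y} {w} y∉ w∈ yw∈ = y∉ (subst InW (⊕-cancel y w) (⊕∈W yw∈ w∈))

    U⊆Dir : ∀ {y} → f y ≡ true → ¬ InW y → ∀ {d} → Mem d → Dir y d
    U⊆Dir {y} fy y∉W {d} d∈U with comparable fy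
    ... | inj₁ h = h d d∈U
    ... | inj₂ h = decidable-stable (Dir? y d) λ d∉y →
            y∉W (generator⇒W (inj₂ (fy , h , d , d∈U , d∉y)))

    -- For `g` below `U`, take `d ∈ U` that is no direction of `g`: `two-on-coset` gives `y ⊕ g` or
    -- `(y ⊕ g) ⊕ d` in E. The latter is still outside the span, so it has all of `U` among its
    -- directions and `d` can be added back.
    grow : ∀ {y g} → f y ≡ true → ¬ InW y → Generator g → f (y ⊕ g) ≡ true
    grow fy y∉W (inj₁ g∈U) = proj₂ (U⊆Dir fy y∉W g∈U)
    grow {y} {g} fy y∉W (inj₂ b@(fg , g⊆U , d , d∈U , d∉g))
      with two-on-coset fy fg (U⊆Dir fy y∉W d∈U) (U⊆F d∈U) (¬Dir⇒false (U⊆F d∈U) d∉g)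
    ... | inj₁ p = p
    ... | inj₂ p = at (⊕-cancel (y ⊕ g) d) (proj₂ (U⊆Dir p
            (∉W-⊕ (∉W-⊕ y∉W (generator⇒W (inj₂ b))) (generator⇒W (inj₁ d∈U))) d∈U))

    invariant-generator : ∀ {y g} → ¬ InW y → Generator g → f (y ⊕ g) ≡ f y
    invariant-generator {y} {g} y∉W gen with bool-cases (f y) | bool-cases (f (y ⊕ g))
    ... | inj₁ p | _ = trans (grow p y∉W gen) (sym p)
    ... | inj₂ p | inj₂ q = trans q (sym p)
    ... | inj₂ p | inj₁ q = ⊥-elim (true≢false
            (at (⊕-cancel y g) (grow q (∉W-⊕ y∉W (generator⇒W gen)) gen)) p)

    decomposer : Decomposer f
    decomposer = record
      { W = span generators
      ; inside = inside ; inside∈ = generator⇒W (inj₁ inside∈) ; inside≢0 = inside≢0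
      ; outside = outside ; outside∉ = λ p → outside∉ (W∩F⊆U p outside∈F)
      ; invariant = λ {y} y∉W → proj₂ ∘ Span-ind {P = λ w → InW w × f (y ⊕ w) ≡ f y} generators
          (Subspace.0∈ (span generators) , cong f (⊕-identityʳ y))
          (λ {w} {g} g∈ (w∈ , eq) →
            let gen = proj₂ (∈ₗ.∈-filter⁻ Generator? {xs = allV n} g∈) in
            ⊕∈W w∈ (generator⇒W gen) ,
            trans (cong f (sym (⊕-assoc y w g)))
              (trans (invariant-generator (∉W-⊕ y∉W w∈) gen) eq))
      }

  -- Incomparable directions

  infix 4 _∋_∌_
  _∋_∌_ : V n → V n → V n → Set
  a ∋ d ∌ b = Dir a d × ¬ Dir b d

  Incomparable : V n → V n → Set
  Incomparable a b = (∃ λ d → a ∋ d ∌ b) × (∃ λ e → b ∋ e ∌ a)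

  _⊆ᴰ_ : V n → V n → Set
  a ⊆ᴰ b = ∀ d → Dir a d → Dir b d

  ⊆-or-witness : ∀ a b → a ⊆ᴰ b ⊎ ∃ λ d → a ∋ d ∌ b
  ⊆-or-witness a b with ∃? (λ d → Dir? a d ×-dec ¬? (Dir? b d))
  ... | yes w = inj₂ w
  ... | no ¬w = inj₁ λ d p → decidable-stable (Dir? b d) λ ¬q → ¬w (d , p , ¬q)

  Incomparable? : ∀ a b → Dec (Incomparable a b)
  Incomparable? a b = ∃? (λ d → Dir? a d ×-dec ¬? (Dir? b d)) ×-dec ∃? (λ d → Dir? b d ×-dec ¬? (Dir? a d))

  Incomparable-sym : ∀ {a b} → Incomparable a b → Incomparable b a
  Incomparable-sym (p , q) = q , p

  module Adjacent {a b} (fa : f a ≡ true) (fb : f b ≡ true) (fab : f (a ⊕ b) ≡ true) where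

    -- Otherwise `two-on-coset` for `a ⊕ b` and `b ⊕ e` puts `a ⊕ e` or `(a ⊕ d) ⊕ e` into E, and
    -- either makes `e` a direction of `a`.
    misses : ∀ {d e} → b ∋ e ∌ a → a ∋ d ∌ b → ¬ Dir (a ⊕ b) d
    misses {d} {e} (be , ¬ae) (ad , ¬bd) cd
      with two-on-coset fab (proj₂ be) cd (proj₁ cd)
             (¬Dir⇒false (proj₁ cd) λ p → ¬bd (Dir-unshift fb be p))
    ... | inj₁ p = ¬ae (proj₁ be , at (solve 3 (λ a b e → (a :+ b) :+ (b :+ e) ⊜ a :+ e) refl a b e) p)
    ... | inj₂ p = ¬ae (Dir-unshift fa ad (proj₁ be ,
            at (solve 4 (λ a b d e → ((a :+ b) :+ (b :+ e)) :+ d ⊜ (a :+ d) :+ e) refl a b d e) p))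

    -- If the claim fails, `misses` applies to `d ⊕ d′` as well as to `d`, while `two-on-coset` for
    -- `a ⊕ d` and `b` makes one of them a direction of `a ⊕ b`.
    index-two : ∀ {d d′ e} → b ∋ e ∌ a → a ∋ d ∌ b → a ∋ d′ ∌ b → Dir b (d ⊕ d′)
    index-two {d} {d′} e∈ d∈@(ad , ¬bd) d′∈@(ad′ , ¬bd′) = decidable-stable (Dir? b _) λ ¬dd′ →
      misses e∈ (Dir-⊕ fa ad ad′ , ¬dd′) dd′∈c
      where
      dd′∈c : Dir (a ⊕ b) (d ⊕ d′)
      dd′∈c with two-on-coset (proj₂ ad) fb (Dir-shift fa ad ad′) (proj₁ ad′) (¬Dir⇒false (proj₁ ad′) ¬bd′)
      ... | inj₁ p = ⊥-elim (misses e∈ d∈ (proj₁ ad ,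
              at (solve 3 (λ a b d → (a :+ d) :+ b ⊜ (a :+ b) :+ d) refl a b d) p))
      ... | inj₂ p = ⊕∈F (proj₁ ad) (proj₁ ad′) ,
              at (solve 4 (λ a b d d′ → ((a :+ d) :+ b) :+ d′ ⊜ (a :+ b) :+ (d :+ d′)) refl a b d d′) p

    crosses : ∀ {d e} → b ∋ e ∌ a → a ∋ d ∌ b → Dir (a ⊕ b) (d ⊕ e)
    crosses {d} {e} e∈@(be , ¬ae) d∈@(ad , ¬bd)
      with two-on-coset fb (proj₂ ad) be (proj₁ be) (¬Dir⇒false (proj₁ be) λ p → ¬ae (Dir-unshift fa ad p))
    ... | inj₁ p = ⊥-elim (misses e∈ d∈ (proj₁ ad ,
            at (solve 3 (λ a b d → b :+ (a :+ d) ⊜ (a :+ b) :+ d) refl a b d) p))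
    ... | inj₂ p = ⊕∈F (proj₁ ad) (proj₁ be) ,
            at (solve 4 (λ a b d e → (b :+ (a :+ d)) :+ e ⊜ (a :+ b) :+ (d :+ e)) refl a b d e) p

  -- If `Dir a` and `Dir b` are the kernels of two linear functionals on `F`, the last three fields
  -- make `Dir c` behave like the kernel of their sum; `third-value` uses them in this way.
  record ThirdCoset (a b : V n) : Set where
    field
      c       : V n
      fc      : f c ≡ true
      near    : Dir a (c ⊕ (a ⊕ b))
      misses₁ : ∀ {d} → a ∋ d ∌ b → ¬ Dir c d
      misses₂ : ∀ {e} → b ∋ e ∌ a → ¬ Dir c e
      crosses : ∀ {d e} → a ∋ d ∌ b → b ∋ e ∌ a → Dir c (d ⊕ e)

  -- For incomparable directions the case f (a + b) = 0 reduces to f (a + b) = 1 by moving a within its coset.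
  adjust : ∀ {a b} → f a ≡ true → f b ≡ true → Incomparable a b →
    ∃ λ d → Dir a d × f ((a ⊕ d) ⊕ b) ≡ true
  adjust {a} {b} fa fb ((d , ad , ¬bd) , _) with two-on-coset fa fb ad (proj₁ ad) (¬Dir⇒false (proj₁ ad) ¬bd)
  ... | inj₁ p = 0v n , Dir-0 fa , at (cong (_⊕ b) (sym (⊕-identityʳ a))) p
  ... | inj₂ p = d , ad , at (solve 3 (λ a b d → (a :+ b) :+ d ⊜ (a :+ d) :+ b) refl a b d) p

  third-coset : ∀ {a b} → f a ≡ true → f b ≡ true → Incomparable a b → ThirdCoset a b
  third-coset {a} {b} fa fb inc@((d₀ , d₀∈) , (e₀ , e₀∈)) with adjust fa fb inc
  ... | r , ar , fc = record
    { c = (a ⊕ r) ⊕ b ; fc = fc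
    ; near = subst (Dir a) (solve 3 (λ a b r → r ⊜ ((a :+ r) :+ b) :+ (a :+ b)) refl a b r) ar
    ; misses₁ = λ d∈ → A.misses (back e₀∈) (forth d∈)
    ; misses₂ = λ { {e} e∈ (p , q) → B.misses (forth d₀∈) (back e∈) (p , at (cong (_⊕ e) (⊕-comm (a ⊕ r) b)) q) }
    ; crosses = λ d∈ e∈ → A.crosses (back e∈) (forth d∈)
    }
    where
    far = proj₂ ar
    module A = Adjacent far fb fc
    module B = Adjacent fb far (at (⊕-comm (a ⊕ r) b) fc)
    forth : ∀ {d} → a ∋ d ∌ b → (a ⊕ r) ∋ d ∌ b
    forth (p , q) = Dir-shift fa ar p , q
    back : ∀ {e} → b ∋ e ∌ a → b ∋ e ∌ (a ⊕ r)
    back (p , q) = p , λ s → q (Dir-unshift fa ar s)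

  index-two : ∀ {a b d d′} → f a ≡ true → f b ≡ true → Incomparable a b →
    a ∋ d ∌ b → a ∋ d′ ∌ b → Dir b (d ⊕ d′)
  index-two {a} {b} fa fb inc@(_ , (e , be , ¬ae)) d∈ d′∈ with adjust fa fb inc
  ... | r , ar , fc = Adjacent.index-two (proj₂ ar) fb fc
    (be , λ s → ¬ae (Dir-unshift fa ar s)) (forth d∈) (forth d′∈)
    where
    forth : ∀ {d} → a ∋ d ∌ b → (a ⊕ r) ∋ d ∌ b
    forth (p , q) = Dir-shift fa ar p , q

  -- If `u` is a direction of `z` but not of `y`, then `y` and `z` are incomparable, and `d` or
  -- `d ⊕ u` is common to `x` and `y` but not a direction of `z`. With it, `index-two` for `y` and
  -- `z` forces a direction of `y` outside `Dir x` into `Dir x`.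
  below-incomparable : ∀ {x y z d} → f x ≡ true → f y ≡ true → f z ≡ true →
    z ⊆ᴰ x → x ∋ d ∌ z → Incomparable y x → z ⊆ᴰ y
  below-incomparable {x} {y} {z} {d} fx fy fz z⊆x (xd , ¬zd) inc@((e , ye , ¬xe) , _) u zu =
    decidable-stable (Dir? y u) contra
    where
    contra : ¬ ¬ Dir y u
    contra ¬yu = ¬xe (subst (Dir x) (solve 2 (λ d e → d :+ (d :+ e) ⊜ e) refl (proj₁ moved) e)
        (Dir-⊕ fx (proj₁ (proj₂ moved)) (z⊆x _ (index-two fy fz yz (proj₂ (proj₂ moved)) (ye , ¬ze)))))
      where
      ¬ze : ¬ Dir z e
      ¬ze p = ¬xe (z⊆x e p)
      yz : Incomparable y z
      yz = (e , ye , ¬ze) , (u , zu , ¬yu)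
      moved : ∃ λ d′ → Dir x d′ × y ∋ d′ ∌ z
      moved with Dir? y d
      ... | yes yd = d , xd , yd , ¬zd
      ... | no ¬yd = d ⊕ u , Dir-⊕ fx xd (z⊆x u zu) ,
              index-two fx fy (Incomparable-sym inc) (xd , ¬yd) (z⊆x u zu , ¬yu) ,
              λ p → ¬zd (subst (Dir z) (⊕-cancel d u) (Dir-⊕ fz p zu))

  above-incomparable : ∀ {x y z d} → f x ≡ true → f y ≡ true → f z ≡ true →
    x ⊆ᴰ z → z ∋ d ∌ x → Incomparable y x → y ⊆ᴰ z
  above-incomparable {x} {y} {z} {d} fx fy fz x⊆z (zd , ¬xd) inc@(_ , (e , xe , ¬ye)) u yu =
    decidable-stable (Dir? z u) contra
    where
    contra : ¬ ¬ Dir z u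
    contra ¬zu = ¬zu (subst (Dir z) (solve 2 (λ d u → d :+ (d :+ u) ⊜ u) refl (proj₁ moved) u)
        (Dir-⊕ fz (proj₁ (proj₂ moved)) (x⊆z _ (index-two fy fx inc (proj₂ (proj₂ moved)) (yu , λ p → ¬zu (x⊆z u p))))))
      where
      zy : Incomparable z y
      zy = (e , x⊆z e xe , ¬ye) , (u , yu , ¬zu)
      moved : ∃ λ d′ → Dir z d′ × y ∋ d′ ∌ x
      moved with Dir? y d
      ... | yes yd = d , zd , yd , ¬xd
      ... | no ¬yd = d ⊕ e , Dir-⊕ fz zd (x⊆z e xe) ,
              index-two fz fy zy (zd , ¬yd) (x⊆z e xe , ¬ye) ,
              λ p → ¬xd (subst (Dir x) (⊕-cancel d e) (Dir-⊕ fx p xe))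

  -- Directions of order 2

  IsPoint : V n → V n → Set
  IsPoint v p = f v ≡ true × p ≢ 0v n × Dir v p × (∀ d → Dir v d → d ≡ 0v n ⊎ d ≡ p)

  IsPoint? : ∀ v p → Dec (IsPoint v p)
  IsPoint? v p = (f v Boolₚ.≟ true) ×-dec (¬? (p ≟ᵥ 0v n) ×-dec (Dir? v p ×-dec
    ∀? (λ d → Dir? v d →-dec ((d ≟ᵥ 0v n) ⊎-dec (d ≟ᵥ p)))))

  IsPoint-shift : ∀ {v p d} → IsPoint v p → Dir v d → IsPoint (v ⊕ d) p
  IsPoint-shift (fv , p≢0 , vp , only) vd =
    proj₂ vd , p≢0 , Dir-shift fv vd vp , λ e q → only e (Dir-unshift fv vd q)

  point∌ : ∀ {v w p q} → IsPoint v p → IsPoint w q → p ≢ q → v ∋ p ∌ w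
  point∌ (_ , p≢0 , vp , _) (_ , _ , _ , only) p≢q =
    vp , λ wp → [ p≢0 , p≢q ]′ (only _ wp)

  points-incomparable : ∀ {v w p q} → IsPoint v p → IsPoint w q → p ≢ q → Incomparable v w
  points-incomparable P Q p≢q = (_ , point∌ P Q p≢q) , (_ , point∌ Q P (p≢q ∘ sym))

  points-distinct : ∀ {v w p q} → IsPoint v p → IsPoint w q → p ≢ q → v ≢ w
  points-distinct P Q p≢q refl = proj₂ (point∌ P Q p≢q) (proj₁ (proj₂ (proj₂ P)))

  -- `misses` and `crosses` leave `p ⊕ q` but neither `p` nor `q` in `Dir (a ⊕ b)`. For a further
  -- `d`, `index-two` against `a` puts `d ⊕ (p ⊕ q)` into `Dir a`, so that `d` would be `p ⊕ q` or
  -- `q`.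
  point-sum : ∀ {a b p q} → IsPoint a p → IsPoint b q → p ≢ q → f (a ⊕ b) ≡ true → IsPoint (a ⊕ b) (p ⊕ q)
  point-sum {a} {b} {p} {q} P@(fa , p≢0 , ap , onlyₐ) Q@(fb , q≢0 , bq , only_b) p≢q fab =
    fab , ≢⇒⊕≢0 p≢q , crosses b∋q a∋p , only
    where
    open Adjacent fa fb fab using (misses; crosses)
    module Sym = Adjacent fb fa (at (⊕-comm a b) fab)
    a∋p = point∌ P Q p≢q
    b∋q = point∌ Q P (p≢q ∘ sym)
    c∌p : ¬ Dir (a ⊕ b) p
    c∌p = misses b∋q a∋p
    c∌q : ¬ Dir (a ⊕ b) q
    c∌q (q∈ , e) = Sym.misses a∋p b∋q (q∈ , at (cong (_⊕ q) (⊕-comm a b)) e)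
    ¬a : ∀ {d} → d ≢ 0v n → d ≢ p → ¬ Dir a d
    ¬a d≢0 d≢p ad = [ d≢0 , d≢p ]′ (onlyₐ _ ad)
    only : ∀ d → Dir (a ⊕ b) d → d ≡ 0v n ⊎ d ≡ p ⊕ q
    only d cd with d ≟ᵥ 0v n | d ≟ᵥ p ⊕ q
    ... | yes e | _ = inj₁ e
    ... | no _ | yes e = inj₂ e
    ... | no d≢0 | no d≢pq = ⊥-elim ([ ≢⇒⊕≢0 d≢pq , sum≢p ]′ (onlyₐ _ (index-two fab fa
          ((d , d∈) , (p , ap , c∌p)) d∈ pq∈)))
      where
      d∈ : (a ⊕ b) ∋ d ∌ a
      d∈ = cd , ¬a d≢0 λ { refl → c∌p cd }
      pq∈ : (a ⊕ b) ∋ p ⊕ q ∌ a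
      pq∈ = crosses b∋q a∋p , ¬a (≢⇒⊕≢0 p≢q)
        λ e → q≢0 (trans (solve 2 (λ p q → q ⊜ p :+ (p :+ q)) refl p q) (trans (cong (p ⊕_) e) (⊕-self p)))
      sum≢p : d ⊕ (p ⊕ q) ≢ p
      sum≢p e = c∌q (subst (Dir (a ⊕ b)) (trans (solve 3 (λ d p q → d ⊜ (d :+ (p :+ q)) :+ (p :+ q)) refl d p q)
        (trans (cong (_⊕ (p ⊕ q)) e) (solve 2 (λ p q → p :+ (p :+ q) ⊜ q) refl p q))) cd)

  -- If `b ⊕ c` is outside E, claw-freeness for `a ⊕ p`, `b`, `c` gives `k` in E. But then
  -- `e = (b ⊕ q) ⊕ c` has direction `q ⊕ r`, and `a ⊕ e` or `(a ⊕ p) ⊕ e` lies in E with direction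
  -- `p ⊕ (q ⊕ r)`. From there `k` is at distance `p ⊕ q` or `q`, which is not a direction.
  point-transitive : ∀ {a b c p q r} → IsPoint a p → IsPoint b q → IsPoint c r →
    p ≢ q → q ≢ r → p ≢ r → p ≢ q ⊕ r → f (a ⊕ b) ≡ true → f (a ⊕ c) ≡ true → f (b ⊕ c) ≡ true
  point-transitive {a} {b} {c} {p} {q} {r} P@(fa , p≢0 , ap , _) Q@(fb , q≢0 , bq , onlyQ) R@(fc , r≢0 , cr , _)
    p≢q q≢r p≢r p≢qr fab fac with bool-cases (f (b ⊕ c))
  ... | inj₁ fbc = fbc
  ... | inj₂ fbc = ⊥-elim contra
    where
    k : V n
    k = (a ⊕ p) ⊕ (b ⊕ c)
    P′ = IsPoint-shift P ap
    moved : ∀ {x t} → IsPoint x t → p ≢ t → f (a ⊕ x) ≡ true → f ((a ⊕ p) ⊕ x) ≡ false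
    moved {x} X p≢t fax = at (solve 3 (λ a x p → (a :+ x) :+ p ⊜ (a :+ p) :+ x) refl a x p)
      (¬Dir⇒false (proj₁ ap) (Adjacent.misses fa (proj₁ X) fax (point∌ X P (p≢t ∘ sym)) (point∌ P X p≢t)))
    fk : f k ≡ true
    fk = claw-free (points-distinct P′ Q p≢q) (points-distinct P′ R p≢r) (points-distinct Q R q≢r)
      (proj₁ P′) fb fc (moved Q p≢q fab) (moved R p≢r fac) fbc
    fe : f ((b ⊕ q) ⊕ c) ≡ true
    fe with adjust fb fc (points-incomparable Q R q≢r)
    ... | s , bs , fe with onlyQ s bs
    ... | inj₁ refl = ⊥-elim (true≢false fe (at (cong (_⊕ c) (sym (⊕-identityʳ b))) fbc))
    ... | inj₂ refl = fe
    e : V n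
    e = (b ⊕ q) ⊕ c
    Eₚ : IsPoint e (q ⊕ r)
    Eₚ = point-sum (IsPoint-shift Q bq) R q≢r fe
    contra : ⊥
    contra with adjust fa fe (points-incomparable P Eₚ p≢qr)
    ... | s , as , fae with point-sum (IsPoint-shift P as) Eₚ p≢qr fae | proj₂ (proj₂ (proj₂ P)) s as
    ... | (_ , _ , _ , only) | inj₁ refl
        with only (p ⊕ q) (⊕∈F (proj₁ ap) (proj₁ bq) ,
               at (solve 5 (λ a b c p q → (a :+ p) :+ (b :+ c) ⊜ ((a :+ :0) :+ ((b :+ q) :+ c)) :+ (p :+ q)) refl a b c p q) fk)
    ... | inj₁ eq = ≢⇒⊕≢0 p≢q eq
    ... | inj₂ eq = r≢0 (trans (solve 3 (λ p q r → r ⊜ (p :+ q) :+ (p :+ (q :+ r))) refl p q r)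
                      (trans (cong (_⊕ (p ⊕ (q ⊕ r))) eq) (⊕-self _)))
    contra | s , as , fae | (_ , _ , _ , only) | inj₂ refl
        with only q (proj₁ bq ,
               at (solve 5 (λ a b c p q → (a :+ p) :+ (b :+ c) ⊜ ((a :+ p) :+ ((b :+ q) :+ c)) :+ q) refl a b c p q) fk)
    ... | inj₁ eq = q≢0 eq
    ... | inj₂ eq = p≢r (trans (solve 3 (λ p q r → p ⊜ (p :+ (q :+ r)) :+ (q :+ r)) refl p q r)
                      (trans (cong (_⊕ (q ⊕ r)) (sym eq)) (solve 2 (λ q r → q :+ (q :+ r) ⊜ r) refl q r)))

  PointOr0 : V n → Set
  PointOr0 d = d ≡ 0v n ⊎ ∃ λ v → IsPoint v d

  PointOr0-⊕ : ∀ {p q} → PointOr0 p → PointOr0 q → PointOr0 (p ⊕ q)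
  PointOr0-⊕ {q = q} (inj₁ refl) Q = subst PointOr0 (sym (⊕-identityˡ q)) Q
  PointOr0-⊕ {p = p} (inj₂ P) (inj₁ refl) = subst PointOr0 (sym (⊕-identityʳ p)) (inj₂ P)
  PointOr0-⊕ {p} {q} (inj₂ (v , P)) (inj₂ (w , Q)) with p ≟ᵥ q
  ... | yes refl = inj₁ (⊕-self p)
  ... | no p≢q with adjust (proj₁ P) (proj₁ Q) (points-incomparable P Q p≢q)
  ... | r , vr , fc = inj₂ (_ , point-sum (IsPoint-shift P vr) Q p≢q fc)

  points : Subspace n
  points = record
    { Mem = PointOr0
    ; Mem? = λ d → (d ≟ᵥ 0v n) ⊎-dec ∃? (λ v → IsPoint? v d)
    ; 0∈ = inj₁ refl
    ; ⊕∈ = PointOr0-⊕ }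

  points⊆F : ∀ {d} → PointOr0 d → InF d
  points⊆F (inj₁ refl) = 0∈F
  points⊆F (inj₂ (_ , _ , _ , vp , _)) = proj₁ vp

  -- Suppose `Dir v` misses the direction `p` of a point `w`. Inside `Dir w` it is trivial;
  -- otherwise `index-two` over the group `{0, p}` leaves it only one nonzero element, again a
  -- point.
  points-comparable : ∀ {v} → f v ≡ true → (∀ d → PointOr0 d → Dir v d) ⊎ (∀ d → Dir v d → PointOr0 d)
  points-comparable {v} fv with ∃? (λ p → ∃? (λ w → IsPoint? w p) ×-dec ¬? (Dir? v p))
  ... | no none = inj₁ λ
        { d (inj₁ refl) → Dir-0 fv
        ; d (inj₂ P) → decidable-stable (Dir? v d) λ ¬d → none (d , P , ¬d) }
  ... | yes (p , (w , P@(fw , p≢0 , wp , only)) , ¬vp) with ⊆-or-witness v w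
  ... | inj₁ v⊆w = inj₂ λ d vd → [ inj₁ , (λ { refl → ⊥-elim (¬vp vd) }) ]′ (only d (v⊆w d vd))
  ... | inj₂ (e , ve , ¬we) = inj₂ λ d vd → [ inj₁ , (λ { refl → inj₂ (v , isPoint) }) ]′ (dichotomy d vd)
    where
    dichotomy : ∀ d → Dir v d → d ≡ 0v n ⊎ d ≡ e
    dichotomy d vd with d ≟ᵥ 0v n | d ≟ᵥ e
    ... | yes q | _ = inj₁ q
    ... | _ | yes q = inj₂ q
    ... | no d≢0 | no d≢e = ⊥-elim ([ ≢⇒⊕≢0 d≢e , (λ q → ¬vp (subst (Dir v) q (Dir-⊕ fv vd ve))) ]′
          (only _ (index-two fv fw ((e , ve , ¬we) , (p , wp , ¬vp))
            (vd , λ wd → [ d≢0 , (λ { refl → ¬vp vd }) ]′ (only d wd)) (ve , ¬we))))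
    isPoint : IsPoint v e
    isPoint = fv , (λ { refl → ¬we (Dir-0 fw) }) , ve , dichotomy

  -- The lift `w` of a new basis vector is adjusted to have `G h₁ ⊕ w` in E for a single `h₁`;
  -- `point-transitive` through `G h₁` carries this to every `G h ⊕ w`, and `point-sum` identifies
  -- the directions.
  point-section : (∀ {u} → InF u → PointOr0 u) → ∀ {k} (L : V k → V n) → IsLinear L →
    TrivialKernel L → (∀ h → InF (L h)) →
    ∃ λ (G : V k → V n) → IsLinear G × (∀ {h} → h ≢ 0v k → IsPoint (G h) (L h))
  point-section all {zero} L lin inj L∈ = (λ _ → 0v n) , (λ _ _ → sym (⊕-self _)) , λ { {[]} h≢ → ⊥-elim (h≢ refl) }
  point-section all {suc k} L lin inj L∈
    with point-section all (λ h → L (false ∷ h)) (λ x y → lin _ _) (λ h e → Vecₚ.∷-injectiveʳ (inj _ e)) (λ h → L∈ _)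
       | all (L∈ (true ∷ 0v k))
  ... | _ | inj₁ e with inj _ e
  ... | ()
  point-section all {suc k} L lin inj L∈
      | G , G-lin , G-point | inj₂ (w₀ , W₀) = G′ , extendBy-linear G w G-lin , G′-point
    where
    q = L (true ∷ 0v k)
    L-distinct : ∀ {x y} → x ≢ y → L x ≢ L y
    L-distinct {x} {y} x≢y e = ≢⇒⊕≢0 x≢y (inj _ (trans (lin x y) (trans (cong (_⊕ L y) e) (⊕-self _))))
    q≢ : ∀ h → L (false ∷ h) ≢ q
    q≢ h = L-distinct λ ()
    compatible : ∀ {k} (G : V k → V n) (L′ : V k → V n) → IsLinear G → IsLinear L′ →
      (∀ {x y} → x ≢ y → L′ x ≢ L′ y) →
      (∀ {h} → h ≢ 0v k → IsPoint (G h) (L′ h)) → (∀ h → L′ h ≢ q) →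
      ∃ λ w → IsPoint w q × (∀ {h} → h ≢ 0v k → f (G h ⊕ w) ≡ true)
    compatible {zero} G L′ _ _ _ G-point q≢ = w₀ , W₀ , λ { {[]} h≢ → ⊥-elim (h≢ refl) }
    compatible {suc k} G L′ G-lin L′-lin L′-distinct G-point q≢ with adjust (proj₁ W₀) (proj₁ P₁) (points-incomparable W₀ P₁ (q≢ h₁ ∘ sym))
      where
      h₁ = true ∷ 0v k
      P₁ = G-point {h₁} λ ()
    ... | r , wr , fw = w₀ ⊕ r , W , good
      where
      h₁ = true ∷ 0v k
      P₁ = G-point {h₁} λ ()
      W = IsPoint-shift W₀ wr
      fGw : f (G h₁ ⊕ (w₀ ⊕ r)) ≡ true
      fGw = at (⊕-comm (w₀ ⊕ r) (G h₁)) fw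
      good : ∀ {h} → h ≢ 0v (suc k) → f (G h ⊕ (w₀ ⊕ r)) ≡ true
      good {h} h≢0 with h ≟ᵥ h₁
      ... | yes refl = fGw
      ... | no h≢h₁ = point-transitive P₁ (G-point h≢0) W (L′-distinct (h≢h₁ ∘ sym)) (q≢ h) (q≢ h₁)
            (λ e → q≢ (h ⊕ h₁) (trans (L′-lin h h₁) (trans (cong (L′ h ⊕_) e)
              (solve 2 (λ a b → a :+ (a :+ b) ⊜ b) refl (L′ h) q))))
            (at (G-lin h₁ h) (proj₁ (G-point (≢⇒⊕≢0 (h≢h₁ ∘ sym))))) fGw
    w,W = compatible G (λ h → L (false ∷ h)) G-lin (λ x y → lin _ _)
      (λ x≢y → L-distinct λ e → x≢y (Vecₚ.∷-injectiveʳ e)) G-point q≢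
    w = proj₁ w,W
    G′ = extendBy G w
    G′-point : ∀ {h} → h ≢ 0v (suc k) → IsPoint (G′ h) (L h)
    G′-point {false ∷ h} h≢ = subst (λ z → IsPoint z (L (false ∷ h))) (sym (⊕-identityʳ (G h)))
      (G-point λ { refl → h≢ refl })
    G′-point {true ∷ h} _ with h ≟ᵥ 0v k
    ... | yes refl = subst (λ z → IsPoint z q) (sym (trans (cong (_⊕ w) (linear-0 G G-lin)) (⊕-identityˡ w))) (proj₁ (proj₂ w,W))
    ... | no h≢0 = subst (IsPoint (G h ⊕ w)) (trans (sym (lin _ _)) (cong (λ z → L (true ∷ z)) (⊕-identityʳ h)))
          (point-sum (G-point h≢0) (proj₁ (proj₂ w,W)) (q≢ h) (proj₂ (proj₂ w,W) h≢0))

  points-cut-or-section : ∀ {k} (L : V k → V n) → IsLinear L → TrivialKernel L →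
    (∀ h → InF (L h)) → NoFlat f k →
    Decomposer f ⊎ (∀ v p → ¬ IsPoint v p)
  points-cut-or-section L lin inj L∈ no-flat with ∃? (λ p → ∃? (λ v → IsPoint? v p))
  ... | no none = inj₂ λ v p P → none (p , v , P)
  ... | yes (p , v , P) with ∃? (λ g → InF? g ×-dec ¬? (Subspace.Mem? points g))
  ... | yes (g , g∈ , g∉) = inj₁ (FromCut.decomposer (record
          { U = points ; U⊆F = points⊆F
          ; inside = p ; inside∈ = inj₂ (v , P) ; inside≢0 = proj₁ (proj₂ P)
          ; outside = g ; outside∈F = g∈ ; outside∉ = g∉
          ; comparable = points-comparable }))
  ... | no none with point-section (λ {u} u∈ → decidable-stable (Subspace.Mem? points u) λ u∉ → none (u , u∈ , u∉)) L lin inj L∈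
  ... | G , G-lin , G-point = ⊥-elim (no-flat G G-lin (proj₁ ∘ G-point))

  -- Trivial directions

  module NoPoints (no-points : ∀ v p → ¬ IsPoint v p) (u₀ : V n) (u₀∈F : InF u₀) (u₀≢0 : u₀ ≢ 0v n) where

    Isolated : V n → Set
    Isolated v = f v ≡ true × (∀ d → Dir v d → d ≡ 0v n)

    Isolated? : ∀ v → Dec (Isolated v)
    Isolated? v = (f v Boolₚ.≟ true) ×-dec ∀? (λ d → Dir? v d →-dec (d ≟ᵥ 0v n))

    two-directions : ∀ {v} → f v ≡ true → ¬ Isolated v →
      ∃ λ d → ∃ λ e → Dir v d × Dir v e × d ≢ 0v n × e ≢ 0v n × e ≢ d
    two-directions {v} fv ¬iso with ∃? (λ d → Dir? v d ×-dec ¬? (d ≟ᵥ 0v n))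
    ... | no none = ⊥-elim (¬iso (fv , λ d vd → decidable-stable (d ≟ᵥ 0v n) λ d≢0 → none (d , vd , d≢0)))
    ... | yes (d , vd , d≢0) with ∃? (λ e → Dir? v e ×-dec (¬? (e ≟ᵥ 0v n) ×-dec ¬? (e ≟ᵥ d)))
    ... | yes (e , ve , e≢0 , e≢d) = d , e , vd , ve , d≢0 , e≢0 , e≢d
    ... | no none = ⊥-elim (no-points v d (fv , d≢0 , vd , only))
      where
      only : ∀ e → Dir v e → e ≡ 0v n ⊎ e ≡ d
      only e ve with e ≟ᵥ 0v n | e ≟ᵥ d
      ... | yes p | _ = inj₁ p
      ... | no _ | yes p = inj₂ p
      ... | no p | no q = ⊥-elim (none (e , ve , p , q))

    -- Maximality of `F` gives `c = (v ⊕ w) ⊕ t` in E. By `forced` its direction has order at most 2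
    -- when `t ≠ 0`, and order 2 does not occur, so `c` is isolated. Then `three-cosets` puts `t`
    -- into a trivial direction.
    isolated-sum : ∀ {v w} → Isolated v → Isolated w → v ≢ w → Isolated (v ⊕ w)
    isolated-sum {v} {w} (fv , onlyᵥ) (fw , only_w) v≢w = subst Isolated c≡ c-isolated
      where
      vw∉F : ¬ InF (v ⊕ w)
      vw∉F vw∈ = ≢⇒⊕≢0 v≢w (onlyᵥ _ (vw∈ , at (solve 2 (λ v w → w ⊜ v :+ (v :+ w)) refl v w) fw))
      -- For nonzero d ∈ Dir c with c = v + w + s, one of s and s + d vanishes.
      forced : ∀ {s d} → InF s → f ((v ⊕ w) ⊕ s) ≡ true → Dir ((v ⊕ w) ⊕ s) d → d ≢ 0v n → s ≢ 0v n → d ≡ s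
      forced {s} {d} s∈ fc cd d≢0 s≢0
        with two-on-coset fc fv cd (proj₁ cd) (¬Dir⇒false (proj₁ cd) λ vd → d≢0 (onlyᵥ _ vd))
      ... | inj₁ p = ⊥-elim (s≢0 (only_w s (s∈ , at (solve 3 (λ v w s → ((v :+ w) :+ s) :+ v ⊜ w :+ s) refl v w s) p)))
      ... | inj₂ p = trans (solve 2 (λ s d → d ⊜ (s :+ d) :+ s) refl s d)
              (trans (cong (_⊕ s) (only_w (s ⊕ d) (⊕∈F s∈ (proj₁ cd) ,
                at (solve 4 (λ v w s d → (((v :+ w) :+ s) :+ v) :+ d ⊜ w :+ (s :+ d)) refl v w s d) p))) (⊕-identityˡ s))
      isolated : ∀ {s} → InF s → f ((v ⊕ w) ⊕ s) ≡ true → s ≢ 0v n → Isolated ((v ⊕ w) ⊕ s)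
      isolated {s} s∈ fc s≢0 = fc , λ d cd → decidable-stable (d ≟ᵥ 0v n) λ d≢0 →
        no-points _ s (fc , s≢0 , subst (Dir _) (forced s∈ fc cd d≢0 s≢0) cd , only)
        where
        only : ∀ d → Dir ((v ⊕ w) ⊕ s) d → d ≡ 0v n ⊎ d ≡ s
        only d cd with d ≟ᵥ 0v n
        ... | yes p = inj₁ p
        ... | no p = inj₂ (forced s∈ fc cd p s≢0)
      t,c = F-maximal (v ⊕ w) vw∉F
      t = proj₁ t,c
      t∈ = proj₁ (proj₂ t,c)
      fc = proj₂ (proj₂ t,c)
      c = (v ⊕ w) ⊕ t
      c-isolated : Isolated c
      c-isolated with t ≟ᵥ 0v n
      ... | no t≢0 = isolated t∈ fc t≢0
      -- A nonzero direction `d` of `c` would lead to `(v ⊕ w) ⊕ d`, isolated by the other case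
      -- although it has the direction `d` too.
      ... | yes t≡0 = fc , λ d cd → decidable-stable (d ≟ᵥ 0v n) λ d≢0 →
              d≢0 (proj₂ (isolated (proj₁ cd) (at (c+ d) (proj₂ cd)) d≢0) d
                (proj₁ cd , at (⊕-cancel-t d) fc))
        where
        c+ : ∀ d → c ⊕ d ≡ (v ⊕ w) ⊕ d
        c+ d = cong (_⊕ d) (trans (cong ((v ⊕ w) ⊕_) t≡0) (⊕-identityʳ _))
        ⊕-cancel-t : ∀ d → c ≡ ((v ⊕ w) ⊕ d) ⊕ d
        ⊕-cancel-t d = trans (trans (cong ((v ⊕ w) ⊕_) t≡0) (⊕-identityʳ _)) (sym (⊕-cancel (v ⊕ w) d))
      t≡ : v ⊕ (w ⊕ c) ≡ t
      t≡ = solve 3 (λ v w t → v :+ (w :+ ((v :+ w) :+ t)) ⊜ t) refl v w t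
      t≡0 : t ≡ 0v n
      t≡0 = trans (sym t≡) ([ onlyᵥ _ , [ only_w _ , proj₂ c-isolated _ ]′ ]′
        (three-cosets fv fw fc (subst InF (sym t≡) t∈)))
      c≡ : c ≡ v ⊕ w
      c≡ = trans (cong ((v ⊕ w) ⊕_) t≡0) (⊕-identityʳ _)

    isolated-or-0 : Subspace n
    isolated-or-0 = record
      { Mem = λ x → x ≡ 0v n ⊎ Isolated x
      ; Mem? = λ x → (x ≟ᵥ 0v n) ⊎-dec Isolated? x
      ; 0∈ = inj₁ refl ; ⊕∈ = closed }
      where
      closed : ∀ {x y} → x ≡ 0v n ⊎ Isolated x → y ≡ 0v n ⊎ Isolated y → x ⊕ y ≡ 0v n ⊎ Isolated (x ⊕ y)
      closed {y = y} (inj₁ refl) q = subst (λ z → z ≡ 0v n ⊎ Isolated z) (sym (⊕-identityˡ y)) q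
      closed {x} (inj₂ p) (inj₁ refl) = subst (λ z → z ≡ 0v n ⊎ Isolated z) (sym (⊕-identityʳ x)) (inj₂ p)
      closed {x} {y} (inj₂ p) (inj₂ q) with x ≟ᵥ y
      ... | yes refl = inj₁ (⊕-self x)
      ... | no x≢y = inj₂ (isolated-sum p q x≢y)

    isolated-decomposer : ∀ {v} → Isolated v → Decomposer f
    isolated-decomposer {v} iso = record
      { W = isolated-or-0
      ; inside = v ; inside∈ = inj₂ iso ; inside≢0 = λ { refl → true≢false (proj₁ iso) f0 }
      ; outside = u₀ ; outside∉ = [ u₀≢0 , (λ p → E⇒∉F (proj₁ p) u₀∈F) ]′
      ; invariant = invariant }
      where
      open Subspace isolated-or-0 renaming (Mem to InA; ⊕∈ to ⊕∈A) using ()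
      -- If `x ⊕ w` were outside E, `two-on-coset` would put `(x ⊕ w) ⊕ d` into E for each nonzero
      -- direction `d` of `x`. There are at least three of these, `d`, `e`, `d ⊕ e`, so `e` and
      -- `d ⊕ e` are directions of `(x ⊕ w) ⊕ d`, and their sum leads back to `x ⊕ w`.
      grow : ∀ {x w} → f x ≡ true → ¬ InA x → Isolated w → f (x ⊕ w) ≡ true
      grow {x} {w} fx x∉ (fw , only) with two-directions fx (x∉ ∘ inj₂)
      ... | d , e , xd , xe , d≢0 , e≢0 , e≢d with bool-cases (f (x ⊕ w))
      ... | inj₁ p = p
      ... | inj₂ p = at (solve 4 (λ x w d e → ((x :+ w) :+ d) :+ ((d :+ e) :+ e) ⊜ x :+ w) refl x w d e)
              (proj₂ (Dir-⊕ (on xd d≢0)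
                (⊕∈F (proj₁ xd) (proj₁ xe) , at (solve 4 (λ x w d e → (x :+ w) :+ e ⊜ ((x :+ w) :+ d) :+ (d :+ e)) refl x w d e) (on xe e≢0))
                (proj₁ xe , at (sym (⊕-assoc (x ⊕ w) d e)) (on (Dir-⊕ fx xd xe) (≢⇒⊕≢0 (e≢d ∘ sym))))))
        where
        on : ∀ {d} → Dir x d → d ≢ 0v n → f ((x ⊕ w) ⊕ d) ≡ true
        on xd d≢0 with two-on-coset fx fw xd (proj₁ xd) (¬Dir⇒false (proj₁ xd) λ wd → d≢0 (only _ wd))
        ... | inj₁ q = ⊥-elim (true≢false q p)
        ... | inj₂ q = q
      invariant : ∀ {x w} → ¬ InA x → InA w → f (x ⊕ w) ≡ f x
      invariant {x} x∉ (inj₁ refl) = cong f (⊕-identityʳ x)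
      invariant {x} {w} x∉ (inj₂ iso) with bool-cases (f x) | bool-cases (f (x ⊕ w))
      ... | inj₁ p | _ = trans (grow p x∉ iso) (sym p)
      ... | inj₂ p | inj₂ q = trans q (sym p)
      ... | inj₂ p | inj₁ q = ⊥-elim (true≢false (at (⊕-cancel x w)
              (grow q (λ m → x∉ (subst InA (⊕-cancel x w) (⊕∈A m (inj₂ iso)))) iso)) p)

    -- Directions of index at most 2

    module NoIsolated (none : ∀ v → ¬ Isolated v) where

      IndexAtMost2 : V n → Set
      IndexAtMost2 v = ∀ {d e} → InF d → InF e → ¬ Dir v d → ¬ Dir v e → Dir v (d ⊕ e)

      module _ {v} (fv : f v ≡ true) (g : V n) (g∈F : InF g) (¬vg : ¬ Dir v g) where

        Dir-subspace : Subspace n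
        Dir-subspace = record { Mem = Dir v ; Mem? = Dir? v ; 0∈ = Dir-0 fv ; ⊕∈ = Dir-⊕ fv }

        comparable-to-all : (∀ w → f w ≡ true → ¬ Incomparable w v) → Decomposer f
        comparable-to-all h with two-directions fv (none v)
        ... | d , _ , vd , _ , d≢0 , _ = FromCut.decomposer (record
              { U = Dir-subspace ; U⊆F = proj₁
              ; inside = d ; inside∈ = vd ; inside≢0 = d≢0
              ; outside = g ; outside∈F = g∈F ; outside∉ = ¬vg
              ; comparable = compare })
          where
          compare : ∀ {w} → f w ≡ true → v ⊆ᴰ w ⊎ w ⊆ᴰ v
          compare {w} fw with ⊆-or-witness v w | ⊆-or-witness w v
          ... | inj₁ p | _ = inj₁ p
          ... | inj₂ _ | inj₁ q = inj₂ q
          ... | inj₂ p | inj₂ q = ⊥-elim (h w fw (q , p))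

        module _ {y} (fy : f y ≡ true) (y~v : Incomparable y v) where

          -- Order at least 4 enters here: by `index-two`, of two distinct nonzero directions of `v`
          -- and their sum, one belongs to `y`.
          common : ∃ λ q → q ≢ 0v n × Dir v q × Dir y q
          common with two-directions fv (none v)
          ... | d , e , vd , ve , d≢0 , e≢0 , e≢d with Dir? y d | Dir? y e
          ... | yes p | _ = d , d≢0 , vd , p
          ... | no _ | yes p = e , e≢0 , ve , p
          ... | no p | no q = d ⊕ e , ≢⇒⊕≢0 (e≢d ∘ sym) , Dir-⊕ fv vd ve ,
                  index-two fv fy (Incomparable-sym y~v) (vd , p) (ve , q)

          q = proj₁ common
          q≢0 = proj₁ (proj₂ common)
          vq = proj₁ (proj₂ (proj₂ common))
          yq = proj₂ (proj₂ (proj₂ common))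

          -- Intersecting `Dir v` with all directions incomparable to it gives a cut: `q` keeps it
          -- nonzero, and `below-incomparable` puts every direction strictly below `Dir v` inside
          -- it.
          intersection-cut : (∀ w → f w ≡ true → Incomparable w v → Dir w q) → Decomposer f
          intersection-cut h = FromCut.decomposer (record
            { U = record
              { Mem = InU
              ; Mem? = λ d → Dir? v d ×-dec ∀? (λ w → (f w Boolₚ.≟ true) →-dec (Incomparable? w v →-dec Dir? w d))
              ; 0∈ = Dir-0 fv , λ w fw _ → Dir-0 fw
              ; ⊕∈ = λ (p , p′) (r , r′) → Dir-⊕ fv p r , λ w fw w~v → Dir-⊕ fw (p′ w fw w~v) (r′ w fw w~v) }
            ; U⊆F = proj₁ ∘ proj₁
            ; inside = q ; inside∈ = vq , h ; inside≢0 = q≢0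
            ; outside = g ; outside∈F = g∈F ; outside∉ = ¬vg ∘ proj₁
            ; comparable = compare })
            where
            InU : V n → Set
            InU d = Dir v d × (∀ w → f w ≡ true → Incomparable w v → Dir w d)
            compare : ∀ {w} → f w ≡ true → (∀ d → InU d → Dir w d) ⊎ (∀ d → Dir w d → InU d)
            compare {w} fw with ⊆-or-witness v w | ⊆-or-witness w v
            ... | inj₁ v⊆w | _ = inj₁ λ d m → v⊆w d (proj₁ m)
            ... | inj₂ p | inj₂ r = inj₁ λ d m → proj₂ m w fw (r , p)
            ... | inj₂ (d , p) | inj₁ w⊆v = inj₂ λ e we → w⊆v e we ,
                    λ x fx x~v → below-incomparable fv fx fw w⊆v p x~v e we

          module _ {z} (fz : f z ≡ true) (z~v : Incomparable z v) (¬zq : ¬ Dir z q) where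

            e = proj₁ (proj₁ y~v)
            ye = proj₁ (proj₂ (proj₁ y~v))
            ¬ve = proj₂ (proj₂ (proj₁ y~v))

            shift-by-q : ∀ {d} → Dir v ((d ⊕ q) ⊕ e) → Dir v (d ⊕ e)
            shift-by-q {d} p = subst (Dir v) (solve 3 (λ d q e → ((d :+ q) :+ e) :+ q ⊜ d :+ e) refl d q e) (Dir-⊕ fv p vq)

            ∌v-shift : ∀ {d} → ¬ Dir v d → ¬ Dir v (d ⊕ q)
            ∌v-shift {d} ¬vd p = ¬vd (subst (Dir v) (⊕-cancel d q) (Dir-⊕ fv p vq))

            -- If Dir w misses q then it meets Dir y outside Dir v, which pins Dir w ∖ Dir v to Dir v + e.
            bridge : ∀ {w} → f w ≡ true → Incomparable w v → ¬ Dir w q →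
              ∃ λ e′ → w ∋ e′ ∌ v × Dir v (e′ ⊕ e)
            bridge {w} fw w~v ¬wq with Dir? w e
            ... | yes we = e , (we , ¬ve) , subst (Dir v) (sym (⊕-self e)) (Dir-0 fv)
            ... | no ¬we = e ⊕ q , (index-two fy fw y~w (ye , ¬we) (yq , ¬wq) , ∌v-shift ¬ve) ,
                    subst (Dir v) (solve 2 (λ e q → q ⊜ (e :+ q) :+ e) refl e q) vq
              where
              y~w : Incomparable y w
              y~w with ⊆-or-witness w y
              ... | inj₂ p = (q , yq , ¬wq) , p
              ... | inj₁ w⊆y = ⊥-elim (proj₂ (proj₂ (proj₂ y~v)) (above-incomparable fw fv fy w⊆y (yq , ¬wq)
                      (Incomparable-sym w~v) _ (proj₁ (proj₂ (proj₂ y~v)))))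

            -- If `Dir w` misses `q`, `bridge` for `w` suffices. Otherwise `z`, which misses `q`,
            -- mediates: `d` or `d ⊕ q` is a direction of `z`, and `bridge` for `z` compares it with
            -- `e`.
            close : ∀ {w d} → f w ≡ true → Incomparable w v → w ∋ d ∌ v → Dir v (d ⊕ e)
            close {w} {d} fw w~v d∈@(wd , ¬vd) with Dir? w q
            ... | no ¬wq with bridge fw w~v ¬wq
            ... | e′ , e′∈ , ve′e = subst (Dir v) (solve 3 (λ d e e′ → (d :+ e′) :+ (e′ :+ e) ⊜ d :+ e) refl d e e′)
                    (Dir-⊕ fv (index-two fw fv w~v d∈ e′∈) ve′e)
            close {w} {d} fw w~v d∈@(wd , ¬vd) | yes wq with bridge fz z~v ¬zq
            ... | e′ , e′∈ , ve′e with Dir? z d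
            ... | yes zd = subst (Dir v) (solve 3 (λ d e e′ → (d :+ e′) :+ (e′ :+ e) ⊜ d :+ e) refl d e e′)
                    (Dir-⊕ fv (index-two fz fv z~v (zd , ¬vd) e′∈) ve′e)
            ... | no ¬zd = shift-by-q (subst (Dir v) (solve 4 (λ d q e e′ → ((d :+ q) :+ e′) :+ (e′ :+ e) ⊜ (d :+ q) :+ e) refl d q e e′)
                    (Dir-⊕ fv (index-two fz fv z~v (index-two fw fz w~z (wd , ¬zd) (wq , ¬zq) , ∌v-shift ¬vd) e′∈) ve′e))
              where
              w~z : Incomparable w z
              w~z with ⊆-or-witness z w
              ... | inj₂ p = (q , wq , ¬zq) , p
              ... | inj₁ z⊆w = ⊥-elim (proj₂ (proj₂ (proj₂ w~v)) (above-incomparable fz fv fw z⊆w (wq , ¬zq)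
                      (Incomparable-sym z~v) _ (proj₁ (proj₂ (proj₂ w~v)))))

            InSum : V n → Set
            InSum d = InF d × (Dir v d ⊎ Dir v (d ⊕ e))

            InSum? : ∀ d → Dec (InSum d)
            InSum? d = InF? d ×-dec (Dir? v d ⊎-dec Dir? v (d ⊕ e))

            sum-subspace : Subspace n
            sum-subspace = record { Mem = InSum ; Mem? = InSum? ; 0∈ = 0∈F , inj₁ (Dir-0 fv) ; ⊕∈ = closed }
              where
              closed : ∀ {c d} → InSum c → InSum d → InSum (c ⊕ d)
              closed {c} {d} (c∈ , p) (d∈ , r) = ⊕∈F c∈ d∈ , add p r
                where
                add : Dir v c ⊎ Dir v (c ⊕ e) → Dir v d ⊎ Dir v (d ⊕ e) → Dir v (c ⊕ d) ⊎ Dir v ((c ⊕ d) ⊕ e)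
                add (inj₁ p) (inj₁ r) = inj₁ (Dir-⊕ fv p r)
                add (inj₁ p) (inj₂ r) = inj₂ (subst (Dir v) (sym (⊕-assoc c d e)) (Dir-⊕ fv p r))
                add (inj₂ p) (inj₁ r) = inj₂ (subst (Dir v) (solve 3 (λ c d e → (c :+ e) :+ d ⊜ (c :+ d) :+ e) refl c d e) (Dir-⊕ fv p r))
                add (inj₂ p) (inj₂ r) = inj₁ (subst (Dir v) (solve 3 (λ c d e → (c :+ e) :+ (d :+ e) ⊜ c :+ d) refl c d e) (Dir-⊕ fv p r))

            -- The space generated by `Dir v` and `e` is comparable with every direction: those
            -- strictly above `Dir v` contain `e` by `above-incomparable`, and those incomparable to
            -- it lie inside by `close`. So it is a cut unless it is all of `F`.
            sum-cut : Decomposer f ⊎ IndexAtMost2 v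
            sum-cut with ∃? (λ x → InF? x ×-dec ¬? (InSum? x))
            ... | yes (x , x∈ , x∉) = inj₁ (FromCut.decomposer (record
                  { U = sum-subspace ; U⊆F = proj₁
                  ; inside = e ; inside∈ = proj₁ ye , inj₂ (subst (Dir v) (sym (⊕-self e)) (Dir-0 fv))
                  ; inside≢0 = λ e≡0 → ¬ve (subst (Dir v) (sym e≡0) (Dir-0 fv))
                  ; outside = x ; outside∈F = x∈ ; outside∉ = x∉
                  ; comparable = compare }))
              where
              compare : ∀ {w} → f w ≡ true → (∀ d → InSum d → Dir w d) ⊎ (∀ d → Dir w d → InSum d)
              compare {w} fw with ⊆-or-witness w v | ⊆-or-witness v w
              ... | inj₁ w⊆v | _ = inj₂ λ d wd → proj₁ wd , inj₁ (w⊆v d wd)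
              ... | inj₂ (d , p) | inj₁ v⊆w = inj₁ λ
                    { d (_ , inj₁ vd) → v⊆w d vd
                    ; d (_ , inj₂ vde) → subst (Dir w) (⊕-cancel d e) (Dir-⊕ fw (v⊆w _ vde)
                        (above-incomparable fv fy fw v⊆w p y~v e ye)) }
              ... | inj₂ p | inj₂ r = inj₂ λ d wd → proj₁ wd , [ inj₁ , (λ ¬vd → inj₂ (close fw (p , r) (wd , ¬vd))) ]′ (split d)
                where
                split : ∀ d → Dir v d ⊎ ¬ Dir v d
                split d with Dir? v d
                ... | yes s = inj₁ s
                ... | no s = inj₂ s
            ... | no all = inj₂ λ {c} {d} c∈ d∈ ¬vc ¬vd →
                  subst (Dir v) (solve 3 (λ c d e → (c :+ e) :+ (d :+ e) ⊜ c :+ d) refl c d e)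
                    (Dir-⊕ fv (off c∈ ¬vc) (off d∈ ¬vd))
              where
              off : ∀ {d} → InF d → ¬ Dir v d → Dir v (d ⊕ e)
              off {d} d∈ ¬vd with decidable-stable (InSum? d) (λ ¬m → all (d , d∈ , ¬m))
              ... | _ , inj₁ p = ⊥-elim (¬vd p)
              ... | _ , inj₂ p = p

      index-at-most-2 : ∀ {v} → f v ≡ true → Decomposer f ⊎ IndexAtMost2 v
      index-at-most-2 {v} fv with ∃? (λ g → InF? g ×-dec ¬? (Dir? v g))
      ... | no all = inj₂ λ {d} d∈ _ ¬vd _ → ⊥-elim (all (d , d∈ , ¬vd))
      ... | yes (g , g∈ , ¬vg) with ∃? (λ y → (f y Boolₚ.≟ true) ×-dec Incomparable? y v)
      ... | no h = inj₁ (comparable-to-all fv g g∈ ¬vg λ w fw inc → h (w , fw , inc))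
      ... | yes (y , fy , y~v)
          with ∃? (λ z → (f z Boolₚ.≟ true) ×-dec (Incomparable? z v ×-dec ¬? (Dir? z (q fv g g∈ ¬vg fy y~v))))
      ... | no h = inj₁ (intersection-cut fv g g∈ ¬vg fy y~v λ w fw inc →
              decidable-stable (Dir? w _) λ ¬wq → h (w , fw , inc , ¬wq))
      ... | yes (z , fz , z~v , ¬zq) = sum-cut fv g g∈ ¬vg fy y~v fz z~v ¬zq

      incomparable-partner : ∀ {v g} → f v ≡ true → InF g → ¬ Dir v g →
        Decomposer f ⊎ ∃ λ y → f y ≡ true × Incomparable y v
      incomparable-partner {v} {g} fv g∈ ¬vg with ∃? (λ y → (f y Boolₚ.≟ true) ×-dec Incomparable? y v)
      ... | no h = inj₁ (comparable-to-all fv g g∈ ¬vg λ w fw inc → h (w , fw , inc))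
      ... | yes p = inj₂ p

  -- The pairing β between cosets of F and F

  module Half (half : ∀ {v} → f v ≡ true → ∀ {d e} → InF d → InF e → ¬ Dir v d → ¬ Dir v e → Dir v (d ⊕ e)) where

    β : V n → V n → Bool
    β x u = f x xor f (x ⊕ u)

    f-shift : ∀ x u → f (x ⊕ u) ≡ f x xor β x u
    f-shift x u = BSolver.solve 2 (λ a b → b BSolver.⊜ a BSolver.:+ (a BSolver.:+ b)) refl (f x) (f (x ⊕ u))

    Additive : V n → Set
    Additive x = ∀ {u v} → InF u → InF v → β x (u ⊕ v) ≡ β x u xor β x v

    -- For `x` in E, `β x` is 0 on `Dir x` and 1 on the rest of `F`; a subspace of index at most 2
    -- is the kernel of a functional.
    additive-E : ∀ {x} → f x ≡ true → Additive x
    additive-E {x} fx {u} {v} u∈ v∈ rewrite fx with Dir? x u | Dir? x v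
    ... | yes p | yes q rewrite proj₂ p | proj₂ q | proj₂ (Dir-⊕ fx p q) = refl
    ... | yes p | no q rewrite proj₂ p | ¬Dir⇒false v∈ q | ¬Dir⇒false (⊕∈F u∈ v∈) (Dir-split fx p q) = refl
    ... | no p | yes q rewrite proj₂ q | ¬Dir⇒false u∈ p | ⊕-comm u v
                             | ¬Dir⇒false (⊕∈F v∈ u∈) (Dir-split fx q p) = refl
    ... | no p | no q rewrite ¬Dir⇒false u∈ p | ¬Dir⇒false v∈ q | proj₂ (half fx u∈ v∈ p q) = refl

    shift-additive : ∀ {a d u} → Additive a → InF d → InF u → β (a ⊕ d) u ≡ β a u
    shift-additive {a} {d} {u} add d∈ u∈ = begin
      f (a ⊕ d) xor f ((a ⊕ d) ⊕ u)   ≡⟨ cong (λ z → f (a ⊕ d) xor f z) (⊕-assoc a d u) ⟩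
      f (a ⊕ d) xor f (a ⊕ (d ⊕ u))   ≡⟨ BSolver.solve 3 (λ x y z → (y BSolver.:+ z) BSolver.⊜ (x BSolver.:+ y) BSolver.:+ (x BSolver.:+ z)) refl (f a) (f (a ⊕ d)) (f (a ⊕ (d ⊕ u))) ⟩
      β a d xor β a (d ⊕ u)           ≡⟨ cong (β a d xor_) (add d∈ u∈) ⟩
      β a d xor (β a d xor β a u)     ≡⟨ BSolver.solve 2 (λ x y → x BSolver.:+ (x BSolver.:+ y) BSolver.⊜ y) refl (β a d) (β a u) ⟩
      β a u ∎
      where open ≡-Reasoning

    β-F : ∀ {x u} → InF x → InF u → β x u ≡ false
    β-F x∈ u∈ = cong₂ _xor_ (F-empty x∈) (F-empty (⊕∈F x∈ u∈))

    -- A coset other than `F` contains an element of E, and additivity there makes `β` constant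
    -- along the coset.
    β-add : ∀ {x} → Additive x
    β-add {x} {u} {v} u∈ v∈ with InF? x
    ... | yes x∈ = trans (β-F x∈ (⊕∈F u∈ v∈)) (sym (cong₂ _xor_ (β-F x∈ u∈) (β-F x∈ v∈)))
    ... | no x∉ with F-maximal x x∉
    ... | d , d∈ , fa = trans (sym (to (⊕∈F u∈ v∈)))
            (trans (additive-E fa u∈ v∈) (cong₂ _xor_ (to u∈) (to v∈)))
      where
      to : ∀ {u} → InF u → β (x ⊕ d) u ≡ β x u
      to {u} u∈ = trans (sym (shift-additive (additive-E fa) d∈ u∈)) (cong (λ z → β z u) (⊕-cancel x d))

    β-shift : ∀ {x d u} → InF d → InF u → β (x ⊕ d) u ≡ β x u
    β-shift {x} = shift-additive (β-add {x})

    Zero : V n → Set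
    Zero x = ∀ u → InF u → β x u ≡ false

    NonZero : V n → Set
    NonZero x = ∃ λ u → InF u × β x u ≡ true

    Equal : V n → V n → Set
    Equal x y = ∀ u → InF u → β x u ≡ β y u

    -- Linear independence of the functionals `β x` and `β y`, witnessed by a dual pair of vectors.
    -- Over F₂ this means distinct and nonzero, whence `trichotomy`.
    record Dual (x y : V n) : Set where
      field
        u₁ u₂   : V n
        u₁∈     : InF u₁
        u₂∈     : InF u₂
        x₁      : β x u₁ ≡ true
        x₂      : β x u₂ ≡ false
        y₁      : β y u₁ ≡ false
        y₂      : β y u₂ ≡ true

    NonZero? : ∀ x → Dec (NonZero x)
    NonZero? x = ∃? λ u → InF? u ×-dec (β x u Boolₚ.≟ true)

    zero-or-not : ∀ x → Zero x ⊎ NonZero x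
    zero-or-not x with NonZero? x
    ... | yes p = inj₂ p
    ... | no ¬p = inj₁ λ u u∈ → ¬true⇒false λ e → ¬p (u , u∈ , e)

    zero⇒¬nonzero : ∀ {x} → Zero x → ¬ NonZero x
    zero⇒¬nonzero z (u , u∈ , e) = true≢false e (z u u∈)

    Dual-sym : ∀ {x y} → Dual x y → Dual y x
    Dual-sym d = record { u₁ = u₂ ; u₂ = u₁ ; u₁∈ = u₂∈ ; u₂∈ = u₁∈ ; x₁ = y₂ ; x₂ = y₁ ; y₁ = x₂ ; y₂ = x₁ }
      where open Dual d

    Dual-nonzero : ∀ {x y} → Dual x y → NonZero x
    Dual-nonzero d = _ , Dual.u₁∈ d , Dual.x₁ d

    Dual-cong : ∀ {x x′ y} → Equal x x′ → Dual x y → Dual x′ y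
    Dual-cong eq d = record { u₁ = u₁ ; u₂ = u₂ ; u₁∈ = u₁∈ ; u₂∈ = u₂∈
      ; x₁ = trans (sym (eq u₁ u₁∈)) x₁ ; x₂ = trans (sym (eq u₂ u₂∈)) x₂ ; y₁ = y₁ ; y₂ = y₂ }
      where open Dual d

    Dual-sum : ∀ {x y s} → Dual x y → (∀ u → InF u → β s u ≡ β x u xor β y u) → Dual s y
    Dual-sum d eq = record { u₁ = u₁ ; u₂ = u₁ ⊕ u₂ ; u₁∈ = u₁∈ ; u₂∈ = ⊕∈F u₁∈ u₂∈
      ; x₁ = trans (eq u₁ u₁∈) (cong₂ _xor_ x₁ y₁)
      ; x₂ = trans (eq _ (⊕∈F u₁∈ u₂∈)) (cong₂ _xor_ (trans (β-add u₁∈ u₂∈) (cong₂ _xor_ x₁ x₂))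
                                                  (trans (β-add u₁∈ u₂∈) (cong₂ _xor_ y₁ y₂)))
      ; y₁ = y₁ ; y₂ = trans (β-add u₁∈ u₂∈) (cong₂ _xor_ y₁ y₂) }
      where open Dual d

    dual : ∀ {x y} → NonZero y → (∃ λ u → InF u × β x u ≡ true × β y u ≡ false) → Dual x y
    dual {x} {y} (w , w∈ , yw) (u , u∈ , xu , yu) with bool-cases (β x w)
    ... | inj₂ xw = record { u₁ = u ; u₂ = w ; u₁∈ = u∈ ; u₂∈ = w∈ ; x₁ = xu ; x₂ = xw ; y₁ = yu ; y₂ = yw }
    ... | inj₁ xw = record { u₁ = u ; u₂ = u ⊕ w ; u₁∈ = u∈ ; u₂∈ = ⊕∈F u∈ w∈ ; x₁ = xu
            ; x₂ = trans (β-add u∈ w∈) (cong₂ _xor_ xu xw)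
            ; y₁ = yu ; y₂ = trans (β-add u∈ w∈) (cong₂ _xor_ yu yw) }

    trichotomy : ∀ x {y} → NonZero y → Zero x ⊎ Equal x y ⊎ Dual x y
    trichotomy x {y} y≢0 with zero-or-not x
    ... | inj₁ z = inj₁ z
    ... | inj₂ x≢0 with ∃? (λ u → InF? u ×-dec ¬? (β x u Boolₚ.≟ β y u))
    ... | no all = inj₂ (inj₁ λ u u∈ → decidable-stable (β x u Boolₚ.≟ β y u) λ ne → all (u , u∈ , ne))
    ... | yes (u , u∈ , ne) with bool-cases (β x u) | bool-cases (β y u)
    ... | inj₁ p | inj₁ q = ⊥-elim (ne (trans p (sym q)))
    ... | inj₂ p | inj₂ q = ⊥-elim (ne (trans p (sym q)))
    ... | inj₁ p | inj₂ q = inj₂ (inj₂ (dual y≢0 (u , u∈ , p , q)))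
    ... | inj₂ p | inj₁ q = inj₂ (inj₂ (Dual-sym (dual x≢0 (u , u∈ , q , p))))

    lift : ∀ {x w} → InF w → β x w ≡ true → ∃ λ d → InF d × f (x ⊕ d) ≡ true
    lift {x} {w} w∈ xw with bool-cases (f x)
    ... | inj₁ p = 0v n , 0∈F , at (sym (⊕-identityʳ x)) p
    ... | inj₂ p = w , w∈ , trans (f-shift x w) (cong₂ _xor_ p xw)

    dir : ∀ {x d u} → InF d → InF u → f (x ⊕ d) ≡ true → β x u ≡ false → Dir (x ⊕ d) u
    dir {x} {d} {u} d∈ u∈ fa xu = u∈ , trans (f-shift (x ⊕ d) u) (cong₂ _xor_ fa (trans (β-shift d∈ u∈) xu))

    ¬dir : ∀ {x d u} → InF d → InF u → f (x ⊕ d) ≡ true → β x u ≡ true → ¬ Dir (x ⊕ d) u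
    ¬dir {x} {d} {u} d∈ u∈ fa xu (_ , p) =
      true≢false p (trans (f-shift (x ⊕ d) u) (cong₂ _xor_ fa (trans (β-shift d∈ u∈) xu)))

    -- Where exactly one functional is 1, the `misses` fields give the value. Elsewhere `u` is
    -- written as `u₂ ⊕ (u ⊕ u₂)`, whose summands are of that kind.
    third-value : ∀ {x y d e} → Dual x y → InF d → InF e → (f (x ⊕ d) ≡ true) → (f (y ⊕ e) ≡ true) →
      (T : ThirdCoset (x ⊕ d) (y ⊕ e)) → ∀ {u} → InF u → β (ThirdCoset.c T) u ≡ β x u xor β y u
    third-value {x} {y} {d} {e} D d∈ e∈ fa fb T {u} u∈ = value
      where
      open Dual D
      open ThirdCoset T
      a∌b : ∀ {u} → InF u → β x u ≡ false → β y u ≡ true → (x ⊕ d) ∋ u ∌ (y ⊕ e)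
      a∌b u∈ p q = dir d∈ u∈ fa p , ¬dir e∈ u∈ fb q
      b∌a : ∀ {u} → InF u → β x u ≡ true → β y u ≡ false → (y ⊕ e) ∋ u ∌ (x ⊕ d)
      b∌a u∈ p q = dir e∈ u∈ fb q , ¬dir d∈ u∈ fa p
      ∉c : ∀ {u} → InF u → ¬ Dir c u → β c u ≡ true
      ∉c u∈ ¬cu = cong₂ _xor_ fc (¬Dir⇒false u∈ ¬cu)
      u+u₂∈ = ⊕∈F u∈ u₂∈
      value : β c u ≡ β x u xor β y u
      value with bool-cases (β x u) | bool-cases (β y u)
      ... | inj₂ p | inj₁ q = trans (∉c u∈ (misses₁ (a∌b u∈ p q))) (sym (cong₂ _xor_ p q))
      ... | inj₁ p | inj₂ q = trans (∉c u∈ (misses₂ (b∌a u∈ p q))) (sym (cong₂ _xor_ p q))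
      ... | inj₁ p | inj₁ q = trans (trans (cong (β c) (solve 2 (λ u v → u ⊜ v :+ (u :+ v)) refl u u₂))
              (cong₂ _xor_ fc (proj₂ (crosses (a∌b u₂∈ x₂ y₂) (b∌a u+u₂∈
                (trans (β-add u∈ u₂∈) (cong₂ _xor_ p x₂)) (trans (β-add u∈ u₂∈) (cong₂ _xor_ q y₂)))))))
              (sym (cong₂ _xor_ p q))
      ... | inj₂ p | inj₂ q = trans (trans (cong (β c) (solve 2 (λ u v → u ⊜ v :+ (u :+ v)) refl u u₂))
              (trans (β-add u₂∈ u+u₂∈) (cong₂ _xor_ (∉c u₂∈ (misses₁ (a∌b u₂∈ x₂ y₂)))
                (∉c u+u₂∈ (misses₁ (a∌b u+u₂∈
                  (trans (β-add u∈ u₂∈) (cong₂ _xor_ p x₂)) (trans (β-add u∈ u₂∈) (cong₂ _xor_ q y₂))))))))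
              (sym (cong₂ _xor_ p q))

    dual-sum : ∀ {x y} → Dual x y → ∀ u → InF u → β (x ⊕ y) u ≡ β x u xor β y u
    dual-sum {x} {y} D u u∈ with lift {x} (Dual.u₁∈ D) (Dual.x₁ D) | lift {y} (Dual.u₂∈ D) (Dual.y₂ D)
    ... | d , d∈ , fa | e , e∈ , fb = same-coset (third-coset fa fb
            ((u₂ , dir d∈ u₂∈ fa x₂ , ¬dir e∈ u₂∈ fb y₂) , (u₁ , dir e∈ u₁∈ fb y₁ , ¬dir d∈ u₁∈ fa x₁)))
      where
      open Dual D
      same-coset : ThirdCoset (x ⊕ d) (y ⊕ e) → β (x ⊕ y) u ≡ β x u xor β y u
      same-coset T = trans
        (sym (trans (cong (λ z → β z u) (solve 5 (λ c x d y e → c ⊜ (x :+ y) :+ ((d :+ e) :+ (c :+ ((x :+ d) :+ (y :+ e))))) refl (ThirdCoset.c T) x d y e))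
          (β-shift (⊕∈F (⊕∈F d∈ e∈) (proj₁ (ThirdCoset.near T))) u∈)))
        (third-value D d∈ e∈ fa fb T u∈)

    cong-β : ∀ {x y} → x ≡ y → ∀ u → InF u → β x u ≡ β y u
    cong-β refl _ _ = refl

    -- If `β (x ⊕ y)` and `β y` were independent, `dual-sum` for `x ⊕ y` and `y` would make `β x`
    -- nonzero.
    zero-line : ∀ {x y} → Zero x → NonZero y → Zero (x ⊕ y) ⊎ Equal (x ⊕ y) y
    zero-line {x} {y} x0 y≢0 with trichotomy (x ⊕ y) y≢0
    ... | inj₁ z = inj₁ z
    ... | inj₂ (inj₁ e) = inj₂ e
    ... | inj₂ (inj₂ D) = ⊥-elim (true≢false
            (trans (dual-sum D u₁ u₁∈) (cong₂ _xor_ x₁ y₁))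
            (trans (cong (λ z → β z u₁) (⊕-cancel x y)) (x0 u₁ u₁∈)))
      where open Dual D

    -- Failure of additivity in the coset variable

    module Rank {v₀ w₀} (D₀ : Dual v₀ w₀) where

      partner : ∀ {y} → NonZero y → ∃ λ w → Dual w y
      partner {y} y≢0 with trichotomy v₀ y≢0
      ... | inj₁ z = ⊥-elim (zero⇒¬nonzero z (Dual-nonzero D₀))
      ... | inj₂ (inj₁ e) = w₀ , Dual-sym (Dual-cong e D₀)
      ... | inj₂ (inj₂ D) = v₀ , D

      -- The only obstruction to additivity of `β` in its first argument, as `NoBad.additive` shows.
      Bad : V n → V n → Set
      Bad x y = Zero x × NonZero y × Zero (x ⊕ y)

      Bad? : ∀ x y → Dec (Bad x y)
      Bad? x y = zero? x ×-dec (NonZero? y ×-dec zero? (x ⊕ y))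
        where
        zero? : ∀ x → Dec (Zero x)
        zero? x = ∀? λ u → InF? u →-dec (β x u Boolₚ.≟ false)

      -- If `β (x ⊕ y′)` is nonzero, it equals `β y′`, and `dual-sum` with `y` gives `β y` plus
      -- `β y′` on the total of `x`, `y`, `y′`. But `zero-line` from `x ⊕ y` admits only 0 or `β y′`
      -- there.
      bad-dual : ∀ {x y y′} → Bad x y → Dual y y′ → Bad x y′
      bad-dual {x} {y} {y′} (x0 , _ , xy0) D with zero-line x0 (Dual-nonzero (Dual-sym D))
      ... | inj₁ z = x0 , Dual-nonzero (Dual-sym D) , z
      ... | inj₂ e with zero-line xy0 (Dual-nonzero (Dual-sym D))
      ...   | inj₁ z = ⊥-elim (true≢false
                (trans (dual-sum D′ u₁ u₁∈) (cong₂ _xor_ (trans (e u₁ u₁∈) y₁) x₁))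
                (trans (cong-β (solve 3 (λ x y z → (x :+ z) :+ y ⊜ (x :+ y) :+ z) refl x y y′) u₁ u₁∈) (z u₁ u₁∈)))
        where
        open Dual D
        D′ : Dual (x ⊕ y′) y
        D′ = Dual-cong (λ u u∈ → sym (e u u∈)) (Dual-sym D)
      ...   | inj₂ e′ = ⊥-elim (true≢false
                (trans (dual-sum D′ u₁ u₁∈) (cong₂ _xor_ (trans (e u₁ u₁∈) y₁) x₁))
                (trans (cong-β (solve 3 (λ x y z → (x :+ z) :+ y ⊜ (x :+ y) :+ z) refl x y y′) u₁ u₁∈) (trans (e′ u₁ u₁∈) y₁)))
        where
        open Dual D
        D′ : Dual (x ⊕ y′) y
        D′ = Dual-cong (λ u u∈ → sym (e u u∈)) (Dual-sym D)

      bad-all : ∀ {x y y′} → Bad x y → NonZero y′ → Bad x y′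
      bad-all {x} {y} {y′} B y′≢0 with trichotomy y y′≢0
      ... | inj₁ z = ⊥-elim (zero⇒¬nonzero z (proj₁ (proj₂ B)))
      ... | inj₂ (inj₂ D) = bad-dual B D
      ... | inj₂ (inj₁ e) with partner y′≢0
      ... | w , D = bad-dual (bad-dual B (Dual-cong (λ u u∈ → sym (e u u∈)) (Dual-sym D))) D

      BadAt : V n → Set
      BadAt x = ∃ λ y → Bad x y

      BadAt? : ∀ x → Dec (BadAt x)
      BadAt? x = ∃? (Bad? x)

      -- A witness `w` against `x ⊕ y` is turned into one against `x` or `y`; when `β x` is nonzero,
      -- `bad-all` first exchanges `w` for `x`.
      good : Subspace n
      good = record
        { Mem = λ x → ¬ BadAt x ; Mem? = λ x → ¬? (BadAt? x)
        ; 0∈ = λ (y , _ , y≢0 , z) → zero⇒¬nonzero (λ u u∈ → trans (cong-β (sym (⊕-identityˡ y)) u u∈) (z u u∈)) y≢0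
        ; ⊕∈ = closed }
        where
        closed : ∀ {x y} → ¬ BadAt x → ¬ BadAt y → ¬ BadAt (x ⊕ y)
        closed {x} {y} gx gy (w , B@(z , w≢0 , _)) with zero-or-not x | zero-or-not y
        ... | inj₂ x≢0 | _ = gy (x , y0 , x≢0 , λ u u∈ → trans (cong-β (⊕-comm y x) u u∈) (z u u∈))
          where
          y0 : Zero y
          y0 u u∈ = trans (cong-β (solve 2 (λ x y → y ⊜ (x :+ y) :+ x) refl x y) u u∈) (proj₂ (proj₂ (bad-all B x≢0)) u u∈)
        ... | inj₁ x0 | inj₂ y≢0 = gx (y , x0 , y≢0 , z)
        ... | inj₁ x0 | inj₁ y0 with zero-or-not (x ⊕ w)
        ...   | inj₁ xw0 = gx (w , x0 , w≢0 , xw0)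
        ...   | inj₂ xw≢0 = gy (x ⊕ w , y0 , xw≢0 , λ u u∈ →
                  trans (cong-β (solve 3 (λ x y w → y :+ (x :+ w) ⊜ (x :+ y) :+ w) refl x y w) u u∈) (proj₂ (proj₂ B) u u∈))

      -- Every coset of F off the good subspace is contained in E.
      bad-decomposer : ∀ {x} → BadAt x → Decomposer f
      bad-decomposer {x} bad = record
        { W = good
        ; inside = v₀ ; inside∈ = λ (_ , z , _) → zero⇒¬nonzero z (Dual-nonzero D₀)
        ; inside≢0 = λ { refl → zero⇒¬nonzero (λ u u∈ → β-F 0∈F u∈) (Dual-nonzero D₀) }
        ; outside = x ; outside∉ = λ g → g bad
        ; invariant = λ {y} {w} ¬gy gw → trans (one (λ g → ¬gy (subst (λ z → ¬ BadAt z) (⊕-cancel y w) (⊕∈ g gw)))) (sym (one ¬gy)) }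
        where
        open Subspace good
        one : ∀ {y} → ¬ ¬ BadAt y → f y ≡ true
        one {y} nn with decidable-stable (BadAt? y) nn
        ... | w , y0 , w≢0 , yw0 with InF? y
        ... | yes y∈ = ⊥-elim (zero⇒¬nonzero (λ u u∈ → trans (sym (β-shift y∈ u∈)) (trans (cong-β (⊕-comm w y) u u∈) (yw0 u u∈))) w≢0)
        ... | no y∉ with F-maximal y y∉
        ... | d , d∈ , fyd = trans (trans (cong f (sym (⊕-cancel y d))) (f-shift (y ⊕ d) d))
                (cong₂ _xor_ fyd (trans (β-shift d∈ d∈) (y0 d d∈)))

      -- Bilinear β and vanishing third differences

      module NoBad (no-bad : ∀ x y → ¬ Bad x y) where

        additive : ∀ x y u → InF u → β (x ⊕ y) u ≡ β x u xor β y u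
        additive x y u u∈ with zero-or-not x | zero-or-not y
        ... | inj₁ x0 | inj₂ y≢0 with zero-line x0 y≢0
        ...   | inj₁ z = ⊥-elim (no-bad x y (x0 , y≢0 , z))
        ...   | inj₂ e = trans (e u u∈) (cong (_xor β y u) (sym (x0 u u∈)))
        additive x y u u∈ | inj₂ x≢0 | inj₁ y0 with zero-line y0 x≢0
        ...   | inj₁ z = ⊥-elim (no-bad y x (y0 , x≢0 , z))
        ...   | inj₂ e = trans (trans (cong-β (⊕-comm x y) u u∈) (e u u∈))
                  (trans (sym (Boolₚ.xor-identityʳ _)) (cong (β x u xor_) (sym (y0 u u∈))))
        additive x y u u∈ | inj₁ x0 | inj₁ y0 with zero-or-not (x ⊕ y)
        ...   | inj₁ z = trans (z u u∈) (sym (cong₂ _xor_ (x0 u u∈) (y0 u u∈)))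
        ...   | inj₂ z≢0 = ⊥-elim (no-bad x (x ⊕ y) (x0 , z≢0 ,
                  λ u u∈ → trans (cong-β (solve 2 (λ x y → x :+ (x :+ y) ⊜ y) refl x y) u u∈) (y0 u u∈)))
        additive x y u u∈ | inj₂ x≢0 | inj₂ y≢0 with trichotomy x y≢0
        ...   | inj₁ z = ⊥-elim (zero⇒¬nonzero z x≢0)
        ...   | inj₂ (inj₂ D) = dual-sum D u u∈
        ...   | inj₂ (inj₁ e) = trans (sum-zero u u∈) (sym (trans (cong (_xor β y u) (e u u∈)) (Boolₚ.xor-same (β y u))))
          where
          sum-zero : Zero (x ⊕ y)
          sum-zero with zero-or-not (x ⊕ y)
          ... | inj₁ z = z
          ... | inj₂ z≢0 with trichotomy (x ⊕ y) y≢0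
          ...   | inj₁ z = z
          ...   | inj₂ (inj₂ D) = ⊥-elim (true≢false
                    (trans (dual-sum D u₁ u₁∈) (cong₂ _xor_ x₁ y₁))
                    (trans (cong-β (⊕-cancel x y) u₁ u₁∈) (trans (e u₁ u₁∈) y₁)))
            where open Dual D
          -- The two bracketings of `w`, `x`, `y` would give the sum of `β w` and `β y` in one case
          -- and `β w` in the other.
          ...   | inj₂ (inj₁ e′) with partner y≢0
          ...     | w , Dwy = ⊥-elim (true≢false
                    (trans (cong-β (⊕-assoc w x y) u₂ u₂∈) (trans (dual-sum Dwz u₂ u₂∈) (cong₂ _xor_ x₂ (trans (e′ u₂ u₂∈) y₂))))
                    (trans (dual-sum D″ u₂ u₂∈) (cong₂ _xor_ (trans (dual-sum Dwx u₂ u₂∈) (cong₂ _xor_ x₂ (trans (e u₂ u₂∈) y₂))) y₂)))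
            where
            Dwx : Dual w x
            Dwx = Dual-sym (Dual-cong (λ u u∈ → sym (e u u∈)) (Dual-sym Dwy))
            D″ : Dual (w ⊕ x) y
            D″ = Dual-sum Dwy λ u u∈ → trans (dual-sum Dwx u u∈) (cong (β w u xor_) (e u u∈))
            Dwz : Dual w (x ⊕ y)
            Dwz = Dual-sym (Dual-cong (λ u u∈ → sym (e′ u u∈)) (Dual-sym Dwy))
            open Dual Dwy

        open Dual

        -- By bilinearity the four shifted values of `f` contribute `β x u` four times and `β y u`,
        -- `β z u` twice each.
        cubic-shift : ∀ {u} → InF u → ∀ x y z → cubic f (x ⊕ u) y z ≡ cubic f x y z
        cubic-shift {u} u∈ x y z = begin
          cubic f (x ⊕ u) y z
            ≡⟨ cubic-args f (solve 4 (λ x y z u → (x :+ u) :+ (y :+ z) ⊜ (x :+ (y :+ z)) :+ u) refl x y z u)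
                 (solve 3 (λ x y u → (x :+ u) :+ y ⊜ (x :+ y) :+ u) refl x y u)
                 (solve 3 (λ x y u → (x :+ u) :+ y ⊜ (x :+ y) :+ u) refl x z u) refl ⟩
          f ((x ⊕ (y ⊕ z)) ⊕ u) xor (f ((x ⊕ y) ⊕ u) xor (f ((x ⊕ z) ⊕ u) xor (f (y ⊕ z) xor (f (x ⊕ u) xor (f y xor f z)))))
            ≡⟨ cong₂ _xor_ (trans (f-shift _ u) (cong (f (x ⊕ (y ⊕ z)) xor_) (trans (additive x (y ⊕ z) u u∈) (cong (β x u xor_) (additive y z u u∈)))))
                (cong₂ _xor_ (trans (f-shift _ u) (cong (f (x ⊕ y) xor_) (additive x y u u∈)))
                (cong₂ _xor_ (trans (f-shift _ u) (cong (f (x ⊕ z) xor_) (additive x z u u∈)))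
                (cong (f (y ⊕ z) xor_) (cong (_xor (f y xor f z)) (f-shift x u))))) ⟩
          _ ≡⟨ BSolver.solve 10 (λ xyz xy xz yz x y z a b c →
                 (xyz ∔ (a ∔ (b ∔ c))) ∔ ((xy ∔ (a ∔ b)) ∔ ((xz ∔ (a ∔ c)) ∔ (yz ∔ ((x ∔ a) ∔ (y ∔ z)))))
                 BSolver.⊜ xyz ∔ (xy ∔ (xz ∔ (yz ∔ (x ∔ (y ∔ z)))))) refl
                 (f (x ⊕ (y ⊕ z))) (f (x ⊕ y)) (f (x ⊕ z)) (f (y ⊕ z)) (f x) (f y) (f z) (β x u) (β y u) (β z u) ⟩
          cubic f x y z ∎
          where
          open ≡-Reasoning
          open BSolver using () renaming (_:+_ to _∔_)

        cubic-shift₂ : ∀ {u} → InF u → ∀ x y z → cubic f x (y ⊕ u) z ≡ cubic f x y z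
        cubic-shift₂ {u} u∈ x y z =
          trans (cubic-swap₁₂ f x (y ⊕ u) z) (trans (cubic-shift u∈ y x z) (cubic-swap₁₂ f y x z))

        cubic-shift₃ : ∀ {u} → InF u → ∀ x y z → cubic f x y (z ⊕ u) ≡ cubic f x y z
        cubic-shift₃ {u} u∈ x y z =
          trans (cubic-swap₂₃ f x y (z ⊕ u)) (trans (cubic-shift₂ u∈ x z y) (cubic-swap₂₃ f x z y))

        f-keep : ∀ {x u b} → β x u ≡ false → f x ≡ b → f (x ⊕ u) ≡ b
        f-keep {x} {u} e fx = trans (f-shift x u) (trans (cong (f x xor_) e) (trans (Boolₚ.xor-identityʳ (f x)) fx))

        f-flip : ∀ {x u b} → β x u ≡ true → f x ≡ not b → f (x ⊕ u) ≡ b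
        f-flip {x} {u} {true} e fx = trans (f-shift x u) (cong₂ _xor_ fx e)
        f-flip {x} {u} {false} e fx = trans (f-shift x u) (cong₂ _xor_ fx e)

        pair-shiftˡ : ∀ {x y u} → f ((x ⊕ y) ⊕ u) ≡ false → f ((x ⊕ u) ⊕ y) ≡ false
        pair-shiftˡ {x} {y} {u} = at (solve 3 (λ x y u → (x :+ y) :+ u ⊜ (x :+ u) :+ y) refl x y u)

        pair-shiftʳ : ∀ {x y u} → f ((x ⊕ y) ⊕ u) ≡ false → f (x ⊕ (y ⊕ u)) ≡ false
        pair-shiftʳ {x} {y} {u} = at (⊕-assoc x y u)

        -- Moving x, y, z inside their cosets of F does not change the cubic term, and brings
        -- the plane into a position where claw-freeness evaluates it.
        module Plane (u₁ u₂ : V n) (u₁∈ : InF u₁) (u₂∈ : InF u₂) where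

          -- With these values a shift by `u₁` or `u₂` flips `f` at `y`, at `z` or at a pairwise sum
          -- while it keeps what earlier adjustments have fixed. Neither shift affects `f x`, which
          -- `framed` sets through the maximality of `F`.
          Frame : V n → V n → V n → Set
          Frame x y z = (β x u₁ ≡ false × β x u₂ ≡ false) × (β y u₁ ≡ true × β y u₂ ≡ false) × (β z u₁ ≡ false × β z u₂ ≡ true)

          moved : ∀ {x u a b} → InF u → β x u₁ ≡ a × β x u₂ ≡ b → β (x ⊕ u) u₁ ≡ a × β (x ⊕ u) u₂ ≡ b
          moved u∈ (p , q) = trans (β-shift u∈ u₁∈) p , trans (β-shift u∈ u₂∈) q

          sum₁ : ∀ {x y a b} → β x u₁ ≡ a → β y u₁ ≡ b → β (x ⊕ y) u₁ ≡ a xor b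
          sum₁ p q = trans (additive _ _ u₁ u₁∈) (cong₂ _xor_ p q)

          sum₂ : ∀ {x y a b} → β x u₂ ≡ a → β y u₂ ≡ b → β (x ⊕ y) u₂ ≡ a xor b
          sum₂ p q = trans (additive _ _ u₂ u₂∈) (cong₂ _xor_ p q)

          β≢ : ∀ {x y u} → β x u ≡ true → β y u ≡ false → x ≢ y
          β≢ p q refl = true≢false p q

          step₀ : ∀ {x y z} → Frame x y z → f x ≡ true → f y ≡ true → f z ≡ true →
            f (x ⊕ y) ≡ false → f (x ⊕ z) ≡ false → f (y ⊕ z) ≡ false → cubic f x y z ≡ false
          step₀ ((x₁ , x₂) , (y₁ , y₂) , (z₁ , z₂)) fx fy fz fxy fxz fyz =
            cong₂ _xor_ (claw-free (β≢ y₁ x₁ ∘ sym) (β≢ z₂ x₂ ∘ sym) (β≢ y₁ z₁) fx fy fz fxy fxz fyz)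
              (cong₂ _xor_ fxy (cong₂ _xor_ fxz (cong₂ _xor_ fyz (cong₂ _xor_ fx (cong₂ _xor_ fy fz)))))

          step₁ : ∀ {x y z} → Frame x y z → f x ≡ true → f y ≡ true → f z ≡ true →
            f (x ⊕ y) ≡ false → f (x ⊕ z) ≡ false → cubic f x y z ≡ false
          step₁ {x} {y} {z} F@(fr₁@(x₁ , x₂) , fr₂@(y₁ , y₂) , fr₃@(z₁ , z₂)) fx fy fz fxy fxz with bool-cases (f (y ⊕ z))
          ... | inj₂ fyz = step₀ F fx fy fz fxy fxz fyz
          ... | inj₁ fyz = trans (sym (cubic-shift₂ u₂∈ x y z)) (step₀ (fr₁ , moved u₂∈ fr₂ , fr₃) fx (f-keep y₂ fy) fz
                  (pair-shiftʳ (f-keep (sum₂ x₂ y₂) fxy)) fxz (pair-shiftˡ (f-flip (sum₂ y₂ z₂) fyz)))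

          step₂ : ∀ {x y z} → Frame x y z → f x ≡ true → f y ≡ true → f z ≡ true →
            f (x ⊕ y) ≡ false → cubic f x y z ≡ false
          step₂ {x} {y} {z} F@(fr₁@(x₁ , x₂) , fr₂@(y₁ , y₂) , fr₃@(z₁ , z₂)) fx fy fz fxy with bool-cases (f (x ⊕ z))
          ... | inj₂ fxz = step₁ F fx fy fz fxy fxz
          ... | inj₁ fxz = trans (sym (cubic-shift u₂∈ x y z)) (step₁ (moved u₂∈ fr₁ , fr₂ , fr₃) (f-keep x₂ fx) fy fz
                  (pair-shiftˡ (f-keep (sum₂ x₂ y₂) fxy)) (pair-shiftˡ (f-flip (sum₂ x₂ z₂) fxz)))

          step₃ : ∀ {x y z} → Frame x y z → f x ≡ true → f y ≡ true → f z ≡ true → cubic f x y z ≡ false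
          step₃ {x} {y} {z} F@(fr₁@(x₁ , x₂) , fr₂@(y₁ , y₂) , fr₃) fx fy fz with bool-cases (f (x ⊕ y))
          ... | inj₂ fxy = step₂ F fx fy fz fxy
          ... | inj₁ fxy = trans (sym (cubic-shift u₁∈ x y z)) (step₂ (moved u₁∈ fr₁ , fr₂ , fr₃) (f-keep x₁ fx) fy fz
                  (pair-shiftˡ (f-flip (sum₁ x₁ y₁) fxy)))

          step₄ : ∀ {x y z} → Frame x y z → f x ≡ true → f y ≡ true → cubic f x y z ≡ false
          step₄ {x} {y} {z} F@(fr₁ , fr₂ , fr₃@(z₁ , z₂)) fx fy with bool-cases (f z)
          ... | inj₁ fz = step₃ F fx fy fz
          ... | inj₂ fz = trans (sym (cubic-shift₃ u₂∈ x y z)) (step₃ (fr₁ , fr₂ , moved u₂∈ fr₃) fx fy (f-flip z₂ fz))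

          step₅ : ∀ {x y z} → Frame x y z → f x ≡ true → cubic f x y z ≡ false
          step₅ {x} {y} {z} F@(fr₁ , fr₂@(y₁ , y₂) , fr₃) fx with bool-cases (f y)
          ... | inj₁ fy = step₄ F fx fy
          ... | inj₂ fy = trans (sym (cubic-shift₂ u₁∈ x y z)) (step₄ (fr₁ , moved u₁∈ fr₂ , fr₃) fx (f-flip y₁ fy))

          framed : ∀ {x y z} → Frame x y z → cubic f x y z ≡ false
          framed {x} {y} {z} F@(fr₁ , fr₂₃) with bool-cases (f x) | InF? x
          ... | inj₁ fx | _ = step₅ F fx
          ... | inj₂ _ | yes x∈ = trans (cong (λ t → cubic f t y z) (sym (⊕-identityˡ x)))
                  (trans (cubic-shift x∈ (0v n) y z) (cubic-0 f f0 y z))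
          ... | inj₂ _ | no x∉ with F-maximal x x∉
          ... | d , d∈ , fxd = trans (sym (cubic-shift d∈ x y z)) (step₅ (moved d∈ fr₁ , fr₂₃) fxd)

        -- Adding `y` to `x` clears the value of `β x` at `u₁`, adding `z` the one at `u₂`; `cubic`
        -- stays the same.
        cubic-dual : ∀ x {y z} → Dual y z → cubic f x y z ≡ false
        cubic-dual x {y} {z} D with bool-cases (β x (u₁ D)) | bool-cases (β x (u₂ D))
        ... | inj₂ p | inj₂ q = Plane.framed (u₁ D) (u₂ D) (u₁∈ D) (u₂∈ D) ((p , q) , (x₁ D , x₂ D) , (y₁ D , y₂ D))
        ... | inj₁ p | inj₂ q = trans (sym (cubic-+₂ f x y z)) (Plane.framed (u₁ D) (u₂ D) (u₁∈ D) (u₂∈ D)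
                ((trans (additive x y _ (u₁∈ D)) (cong₂ _xor_ p (x₁ D)) , trans (additive x y _ (u₂∈ D)) (cong₂ _xor_ q (x₂ D)))
                 , (x₁ D , x₂ D) , (y₁ D , y₂ D)))
        ... | inj₂ p | inj₁ q = trans (sym (cubic-+₃ f x y z)) (Plane.framed (u₁ D) (u₂ D) (u₁∈ D) (u₂∈ D)
                ((trans (additive x z _ (u₁∈ D)) (cong₂ _xor_ p (y₁ D)) , trans (additive x z _ (u₂∈ D)) (cong₂ _xor_ q (y₂ D)))
                 , (x₁ D , x₂ D) , (y₁ D , y₂ D)))
        ... | inj₁ p | inj₁ q = trans (sym (trans (cubic-+₃ f (x ⊕ y) y z) (cubic-+₂ f x y z))) (Plane.framed (u₁ D) (u₂ D) (u₁∈ D) (u₂∈ D)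
                ((trans (additive (x ⊕ y) z _ (u₁∈ D)) (cong₂ _xor_ (trans (additive x y _ (u₁∈ D)) (cong₂ _xor_ p (x₁ D))) (y₁ D)) ,
                  trans (additive (x ⊕ y) z _ (u₂∈ D)) (cong₂ _xor_ (trans (additive x y _ (u₂∈ D)) (cong₂ _xor_ q (x₂ D))) (y₂ D)))
                 , (x₁ D , x₂ D) , (y₁ D , y₂ D)))

        -- The second hypothesis kills the right side of `fourth-difference`, so `x` may be
        -- exchanged for `x ⊕ w`, whose functional can be made independent of `β z`.
        cubic-by-fourth : ∀ {x y z} w → cubic f (x ⊕ w) y z ≡ false → (∀ t → cubic f t w z ≡ false) → cubic f x y z ≡ false
        cubic-by-fourth {x} {y} {z} w e h = begin
          cubic f x y z
            ≡⟨ BSolver.solve 3 (λ a b c → b BSolver.⊜ (a BSolver.:+ (b BSolver.:+ c)) BSolver.:+ (a BSolver.:+ c)) refl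
                 (cubic f (x ⊕ w) y z) (cubic f x y z) (cubic f w y z) ⟩
          (cubic f (x ⊕ w) y z xor (cubic f x y z xor cubic f w y z)) xor (cubic f (x ⊕ w) y z xor cubic f w y z)
            ≡⟨ cong₂ _xor_ (trans (fourth-difference f x w y z) (cong₂ _xor_ (h (x ⊕ y)) (cong₂ _xor_ (h x) (h y))))
                 (cong₂ _xor_ e (trans (cubic-swap₁₂ f w y z) (h y))) ⟩
          false ∎
          where open ≡-Reasoning

        cubic-nonzero : ∀ x y {z} → NonZero z → cubic f x y z ≡ false
        cubic-nonzero x y {z} z≢0 with trichotomy x z≢0 | partner z≢0
        ... | inj₂ (inj₂ D) | _ = trans (cubic-swap₁₂ f x y z) (cubic-dual y D)
        ... | inj₁ x0 | w , D = cubic-by-fourth w (trans (cubic-swap₁₂ f (x ⊕ w) y z) (cubic-dual y (Dual-cong eq D))) (λ t → cubic-dual t D)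
          where
          eq : Equal w (x ⊕ w)
          eq u u∈ = sym (trans (additive x w u u∈) (cong (_xor β w u) (x0 u u∈)))
        ... | inj₂ (inj₁ x~z) | w , D = cubic-by-fourth w (trans (cubic-swap₁₂ f (x ⊕ w) y z) (cubic-dual y (Dual-sum D eq))) (λ t → cubic-dual t D)
          where
          eq : ∀ u → InF u → β (x ⊕ w) u ≡ β w u xor β z u
          eq u u∈ = trans (additive x w u u∈) (trans (cong (_xor β w u) (x~z u u∈)) (Boolₚ.xor-comm (β z u) (β w u)))

        cubic-vanishes : ∀ x y z → cubic f x y z ≡ false
        cubic-vanishes x y z with zero-or-not x
        ... | inj₂ x≢0 = trans (trans (cubic-swap₁₂ f x y z) (cubic-swap₂₃ f y x z)) (cubic-nonzero y z x≢0)
        ... | inj₁ x0 = cubic-by-fourth v₀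
                (trans (trans (cubic-swap₁₂ f (x ⊕ v₀) y z) (cubic-swap₂₃ f y (x ⊕ v₀) z)) (cubic-nonzero y z v₀≢0′))
                (λ t → trans (cubic-swap₂₃ f t v₀ z) (cubic-nonzero t z v₀≢0))
          where
          v₀≢0 = Dual-nonzero D₀
          v₀≢0′ : NonZero (x ⊕ v₀)
          v₀≢0′ = proj₁ v₀≢0 , proj₁ (proj₂ v₀≢0) ,
            trans (additive x v₀ _ (proj₁ (proj₂ v₀≢0))) (cong₂ _xor_ (x0 _ (proj₁ (proj₂ v₀≢0))) (proj₂ (proj₂ v₀≢0)))

  -- Decomposer or vanishing third differences

  F-decomposer : ∀ {u y} → InF u → u ≢ 0v n → ¬ InF y → (∀ v → f v ≡ true → ∀ d → InF d → Dir v d) → Decomposer f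
  F-decomposer {u} {y} u∈ u≢0 y∉ full = record
    { W = F ; inside = u ; inside∈ = u∈ ; inside≢0 = u≢0 ; outside = y ; outside∉ = y∉
    ; invariant = λ {x} {w} _ w∈ → invariant x w∈ }
    where
    invariant : ∀ x {w} → InF w → f (x ⊕ w) ≡ f x
    invariant x {w} w∈ with bool-cases (f x) | bool-cases (f (x ⊕ w))
    ... | inj₁ p | _ = trans (proj₂ (full x p w w∈)) (sym p)
    ... | inj₂ p | inj₂ q = trans q (sym p)
    ... | inj₂ p | inj₁ q = ⊥-elim (true≢false (at (⊕-cancel x w) (proj₂ (full _ q w w∈))) p)

  incomparable⇒dual : (half : ∀ {v} → f v ≡ true → ∀ {d e} → InF d → InF e → ¬ Dir v d → ¬ Dir v e → Dir v (d ⊕ e)) →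
    ∀ {v y} → f v ≡ true → f y ≡ true → Incomparable y v → Half.Dual half v y
  incomparable⇒dual half fv fy ((d , yd , ¬vd) , (e , ve , ¬ye)) = record
    { u₁ = d ; u₂ = e ; u₁∈ = proj₁ yd ; u₂∈ = proj₁ ve
    ; x₁ = cong₂ _xor_ fv (¬Dir⇒false (proj₁ yd) ¬vd) ; x₂ = cong₂ _xor_ fv (proj₂ ve)
    ; y₁ = cong₂ _xor_ fy (proj₂ yd) ; y₂ = cong₂ _xor_ fy (¬Dir⇒false (proj₁ ve) ¬ye) }

  -- The subspace inside `F` has the dimension of the excluded flats, so that a section of points
  -- over it is contradictory; being positive, it also supplies `u₀`.
  dichotomy : ∀ {k} (L : V (suc k) → V n) → IsLinear L → TrivialKernel L → (∀ h → InF (L h)) → NoFlat f (suc k) →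
    Decomposer f ⊎ (∀ x y z → cubic f x y z ≡ false)
  dichotomy {k} L lin ker L∈ no-flat with points-cut-or-section L lin ker L∈ no-flat
  ... | inj₁ D = inj₁ D
  ... | inj₂ no-points = go₁
    where
    u₀ = L (true ∷ 0v k)
    u₀≢0 : u₀ ≢ 0v n
    u₀≢0 e with ker _ e
    ... | ()
    open NoPoints no-points u₀ (L∈ _) u₀≢0
    Goal = Decomposer f ⊎ (∀ x y z → cubic f x y z ≡ false)
    go₃ : (none : ∀ v → ¬ Isolated v) → (∀ v → f v ≡ true → NoIsolated.IndexAtMost2 none v) → Goal
    go₃ none half′ with ∃? (λ v → (f v Boolₚ.≟ true) ×-dec ∃? (λ g → InF? g ×-dec ¬? (Dir? v g)))
    -- Now every direction is all of `F`, so E is a union of cosets of `F`, and it is empty if `F`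
    -- is the whole space.
    ... | no full with ∃? (λ y → ¬? (InF? y))
    ... | yes (y , y∉) = inj₁ (F-decomposer (L∈ _) u₀≢0 y∉ λ v fv d d∈ →
            decidable-stable (Dir? v d) λ ¬vd → full (v , fv , d , d∈ , ¬vd))
    ... | no all = inj₂ λ x y z → cong₂ _xor_ (vanish _) (cong₂ _xor_ (vanish _) (cong₂ _xor_ (vanish _)
            (cong₂ _xor_ (vanish _) (cong₂ _xor_ (vanish _) (cong₂ _xor_ (vanish _) (vanish _))))))
      where
      vanish : ∀ x → f x ≡ false
      vanish x = F-empty (decidable-stable (InF? x) λ x∉ → all (x , x∉))
    go₃ none half′ | yes (v , fv , g , g∈ , ¬vg) with NoIsolated.incomparable-partner none fv g∈ ¬vg
    ... | inj₁ D = inj₁ D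
    ... | inj₂ (y , fy , y~v) = go₄ (incomparable⇒dual half fv fy y~v)
      where
      half : ∀ {v} → f v ≡ true → ∀ {d e} → InF d → InF e → ¬ Dir v d → ¬ Dir v e → Dir v (d ⊕ e)
      half {v} fv = half′ v fv
      go₄ : Half.Dual half v y → Goal
      go₄ D₀ with ∃? (Half.Rank.BadAt? half D₀)
      ... | yes (x , bad) = inj₁ (Half.Rank.bad-decomposer half D₀ bad)
      ... | no none = inj₂ (Half.Rank.NoBad.cubic-vanishes half D₀ λ x y b → none (x , y , b))
    go₂ : (∀ v → ¬ Isolated v) → Goal
    go₂ none with choose {P = λ v → f v ≡ true → NoIsolated.IndexAtMost2 none v} step
      where
      step : ∀ v → Decomposer f ⊎ (f v ≡ true → NoIsolated.IndexAtMost2 none v)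
      step v with bool-cases (f v)
      ... | inj₂ ¬fv = inj₂ λ fv → ⊥-elim (true≢false fv ¬fv)
      ... | inj₁ fv with NoIsolated.index-at-most-2 none fv
      ... | inj₁ D = inj₁ D
      ... | inj₂ h = inj₂ λ _ → h
    ... | inj₁ D = inj₁ D
    ... | inj₂ half′ = go₃ none half′
    go₁ : Goal
    go₁ with ∃? Isolated?
    ... | yes (v , iso) = inj₁ (isolated-decomposer iso)
    ... | no none = go₂ λ v iso → none (v , iso)

-- Ramsey theory over F₂

size : ℕ → ℕ
size zero = 1
size (suc n) = size n + size n

size-positive : ∀ n → 1 ≤ size n
size-positive zero = s≤s z≤n
size-positive (suc n) = ≤-trans (size-positive n) (m≤m+n (size n) (size n))

encode : ∀ {n} → V n → Fin (size n)
encode [] = zero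
encode (false ∷ x) = encode x ↑ˡ _
encode {suc n} (true ∷ x) = size n ↑ʳ encode x

decode : ∀ {n} → Fin (size n) → V n
decode {zero} _ = []
decode {suc n} i = [ (λ j → false ∷ decode j) , (λ j → true ∷ decode j) ]′ (splitAt (size n) i)

decode-encode : ∀ {n} (x : V n) → decode (encode x) ≡ x
decode-encode [] = refl
decode-encode {suc n} (false ∷ x) rewrite splitAt-↑ˡ (size n) (encode x) (size n) = cong (false ∷_) (decode-encode x)
decode-encode {suc n} (true ∷ x) rewrite splitAt-↑ʳ (size n) (size n) (encode x) = cong (true ∷_) (decode-encode x)

encode-decode : ∀ {n} (i : Fin (size n)) → encode {n} (decode i) ≡ i
encode-decode {zero} zero = refl
encode-decode {suc n} i with splitAt (size n) i in eq
... | inj₁ j = trans (cong (_↑ˡ size n) (encode-decode {n} j)) (splitAt⁻¹-↑ˡ eq)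
... | inj₂ j = trans (cong (size n ↑ʳ_) (encode-decode {n} j)) (splitAt⁻¹-↑ʳ eq)

collision : ∀ {n} (g : V (suc n) → V n) → ∃ λ x → ∃ λ y → x ≢ y × g x ≡ g y
collision {n} g with pigeonhole (≤-trans (s≤s (m≤n+m (size n) 0)) (+-monoˡ-≤ (size n) (size-positive n))) (encode {n} ∘ g ∘ decode {suc n})
... | i , j , i<j , eq = decode i , decode j
      , (λ e → <⇒≢ i<j (trans (sym (encode-decode {suc n} i)) (trans (cong (encode {suc n}) e) (encode-decode {suc n} j))))
      , trans (sym (decode-encode _)) (trans (cong decode eq) (decode-encode _))

-- Codes a colouring as a vector, so that `collision` can find two equal slices.
table : ∀ {n} → (V n → Bool) → V (size n)
table {zero} f = f [] ∷ []
table {suc n} f = table (f ∘ (false ∷_)) ++ table (f ∘ (true ∷_))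

table-injective : ∀ {n} {f g : V n → Bool} → table f ≡ table g → ∀ x → f x ≡ g x
table-injective {zero} eq [] = Vecₚ.∷-injectiveˡ eq
table-injective {suc n} {f} {g} eq (b ∷ x)
  with Vecₚ.++-injective (table (f ∘ (false ∷_))) (table (g ∘ (false ∷_))) eq
table-injective {suc n} {f} {g} eq (false ∷ x) | p , q = table-injective p x
table-injective {suc n} {f} {g} eq (true ∷ x) | p , q = table-injective q x

record MonochromaticFlat {n} (f : V n → Bool) (j : ℕ) : Set where
  field
    base   : V n
    L      : V j → V n
    linear : IsLinear L
    kernel : TrivialKernel L
    colour : Bool
    mono   : ∀ h → f (base ⊕ L h) ≡ colour

-- With `m` the previous bound, `V m` has 2 to the power `size m` colourings; one coordinate more
-- than `size m` gives enough slices for two to agree.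
two-colour-bound : ℕ → ℕ
two-colour-bound zero = 0
two-colour-bound (suc j) = suc (size (two-colour-bound j)) + two-colour-bound j

-- Two equal slices of f double a monochromatic affine flat of the slice.
two-colour : ∀ j (f : V (two-colour-bound j) → Bool) → MonochromaticFlat f j
two-colour zero f = record { base = [] ; L = λ _ → [] ; linear = λ _ _ → refl
  ; kernel = λ { [] _ → refl } ; colour = f [] ; mono = λ _ → refl }
two-colour (suc j) f with collision (λ p → table (λ x → f (p ++ x)))
... | p , p′ , p≢p′ , eq = record
  { base = p ++ base
  ; L = extendBy (λ h → 0v _ ++ L h) ((p ⊕ p′) ++ 0v _)
  ; linear = extendBy-linear _ _ λ x y → trans (cong (0v _ ++_) (linear x y))
      (trans (cong (_++ (L x ⊕ L y)) (sym (⊕-self (0v _)))) (sym (++-⊕ (0v _) (0v _) (L x) (L y))))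
  ; kernel = extendBy-kernel _ _ (λ h e → kernel h (proj₂ (++≡0 (0v _) e)))
      λ h e → ≢⇒⊕≢0 p≢p′ (trans (sym (⊕-identityˡ _)) (proj₁ (++≡0 (0v _ ⊕ (p ⊕ p′))
        (trans (sym (++-⊕ (0v _) (p ⊕ p′) (L h) (0v _))) e))))
  ; colour = colour
  ; mono = mono′ }
  where
  open MonochromaticFlat (two-colour j (λ x → f (p ++ x)))
  mono′ : ∀ h → f ((p ++ base) ⊕ extendBy (λ h → 0v _ ++ L h) ((p ⊕ p′) ++ 0v _) h) ≡ colour
  mono′ (false ∷ h) = trans (cong f (trans (cong ((p ++ base) ⊕_) (⊕-identityʳ _))
    (trans (++-⊕ p (0v _) base (L h)) (cong (_++ (base ⊕ L h)) (⊕-identityʳ p))))) (mono h)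
  mono′ (true ∷ h) = trans (cong f (trans (cong ((p ++ base) ⊕_) (++-⊕ (0v _) (p ⊕ p′) (L h) (0v _)))
    (trans (++-⊕ p (0v _ ⊕ (p ⊕ p′)) base (L h ⊕ 0v _))
      (cong₂ _++_ (solve 2 (λ p q → p :+ (:0 :+ (p :+ q)) ⊜ q) refl p p′) (cong (base ⊕_) (⊕-identityʳ (L h)))))))
    (trans (sym (table-injective eq (base ⊕ L h))) (mono h))

complement : ∀ {n} (x : V (suc n)) → x ≢ 0v (suc n) →
  ∃ λ (C : V n → V (suc n)) → IsLinear C × TrivialKernel C × (∀ h → C h ≢ x)
complement (true ∷ x) _ = (false ∷_) , (λ _ _ → refl) , (λ h e → Vecₚ.∷-injectiveʳ e) , λ h ()
complement {zero} (false ∷ []) x≢0 = ⊥-elim (x≢0 refl)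
complement {suc n} (false ∷ x) x≢0 with complement x (λ { refl → x≢0 refl })
... | C , lin , ker , off = (λ { (t ∷ h) → t ∷ C h })
      , (λ { (s ∷ x) (t ∷ y) → cong ((s xor t) ∷_) (lin x y) })
      , (λ { (t ∷ h) e → cong₂ _∷_ (Vecₚ.∷-injectiveˡ e) (ker h (Vecₚ.∷-injectiveʳ e)) })
      , λ { (t ∷ h) e → off h (Vecₚ.∷-injectiveʳ e) }

record EmptyAffineFlat {n} (f : V n → Bool) (j : ℕ) : Set where
  field
    base   : V n
    L      : V j → V n
    linear : IsLinear L
    kernel : TrivialKernel L
    base∉  : ∀ h → base ⊕ L h ≢ 0v n
    empty  : ∀ h → f (base ⊕ L h) ≡ false

-- The summand `j` leaves room for the flat when E is empty; the `suc` accounts for the vector `x`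
-- that is split off.
affine-bound : ℕ → ℕ → ℕ
affine-bound zero j = 0
affine-bound (suc t) j = suc (j + affine-bound t (two-colour-bound j))

-- For `x` in E, `f′` marks the vectors of a complement that stay in E when `x` is added; a t-flat
-- of such vectors together with `x` spans a flat of dimension `suc t` in E. On an affine flat
-- without marks, a monochromatic part avoids E or its translate by `x` does.
affine-flat : ∀ t j (f : V (affine-bound t j) → Bool) → f (0v _) ≡ false → NoFlat f t → EmptyAffineFlat f j
affine-flat zero j f f0 none = ⊥-elim (none (λ _ → []) (λ _ _ → refl) λ { {[]} h≢0 → ⊥-elim (h≢0 refl) })
affine-flat (suc t) j f f0 none with ∃? (λ x → f x Boolₚ.≟ true)
... | no all = record
  { base = true ∷ 0v _ ; L = λ h → false ∷ (h ++ 0v _)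
  ; linear = λ x y → cong (false ∷_) (trans (cong ((x ⊕ y) ++_) (sym (⊕-self (0v _)))) (sym (++-⊕ x y _ _)))
  ; kernel = λ h e → proj₁ (++≡0 h (Vecₚ.∷-injectiveʳ e))
  ; base∉ = λ h () ; empty = λ h → ¬true⇒false λ e → all (_ , e) }
... | yes (x , fx) with complement x (λ { refl → true≢false fx f0 })
... | C , C-lin , C-ker , C-off = from (affine-flat t (two-colour-bound j) f′
        (cong (_∧ f (D (0v _) ⊕ x)) (trans (cong f (linear-0 D D-lin)) f0)) none′)
  where
  m = affine-bound t (two-colour-bound j)
  D : V m → V (suc (j + m))
  D h = C (0v j ++ h)
  D-lin : IsLinear D
  D-lin x y = trans (cong C (trans (cong (_++ (x ⊕ y)) (sym (⊕-self (0v j)))) (sym (++-⊕ (0v j) (0v j) x y)))) (C-lin _ _)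
  D-ker : TrivialKernel D
  D-ker h e = proj₂ (++≡0 (0v j) (C-ker _ e))
  f′ : V m → Bool
  f′ y = f (D y) ∧ f (D y ⊕ x)
  both : ∀ {a b} → a ∧ b ≡ true → a ≡ true × b ≡ true
  both {true} {true} _ = refl , refl
  none′ : NoFlat f′ t
  none′ G G-lin ones = none (extendBy (D ∘ G) x) (extendBy-linear _ x λ a b → trans (cong D (G-lin a b)) (D-lin _ _)) ones′
    where
    DG0 : D (G (0v t)) ≡ 0v _
    DG0 = trans (cong D (linear-0 G G-lin)) (linear-0 D D-lin)
    ones′ : ∀ {h} → h ≢ 0v (suc t) → f (extendBy (D ∘ G) x h) ≡ true
    ones′ {false ∷ h} h≢0 = trans (cong f (⊕-identityʳ _)) (proj₁ (both (ones λ { refl → h≢0 refl })))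
    ones′ {true ∷ h} _ with h ≟ᵥ 0v t
    ... | yes refl = trans (cong f (trans (cong (_⊕ x) DG0) (⊕-identityˡ x))) fx
    ... | no h≢0 = proj₂ (both {f (D (G h))} (ones h≢0))
  from : EmptyAffineFlat f′ (two-colour-bound j) → EmptyAffineFlat f j
  from A = pick (two-colour j (λ h → f (D (A.base ⊕ A.L h))))
    where
    module A = EmptyAffineFlat A
    pick : MonochromaticFlat (λ h → f (D (A.base ⊕ A.L h))) j → EmptyAffineFlat f j
    pick B = result colour refl
      where
      open MonochromaticFlat B
      L′ : V j → V (suc (j + m))
      L′ = D ∘ A.L ∘ L
      point : ∀ h → D (A.base ⊕ A.L base) ⊕ L′ h ≡ D (A.base ⊕ A.L (base ⊕ L h))
      point h = trans (sym (D-lin _ _)) (cong D (trans (⊕-assoc A.base _ _) (cong (A.base ⊕_) (sym (A.linear base (L h))))))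
      point-x : ∀ h → (D (A.base ⊕ A.L base) ⊕ x) ⊕ L′ h ≡ D (A.base ⊕ A.L (base ⊕ L h)) ⊕ x
      point-x h = trans (solve 3 (λ a x b → (a :+ x) :+ b ⊜ (a :+ b) :+ x) refl (D (A.base ⊕ A.L base)) x (L′ h)) (cong (_⊕ x) (point h))
      L′-lin : IsLinear L′
      L′-lin a b = trans (cong (D ∘ A.L) (linear a b)) (trans (cong D (A.linear _ _)) (D-lin _ _))
      L′-ker : TrivialKernel L′
      L′-ker h e = kernel h (A.kernel _ (D-ker _ e))
      other : ∀ {a b} → a ∧ b ≡ false → a ≡ true → b ≡ false
      other e refl = e
      result : ∀ c → colour ≡ c → EmptyAffineFlat f j
      result false c = record { base = D (A.base ⊕ A.L base) ; L = L′ ; linear = L′-lin ; kernel = L′-ker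
        ; base∉ = λ h e → A.base∉ _ (D-ker _ (trans (sym (point h)) e))
        ; empty = λ h → trans (cong f (point h)) (trans (mono h) c) }
      result true c = record { base = D (A.base ⊕ A.L base) ⊕ x ; L = L′ ; linear = L′-lin ; kernel = L′-ker
        ; base∉ = λ h e → C-off _ (trans (solve 2 (λ a x → a ⊜ (a :+ x) :+ x) refl _ x)
            (trans (cong (_⊕ x) (trans (sym (point-x h)) e)) (⊕-identityˡ x)))
        ; empty = λ h → trans (cong f (point-x h)) (other (A.empty _) (trans (mono h) c)) }

record EmptyFlat {n} (f : V n → Bool) (N : ℕ) : Set where
  field
    L      : V N → V n
    linear : IsLinear L
    kernel : TrivialKernel L
    empty  : ∀ h → f (L h) ≡ false

ramsey-bound : ℕ → ℕ → ℕ
ramsey-bound t zero = 0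
ramsey-bound t (suc N) = affine-bound t (ramsey-bound t N)

-- Induction works in the direction space of an E-free affine flat; adjoining the base point to the
-- subspace found there adds only vectors of that affine flat.
ramsey : ∀ t N (f : V (ramsey-bound t N) → Bool) → f (0v _) ≡ false → NoFlat f t → EmptyFlat f N
ramsey t zero f f0 none = record { L = λ _ → [] ; linear = λ _ _ → refl ; kernel = λ { [] _ → refl } ; empty = λ _ → f0 }
ramsey t (suc N) f f0 none = from (affine-flat t (ramsey-bound t N) f f0 none)
  where
  from : EmptyAffineFlat f (ramsey-bound t N) → EmptyFlat f (suc N)
  from A = add (ramsey t N (f ∘ A.L) (trans (cong f (linear-0 A.L A.linear)) f0) (NoFlat-∘ {f = f} A.L A.linear none))
    where
    module A = EmptyAffineFlat A
    add : EmptyFlat (f ∘ A.L) N → EmptyFlat f (suc N)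
    add B = record
      { L = extendBy (A.L ∘ L) A.base
      ; linear = extendBy-linear _ _ λ x y → trans (cong A.L (linear x y)) (A.linear _ _)
      ; kernel = extendBy-kernel _ _ (λ h e → kernel h (A.kernel _ e)) λ h e → A.base∉ (L h) (trans (⊕-comm _ _) e)
      ; empty = λ { (false ∷ h) → trans (cong f (⊕-identityʳ _)) (empty h)
                  ; (true ∷ h) → trans (cong f (⊕-comm _ _)) (A.empty (L h)) } }
      where open EmptyFlat B

initial : ∀ {m n} → m ≤ n → V m → V n
initial z≤n _ = 0v _
initial (s≤s m≤n) (b ∷ x) = b ∷ initial m≤n x

initial-linear : ∀ {m n} (m≤n : m ≤ n) → IsLinear (initial m≤n)
initial-linear z≤n x y = sym (⊕-self (0v _))
initial-linear (s≤s m≤n) (a ∷ x) (b ∷ y) = cong ((a xor b) ∷_) (initial-linear m≤n x y)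

initial-kernel : ∀ {m n} (m≤n : m ≤ n) → TrivialKernel (initial m≤n)
initial-kernel z≤n [] e = refl
initial-kernel (s≤s m≤n) (a ∷ x) e = cong₂ _∷_ (Vecₚ.∷-injectiveˡ e) (initial-kernel m≤n x (Vecₚ.∷-injectiveʳ e))

ramsey-≤ : ∀ t N {n} → ramsey-bound t N ≤ n → (f : V n → Bool) → f (0v n) ≡ false → NoFlat f t → EmptyFlat f N
ramsey-≤ t N le f f0 none = record
  { L = initial le ∘ L
  ; linear = λ x y → trans (cong (initial le) (linear x y)) (initial-linear le _ _)
  ; kernel = λ h e → kernel h (initial-kernel le _ e)
  ; empty = empty }
  where
  open EmptyFlat (ramsey t N (f ∘ initial le) (trans (cong f (linear-0 (initial le) (initial-linear le))) f0)
    (NoFlat-∘ {f = f} (initial le) (initial-linear le) none))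

-- Maximal E-free subspaces

record MaximalEmpty {n} (f : V n → Bool) (gs vs : List (V n)) : Set where
  field
    generators : List (V n)
    extends    : ∀ {x} → Span gs x → Span generators x
    empty      : ∀ {x} → Span generators x → f x ≡ false
    maximal    : ∀ {v} → v ∈ₗ vs → Span generators v ⊎ ∃ λ d → Span generators d × f (v ⊕ d) ≡ true

-- One pass suffices: a `d` that blocks `v` remains in the growing span.
greedy : ∀ {n} (f : V n → Bool) gs vs → (∀ {x} → Span gs x → f x ≡ false) → MaximalEmpty f gs vs
greedy f gs [] e = record { generators = gs ; extends = id ; empty = e ; maximal = λ () }
greedy {n} f gs (v ∷ vs) e with ∃? (λ d → Span? gs d ×-dec (f (v ⊕ d) Boolₚ.≟ true))
... | yes (d , d∈ , fvd) = record { generators = generators ; extends = extends ; empty = empty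
      ; maximal = λ { (here refl) → inj₂ (d , extends d∈ , fvd) ; (there i) → maximal i } }
  where open MaximalEmpty (greedy f gs vs e)
... | no none = record { generators = generators ; extends = extends ∘ inj₁ ; empty = empty
      ; maximal = λ { (here refl) → inj₁ (extends (∈⇒Span (here refl))) ; (there i) → maximal i } }
  where
  e′ : ∀ {x} → Span (v ∷ gs) x → f x ≡ false
  e′ (inj₁ s) = e s
  e′ {x} (inj₂ s) = ¬true⇒false λ fx → none (x ⊕ v , s , trans (cong f (solve 2 (λ x v → v :+ (x :+ v) ⊜ x) refl x v)) fx)
  open MaximalEmpty (greedy f (v ∷ gs) vs e′)

-- `ramsey-bound` takes `suc s` twice: once for the excluded flats, once for the E-free subspace,
-- which `dichotomy` wants of the same dimension.
decompose-or-quadratic : ∀ {n} s (f : V n → Bool) → f (0v n) ≡ false → ClawFreeFun f → NoFlat f (suc s) →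
  ramsey-bound (suc s) (suc s) ≤ n → Decomposer f ⊎ (∀ x y z → cubic f x y z ≡ false)
decompose-or-quadratic {n} s f f0 cf none le = from (ramsey-≤ (suc s) (suc s) le f f0 none)
  where
  from : EmptyFlat f (suc s) → Decomposer f ⊎ (∀ x y z → cubic f x y z ≡ false)
  from A = Cosets.dichotomy f f0 cf (span generators) empty maximal′ L linear kernel
      (λ h → extends (∈⇒Span (∈ₗ.∈-map⁺ L (allV-complete h)))) none
    where
    open EmptyFlat A using (L; linear; kernel)
    image : ∀ {x} → Span (List.map L (allV (suc s))) x → ∃ λ h → x ≡ L h
    image = Span-ind {P = λ x → ∃ λ h → x ≡ L h} (List.map L (allV (suc s)))
      (0v _ , sym (linear-0 L linear)) step
      where
      step : ∀ {x g} → g ∈ₗ List.map L (allV (suc s)) → (∃ λ h → x ≡ L h) → ∃ λ h → x ⊕ g ≡ L h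
      step g∈ (h , refl) with ∈ₗ.∈-map⁻ L g∈
      ... | h′ , _ , refl = h ⊕ h′ , sym (linear h h′)
    open MaximalEmpty (greedy f (List.map L (allV (suc s))) (allV n)
      (λ x∈ → trans (cong f (proj₂ (image x∈))) (EmptyFlat.empty A _)))
    maximal′ : ∀ v → ¬ Span generators v → ∃ λ d → Span generators d × f (v ⊕ d) ≡ true
    maximal′ v v∉ with maximal (allV-complete v)
    ... | inj₁ v∈ = ⊥-elim (v∉ v∈)
    ... | inj₂ r = r

-- Claws, flats and planes in terms of the indicator function

-- Otherwise `a`, `b`, `c` span a plane that meets E in a claw. They are independent because `c`
-- lies in E and `a ⊕ b` does not.
claw-free-function : ∀ {M} → ClawFree M → ClawFreeFun (E M)
claw-free-function {M} cf {a} {b} {c} a≢b a≢c b≢c fa fb fc fab fac fbc = ¬false⇒true λ fabc →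
  cf L L-linear (trivial-kernel⇒injective L-linear L-kernel) e₁ e₂ e₃ independent
    (id , id , (λ _ _ → refl) , (λ _ → refl) , (λ _ → refl) , sameE fabc)
  where
  n = dim M
  f = E M
  L : V 3 → V n
  L (s ∷ t ∷ u ∷ []) = scale s a ⊕ (scale t b ⊕ scale u c)
  L-linear : IsLinear L
  L-linear (s ∷ t ∷ u ∷ []) (s′ ∷ t′ ∷ u′ ∷ []) = trans
    (cong₂ _⊕_ (scale-xor s s′ a) (cong₂ _⊕_ (scale-xor t t′ b) (scale-xor u u′ c)))
    (solve 6 (λ p p′ q q′ r r′ → (p :+ p′) :+ ((q :+ q′) :+ (r :+ r′)) ⊜ (p :+ (q :+ r)) :+ (p′ :+ (q′ :+ r′))) refl
      (scale s a) (scale s′ a) (scale t b) (scale t′ b) (scale u c) (scale u′ c))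
  nonzero : ∀ {x} → f x ≡ true → x ≢ 0v n
  nonzero fx refl = true≢false fx (0∉E M)
  values : V 3 → V n
  values (false ∷ false ∷ false ∷ []) = 0v n
  values (true ∷ false ∷ false ∷ []) = a
  values (false ∷ true ∷ false ∷ []) = b
  values (false ∷ false ∷ true ∷ []) = c
  values (true ∷ true ∷ false ∷ []) = a ⊕ b
  values (true ∷ false ∷ true ∷ []) = a ⊕ c
  values (false ∷ true ∷ true ∷ []) = b ⊕ c
  values (true ∷ true ∷ true ∷ []) = a ⊕ (b ⊕ c)
  L≡values : ∀ x → L x ≡ values x
  L≡values (false ∷ false ∷ false ∷ []) = trans (⊕-identityˡ _) (⊕-identityˡ _)
  L≡values (true ∷ false ∷ false ∷ []) = trans (cong (a ⊕_) (⊕-identityˡ _)) (⊕-identityʳ a)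
  L≡values (false ∷ true ∷ false ∷ []) = trans (⊕-identityˡ _) (⊕-identityʳ b)
  L≡values (false ∷ false ∷ true ∷ []) = trans (⊕-identityˡ _) (⊕-identityˡ c)
  L≡values (true ∷ true ∷ false ∷ []) = cong (a ⊕_) (⊕-identityʳ b)
  L≡values (true ∷ false ∷ true ∷ []) = cong (a ⊕_) (⊕-identityˡ c)
  L≡values (false ∷ true ∷ true ∷ []) = ⊕-identityˡ _
  L≡values (true ∷ true ∷ true ∷ []) = refl
  values-kernel : ∀ x → values x ≡ 0v n → x ≡ 0v 3
  values-kernel (false ∷ false ∷ false ∷ []) _ = refl
  values-kernel (true ∷ false ∷ false ∷ []) e = ⊥-elim (nonzero fa e)
  values-kernel (false ∷ true ∷ false ∷ []) e = ⊥-elim (nonzero fb e)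
  values-kernel (false ∷ false ∷ true ∷ []) e = ⊥-elim (nonzero fc e)
  values-kernel (true ∷ true ∷ false ∷ []) e = ⊥-elim (≢⇒⊕≢0 a≢b e)
  values-kernel (true ∷ false ∷ true ∷ []) e = ⊥-elim (≢⇒⊕≢0 a≢c e)
  values-kernel (false ∷ true ∷ true ∷ []) e = ⊥-elim (≢⇒⊕≢0 b≢c e)
  values-kernel (true ∷ true ∷ true ∷ []) e = ⊥-elim (true≢false fc (trans (cong f c≡ab) fab))
    where
    c≡ab : c ≡ a ⊕ b
    c≡ab = trans (solve 3 (λ a b c → c ⊜ (a :+ (b :+ c)) :+ (a :+ b)) refl a b c)
      (trans (cong (_⊕ (a ⊕ b)) e) (⊕-identityˡ _))
  L-kernel : TrivialKernel L
  L-kernel x e = values-kernel x (trans (sym (L≡values x)) e)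
  e₁ e₂ e₃ : V 3
  e₁ = true ∷ false ∷ false ∷ []
  e₂ = false ∷ true ∷ false ∷ []
  e₃ = false ∷ false ∷ true ∷ []
  independent : Independent3 e₁ e₂ e₃
  independent true true true _ ()
  independent true true false _ ()
  independent true false true _ ()
  independent true false false _ ()
  independent false true true _ ()
  independent false true false _ ()
  independent false false true _ ()
  independent false false false () _
  sameE : f (a ⊕ (b ⊕ c)) ≡ false → ∀ x → E (claw e₁ e₂ e₃) x ≡ E (restrict M L) x
  sameE fabc (false ∷ false ∷ false ∷ []) = refl
  sameE fabc x@(true ∷ false ∷ false ∷ []) = sym (trans (cong f (L≡values x)) fa)
  sameE fabc x@(false ∷ true ∷ false ∷ []) = sym (trans (cong f (L≡values x)) fb)
  sameE fabc x@(false ∷ false ∷ true ∷ []) = sym (trans (cong f (L≡values x)) fc)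
  sameE fabc x@(true ∷ true ∷ false ∷ []) = sym (trans (cong f (L≡values x)) fab)
  sameE fabc x@(true ∷ false ∷ true ∷ []) = sym (trans (cong f (L≡values x)) fac)
  sameE fabc x@(false ∷ true ∷ true ∷ []) = sym (trans (cong f (L≡values x)) fbc)
  sameE fabc x@(true ∷ true ∷ true ∷ []) = sym (trans (cong f (L≡values x)) fabc)

ClawFreeFun-∘ : ∀ {m n} {f : V n → Bool} (L : V m → V n) → IsLinear L → IsInjective L → ClawFreeFun f → ClawFreeFun (f ∘ L)
ClawFreeFun-∘ {f = f} L lin inj cf {a} {b} {c} a≢b a≢c b≢c fa fb fc fab fac fbc =
  trans (cong f (trans (lin a (b ⊕ c)) (cong (L a ⊕_) (lin b c))))
    (cf (a≢b ∘ inj a b) (a≢c ∘ inj a c) (b≢c ∘ inj b c) fa fb fc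
      (trans (cong f (sym (lin a b))) fab) (trans (cong f (sym (lin a c))) fac) (trans (cong f (sym (lin b c))) fbc))

ones⇒injective : ∀ {M k} (G : V k → V (dim M)) → IsLinear G → (∀ {h} → h ≢ 0v k → E M (G h) ≡ true) → IsInjective G
ones⇒injective {M} G lin ones = trivial-kernel⇒injective lin λ h e → decidable-stable (h ≟ᵥ _) λ h≢0 →
  true≢false (ones h≢0) (trans (cong (E M) e) (0∉E M))

flat-≤ω : ∀ {M s k} → ω≤ M s → (G : V k → V (dim M)) → IsLinear G → (∀ {h} → h ≢ 0v k → E M (G h) ≡ true) → k ≤ s
flat-≤ω {M} ω G lin ones = ω _ G lin (ones⇒injective {M} G lin ones) λ x nzx → ones (nz-true nzx)

parity : List Bool → Bool
parity [] = false
parity (b ∷ bs) = b xor parity bs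

parity-countT : ∀ bs → (parity bs ≡ false → 2 ∣ countT bs) × (parity bs ≡ true → 2 ∣ suc (countT bs))
parity-countT [] = (λ _ → 2 ∣0) , λ ()
parity-countT (false ∷ bs) = parity-countT bs
parity-countT (true ∷ bs) = (λ e → proj₂ (parity-countT bs) (trans (sym (Boolₚ.not-involutive _)) (cong not e)))
  , λ e → ∣m∣n⇒∣m+n ∣-refl (proj₁ (parity-countT bs) (trans (sym (Boolₚ.not-involutive _)) (cong not e)))

-- At the images of a basis of the plane, `cubic` is the parity of the number of elements of E in
-- it.
quadratic⇒even-plane : ∀ {M} → (∀ x y z → cubic (E M) x y z ≡ false) → EvenPlane M
quadratic⇒even-plane {M} q L lin _ = proj₁ (parity-countT (List.map (λ x → nz x ∧ f (L x)) (allV 3)))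
  (trans (trans (cong₂ (λ p q → f z xor (f y xor (p xor (f x xor q)))) (cong f (lin v₂ v₃))
      (cong₂ (λ p q → p xor q) (cong f (lin v₁ v₃)) (cong₂ (λ p q → p xor q) (cong f (lin v₁ v₂))
        (cong (_xor false) (cong f (trans (lin v₁ (false ∷ true ∷ true ∷ [])) (cong (x ⊕_) (lin v₂ v₃))))))))
    (BSolver.solve 7 (λ xyz xy xz yz x y z →
      z ∔ (y ∔ (yz ∔ (x ∔ (xz ∔ (xy ∔ (xyz ∔ BSolver.:0)))))) BSolver.⊜ xyz ∔ (xy ∔ (xz ∔ (yz ∔ (x ∔ (y ∔ z)))))) refl
      (f (x ⊕ (y ⊕ z))) (f (x ⊕ y)) (f (x ⊕ z)) (f (y ⊕ z)) (f x) (f y) (f z))) (q x y z))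
  where
  open BSolver using () renaming (_:+_ to _∔_)
  f = E M
  v₁ v₂ v₃ : V 3
  v₁ = true ∷ false ∷ false ∷ []
  v₂ = false ∷ true ∷ false ∷ []
  v₃ = false ∷ false ∷ true ∷ []
  x = L v₁
  y = L v₂
  z = L v₃

-- Coordinates adapted to a subspace

record Splitting {n} (W : Subspace n) : Set where
  open Subspace W
  field
    a b      : ℕ
    a+b≡n    : a + b ≡ n
    p        : V n → V a
    q        : V n → V b
    i        : V a → V b → V n
    p-linear : IsLinear p
    q-linear : IsLinear q
    i-pq     : ∀ x → i (p x) (q x) ≡ x
    p-i      : ∀ u v → p (i u v) ≡ u
    q-i      : ∀ u v → q (i u v) ≡ v
    W⇒q      : ∀ {x} → Mem x → q x ≡ 0v b
    q⇒W      : ∀ {x} → q x ≡ 0v b → Mem x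

  i-linear : ∀ u v u′ v′ → i u v ⊕ i u′ v′ ≡ i (u ⊕ u′) (v ⊕ v′)
  i-linear u v u′ v′ = trans (sym (i-pq _)) (cong₂ i
    (trans (p-linear _ _) (cong₂ _⊕_ (p-i u v) (p-i u′ v′)))
    (trans (q-linear _ _) (cong₂ _⊕_ (q-i u v) (q-i u′ v′))))

tail-subspace : ∀ {n} → Subspace (suc n) → Subspace n
tail-subspace W = record { Mem = λ x → Mem (false ∷ x) ; Mem? = λ x → Mem? (false ∷ x) ; 0∈ = 0∈ ; ⊕∈ = ⊕∈ }
  where open Subspace W

-- Elimination on the first coordinate: a vector `true ∷ w` in `W` serves as pivot and the
-- coordinate goes to `p`; without one it goes to `q`.
split : ∀ {n} (W : Subspace n) → Splitting W
split {zero} W = record { a = 0 ; b = 0 ; a+b≡n = refl ; p = id ; q = id ; i = λ u _ → u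
  ; p-linear = λ _ _ → refl ; q-linear = λ _ _ → refl ; i-pq = λ _ → refl ; p-i = λ _ _ → refl
  ; q-i = λ { [] [] → refl } ; W⇒q = λ { {[]} _ → refl } ; q⇒W = λ { {[]} _ → Subspace.0∈ W } }
split {suc n} W = build (∃? (λ x → Mem? (true ∷ x)))
  where
  open Subspace W
  open Splitting (split (tail-subspace W))
  build : Dec (∃ λ x → Mem (true ∷ x)) → Splitting W
  build (no none) = record { a = a ; b = suc b ; a+b≡n = trans (+-suc a b) (cong suc a+b≡n)
    ; p = λ { (t ∷ x) → p x } ; q = λ { (t ∷ x) → t ∷ q x } ; i = λ { u (t ∷ v) → t ∷ i u v }
    ; p-linear = λ { (s ∷ x) (t ∷ y) → p-linear x y }
    ; q-linear = λ { (s ∷ x) (t ∷ y) → cong ((s xor t) ∷_) (q-linear x y) }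
    ; i-pq = λ { (t ∷ x) → cong (t ∷_) (i-pq x) }
    ; p-i = λ { u (t ∷ v) → p-i u v } ; q-i = λ { u (t ∷ v) → cong (t ∷_) (q-i u v) }
    ; W⇒q = λ { {false ∷ x} m → cong (false ∷_) (W⇒q m) ; {true ∷ x} m → ⊥-elim (none (x , m)) }
    ; q⇒W = λ { {false ∷ x} e → q⇒W (Vecₚ.∷-injectiveʳ e) } }
  build (yes (w , w∈)) = record { a = suc a ; b = b ; a+b≡n = cong suc a+b≡n
    ; p = λ { (t ∷ x) → t ∷ p (r t x) } ; q = λ { (t ∷ x) → q (r t x) } ; i = λ { (t ∷ u) v → t ∷ r t (i u v) }
    ; p-linear = λ { (s ∷ x) (t ∷ y) → cong ((s xor t) ∷_) (trans (cong p (r-linear s t x y)) (p-linear _ _)) }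
    ; q-linear = λ { (s ∷ x) (t ∷ y) → trans (cong q (r-linear s t x y)) (q-linear _ _) }
    ; i-pq = λ { (t ∷ x) → cong (t ∷_) (trans (cong (r t) (i-pq _)) (⊕-cancel x (scale t w))) }
    ; p-i = λ { (t ∷ u) v → cong (t ∷_) (trans (cong p (⊕-cancel _ (scale t w))) (p-i u v)) }
    ; q-i = λ { (t ∷ u) v → trans (cong q (⊕-cancel _ (scale t w))) (q-i u v) }
    ; W⇒q = λ { {t ∷ x} m → W⇒q (reduce t m) }
    ; q⇒W = λ { {t ∷ x} e → unreduce t (q⇒W e) } }
    where
    r : Bool → V n → V n
    r t x = x ⊕ scale t w
    r-linear : ∀ s t x y → r (s xor t) (x ⊕ y) ≡ r s x ⊕ r t y
    r-linear s t x y = trans (cong ((x ⊕ y) ⊕_) (scale-xor s t w))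
      (solve 4 (λ a b c d → (a :+ b) :+ (c :+ d) ⊜ (a :+ c) :+ (b :+ d)) refl x y (scale s w) (scale t w))
    reduce : ∀ t {x} → Mem (t ∷ x) → Mem (false ∷ r t x)
    reduce true m = ⊕∈ m w∈
    reduce false {x} m = subst (λ z → Mem (false ∷ z)) (sym (⊕-identityʳ x)) m
    unreduce : ∀ t {x} → Mem (false ∷ r t x) → Mem (t ∷ x)
    unreduce true {x} m = subst (λ z → Mem (true ∷ z)) (⊕-cancel x w) (⊕∈ m w∈)
    unreduce false {x} m = subst (λ z → Mem (false ∷ z)) (⊕-identityʳ x) m

-- Isomorphisms and the lift-join

take-++ : ∀ {m n} (u : V m) (v : V n) → take m (u ++ v) ≡ u
take-++ [] v = refl
take-++ (b ∷ u) v = cong (b ∷_) (take-++ u v)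

drop-++ : ∀ {m n} (u : V m) (v : V n) → drop m (u ++ v) ≡ v
drop-++ [] v = refl
drop-++ (b ∷ u) v = drop-++ u v

take-⊕ : ∀ m {n} (x y : V (m + n)) → take m (x ⊕ y) ≡ take m x ⊕ take m y
take-⊕ m x y = Vecₚ.take-zipWith _xor_ x y

drop-⊕ : ∀ m {n} (x y : V (m + n)) → drop m (x ⊕ y) ≡ drop m x ⊕ drop m y
drop-⊕ m x y = Vecₚ.drop-zipWith _xor_ x y

take-drop-0 : ∀ m n → take m (0v (m + n)) ≡ 0v m × drop m (0v (m + n)) ≡ 0v n
take-drop-0 m n = trans (cong (take m) (sym (0++0 m n))) (take-++ (0v m) (0v n))
                , trans (cong (drop m) (sym (0++0 m n))) (drop-++ (0v m) (0v n))

Iso-refl : ∀ {M} → Iso M M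
Iso-refl = id , id , (λ _ _ → refl) , (λ _ → refl) , (λ _ → refl) , λ _ → refl

Iso-sym : ∀ {M N} → Iso M N → Iso N M
Iso-sym {M} {N} (f , g , lin , gf , fg , e) = g , f ,
  (λ x y → trans (cong g (trans (cong₂ _⊕_ (sym (fg x)) (sym (fg y))) (sym (lin (g x) (g y))))) (gf _)) ,
  fg , gf , λ x → trans (sym (e (g x))) (cong (E N) (fg x))

Iso-trans : ∀ {M N P} → Iso M N → Iso N P → Iso M P
Iso-trans (f , g , lin , gf , fg , e) (f′ , g′ , lin′ , gf′ , fg′ , e′) =
  f′ ∘ f , g ∘ g′ , (λ x y → trans (cong f′ (lin x y)) (lin′ _ _)) ,
  (λ x → trans (cong g (gf′ (f x))) (gf x)) , (λ y → trans (cong f′ (fg (g′ y))) (fg′ y)) ,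
  λ x → trans (e′ (f x)) (e x)

-- The first component matters only where the second vanishes; in this form associativity is a case
-- split on two booleans.
join-E : ∀ A B → V (dim A) → V (dim B) → Bool
join-E A B u v = if nz v then E B v else E A u

⊗-E : ∀ A B w → E (A ⊗ B) w ≡ join-E A B (take (dim A) w) (drop (dim A) w)
⊗-E A B w with nz w in nzw
... | true = general (take (dim A) w) (drop (dim A) w)
  where
  general : ∀ u v → (not (nz v) ∧ E A u) ∨ E B v ≡ join-E A B u v
  general u v with nz v in nzv
  ... | true = refl
  ... | false = trans (cong (E A u ∨_) (trans (cong (E B) (nz-false v nzv)) (0∉E B))) (Boolₚ.∨-identityʳ (E A u))
... | false = sym (trans (cong₂ (join-E A B) u≡0 v≡0) zeros)
  where
  w≡0 = nz-false w nzw
  u≡0 = trans (cong (take (dim A)) w≡0) (proj₁ (take-drop-0 (dim A) (dim B)))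
  v≡0 = trans (cong (drop (dim A)) w≡0) (proj₂ (take-drop-0 (dim A) (dim B)))
  zeros : join-E A B (0v (dim A)) (0v (dim B)) ≡ false
  zeros rewrite nz-0 (dim B) = 0∉E A

Iso-⊗ : ∀ {M} A B (p : V (dim M) → V (dim A)) (q : V (dim M) → V (dim B)) (i : V (dim A) → V (dim B) → V (dim M)) →
  IsLinear p → IsLinear q → (∀ x → i (p x) (q x) ≡ x) → (∀ u v → p (i u v) ≡ u) → (∀ u v → q (i u v) ≡ v) →
  (∀ x → join-E A B (p x) (q x) ≡ E M x) → Iso M (A ⊗ B)
Iso-⊗ A B p q i p-lin q-lin i-pq p-i q-i e =
  (λ x → p x ++ q x) , (λ w → i (take a w) (drop a w)) ,
  (λ x y → trans (cong₂ _++_ (p-lin x y) (q-lin x y)) (sym (++-⊕ (p x) (p y) (q x) (q y)))) ,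
  (λ x → trans (cong₂ i (take-++ (p x) (q x)) (drop-++ (p x) (q x))) (i-pq x)) ,
  (λ w → trans (cong₂ _++_ (p-i (take a w) (drop a w)) (q-i (take a w) (drop a w))) (Vecₚ.take++drop≡id a w)) ,
  λ x → trans (⊗-E A B (p x ++ q x)) (trans (cong₂ (join-E A B) (take-++ (p x) (q x)) (drop-++ (p x) (q x))) (e x))
  where a = dim A

nz-Iso : ∀ {M N} ((f , _) : Iso M N) → ∀ x → nz (f x) ≡ nz x
nz-Iso {M} {N} (f , g , lin , gf , _) x with nz x in nzx
... | true = ≢0⇒nz λ e → nz-true nzx (trans (sym (gf x)) (trans (cong g (trans e (sym (linear-0 f lin)))) (gf _)))
... | false = trans (cong nz (trans (cong f (nz-false x nzx)) (linear-0 f lin))) (nz-0 (dim N))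

⊗-cong : ∀ {A A′ B B′} → Iso A A′ → Iso B B′ → Iso (A ⊗ B) (A′ ⊗ B′)
⊗-cong {A} {A′} {B} {B′} (f , f⁻¹ , f-lin , f⁻¹f , ff⁻¹ , f-E) I@(g , g⁻¹ , g-lin , g⁻¹g , gg⁻¹ , g-E) =
  Iso-⊗ {A ⊗ B} A′ B′ (f ∘ take a) (g ∘ drop a) (λ u v → f⁻¹ u ++ g⁻¹ v)
    (λ x y → trans (cong f (take-⊕ a x y)) (f-lin _ _))
    (λ x y → trans (cong g (drop-⊕ a x y)) (g-lin _ _))
    (λ w → trans (cong₂ _++_ (f⁻¹f _) (g⁻¹g _)) (Vecₚ.take++drop≡id a w))
    (λ u v → trans (cong f (take-++ (f⁻¹ u) (g⁻¹ v))) (ff⁻¹ u))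
    (λ u v → trans (cong g (drop-++ (f⁻¹ u) (g⁻¹ v))) (gg⁻¹ v))
    λ w → trans (same (take a w) (drop a w)) (sym (⊗-E A B w))
  where
  a = dim A
  same : ∀ u v → join-E A′ B′ (f u) (g v) ≡ join-E A B u v
  same u v rewrite nz-Iso {B} {B′} I v | f-E u | g-E v = refl

nz-++ : ∀ {m n} (u : V m) (v : V n) → nz (u ++ v) ≡ nz u ∨ nz v
nz-++ [] v = refl
nz-++ (b ∷ u) v = trans (cong (b ∨_) (nz-++ u v)) (sym (Boolₚ.∨-assoc b (nz u) (nz v)))

⊗-assoc : ∀ A B C → Iso ((A ⊗ B) ⊗ C) (A ⊗ (B ⊗ C))
⊗-assoc A B C = Iso-⊗ {(A ⊗ B) ⊗ C} A (B ⊗ C)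
  (λ w → take a (take (a + b) w)) (λ w → drop a (take (a + b) w) ++ drop (a + b) w)
  (λ u v → (u ++ take b v) ++ drop b v)
  (λ x y → trans (cong (take a) (take-⊕ (a + b) x y)) (take-⊕ a _ _))
  (λ x y → trans (cong₂ _++_ (trans (cong (drop a) (take-⊕ (a + b) x y)) (drop-⊕ a _ _)) (drop-⊕ (a + b) x y))
    (sym (++-⊕ (drop a (take (a + b) x)) (drop a (take (a + b) y)) (drop (a + b) x) (drop (a + b) y))))
  (λ w → trans (cong₂ _++_ (trans (cong (take a (take (a + b) w) ++_) (take-++ (drop a (take (a + b) w)) (drop (a + b) w))) (Vecₚ.take++drop≡id a (take (a + b) w)))
                 (drop-++ (drop a (take (a + b) w)) (drop (a + b) w))) (Vecₚ.take++drop≡id (a + b) w))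
  (λ u v → trans (cong (take a) (take-++ (u ++ take b v) (drop b v))) (take-++ u (take b v)))
  (λ u v → trans (cong₂ _++_ (trans (cong (drop a) (take-++ (u ++ take b v) (drop b v))) (drop-++ u (take b v)))
             (drop-++ (u ++ take b v) (drop b v))) (Vecₚ.take++drop≡id b v))
  λ w → trans (same (take (a + b) w) (drop (a + b) w)) (sym (⊗-E (A ⊗ B) C w))
  where
  a = dim A
  b = dim B
  same : ∀ t z → join-E A (B ⊗ C) (take a t) (drop a t ++ z) ≡ join-E (A ⊗ B) C t z
  same t z = trans (cong₂ (λ c e → if c then e else E A (take a t)) (nz-++ (drop a t) z)
      (trans (⊗-E B C (drop a t ++ z)) (cong₂ (join-E B C) (take-++ (drop a t) z) (drop-++ (drop a t) z))))
    (trans (cases (nz (drop a t)) (nz z)) (cong (λ e → if nz z then E C z else e) (sym (⊗-E A B t))))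
    where
    cases : ∀ {x y z : Bool} c d → (if c ∨ d then (if d then z else y) else x) ≡ (if d then z else (if c then y else x))
    cases true true = refl
    cases true false = refl
    cases false true = refl
    cases false false = refl

Loops : ℕ → Matroid
Loops e = mkMatroid e (λ _ → false) refl

⊗-identityˡ : ∀ M → Iso M (Loops 0 ⊗ M)
⊗-identityˡ M = Iso-⊗ {M} (Loops 0) M (λ _ → []) id (λ _ v → v)
  (λ _ _ → refl) (λ _ _ → refl) (λ _ → refl) (λ { [] _ → refl }) (λ _ _ → refl) same
  where
  same : ∀ x → join-E (Loops 0) M [] x ≡ E M x
  same x with nz x in nzx
  ... | true = refl
  ... | false = sym (trans (cong (E M) (nz-false x nzx)) (0∉E M))

⊗-identityʳ : ∀ M → Iso M (M ⊗ Loops 0)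
⊗-identityʳ M = Iso-⊗ {M} M (Loops 0) id (λ _ → []) (λ u _ → u)
  (λ _ _ → refl) (λ _ _ → refl) (λ _ → refl) (λ _ _ → refl) (λ { _ [] → refl }) (λ _ → refl)

Loops-⊗ : ∀ a b → Iso (Loops (a + b)) (Loops a ⊗ Loops b)
Loops-⊗ a b = Iso-⊗ {Loops (a + b)} (Loops a) (Loops b) (take a) (drop a) _++_
  (take-⊕ a) (drop-⊕ a) (Vecₚ.take++drop≡id a) take-++ drop-++ same
  where
  same : ∀ x → join-E (Loops a) (Loops b) (take a x) (drop a x) ≡ false
  same x with nz (drop a x)
  ... | true = refl
  ... | false = refl

-- Chains of lift-joins

Vec-flat : ℕ → Matroid → Set
Vec-flat j M = Σ (V j → V (dim M)) λ G → IsLinear G × (∀ {h} → h ≢ 0v j → E M (G h) ≡ true)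

-- The lift-join of Loops e, N₁, Loops e₁, N₂, Loops e₂, …, bracketed to the right.
joinChain : ∀ {j} → ℕ → Vec (Matroid × ℕ) j → Matroid
joinChain e [] = Loops e
joinChain e ((N , e′) ∷ ps) = Loops e ⊗ (N ⊗ joinChain e′ ps)

appendHead : ∀ {j} → ℕ → Vec (Matroid × ℕ) j → ℕ → ℕ
appendHead e [] e′ = e + e′
appendHead e (_ ∷ _) e′ = e

-- The last loops of the first chain absorb the first loops of the second.
append : ∀ {j k} → Vec (Matroid × ℕ) j → ℕ → Vec (Matroid × ℕ) k → Vec (Matroid × ℕ) (j + k)
append [] e′ qs = qs
append ((N , e) ∷ ps) e′ qs = (N , appendHead e ps e′) ∷ append ps e′ qs

joinChain-append : ∀ {j k} e (ps : Vec (Matroid × ℕ) j) e′ (qs : Vec (Matroid × ℕ) k) →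
  Iso (joinChain e ps ⊗ joinChain e′ qs) (joinChain (appendHead e ps e′) (append ps e′ qs))
joinChain-append e [] e′ [] = Iso-sym {Loops (e + e′)} {Loops e ⊗ Loops e′} (Loops-⊗ e e′)
joinChain-append e [] e′ ((N , e″) ∷ qs) = Iso-trans {Loops e ⊗ (Loops e′ ⊗ Y)} {(Loops e ⊗ Loops e′) ⊗ Y} {Loops (e + e′) ⊗ Y}
  (Iso-sym {(Loops e ⊗ Loops e′) ⊗ Y} {Loops e ⊗ (Loops e′ ⊗ Y)} (⊗-assoc (Loops e) (Loops e′) Y))
  (⊗-cong {Loops e ⊗ Loops e′} {Loops (e + e′)} {Y} {Y} (Iso-sym {Loops (e + e′)} {Loops e ⊗ Loops e′} (Loops-⊗ e e′)) (Iso-refl {Y}))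
  where Y = N ⊗ joinChain e″ qs
joinChain-append e ((N , e₁) ∷ ps) e′ qs =
  Iso-trans {(L ⊗ (N ⊗ X)) ⊗ Y} {L ⊗ ((N ⊗ X) ⊗ Y)} {L ⊗ (N ⊗ Z)} (⊗-assoc L (N ⊗ X) Y)
    (⊗-cong {L} {L} {(N ⊗ X) ⊗ Y} {N ⊗ Z} (Iso-refl {L})
      (Iso-trans {(N ⊗ X) ⊗ Y} {N ⊗ (X ⊗ Y)} {N ⊗ Z} (⊗-assoc N X Y)
        (⊗-cong {N} {N} {X ⊗ Y} {Z} (Iso-refl {N}) (joinChain-append e₁ ps e′ qs))))
  where
  L = Loops e
  X = joinChain e₁ ps
  Y = joinChain e′ qs
  Z = joinChain (appendHead e₁ ps e′) (append ps e′ qs)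

Good : ℕ → Matroid → Set
Good k N = EvenPlane N ⊎ dim N ≤ k

append-Good : ∀ {j k m} {ps : Vec (Matroid × ℕ) j} {e′} {qs : Vec (Matroid × ℕ) k} →
  All (Good m ∘ proj₁) ps → All (Good m ∘ proj₁) qs → All (Good m ∘ proj₁) (append ps e′ qs)
append-Good [] gs = gs
append-Good (g ∷ gs) hs = g ∷ append-Good gs hs

-- A decomposition with j non-loop terms comes with a j-dimensional flat inside E, so that ω bounds j.
record Chain (k : ℕ) (M : Matroid) : Set where
  field
    j    : ℕ
    head : ℕ
    ps   : Vec (Matroid × ℕ) j
    iso  : Iso M (joinChain head ps)
    good : All (Good k ∘ proj₁) ps
    flat : Vec-flat j M

-- A matroid with empty E becomes loops and uses up no dimension of the flat; otherwise one element
-- of E spans the flat.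
chain-single : ∀ {k M} → Good k M → Chain k M
chain-single {k} {M} g with ∃? (λ x → E M x Boolₚ.≟ true)
... | no none = record { j = 0 ; head = dim M ; ps = []
      ; iso = id , id , (λ _ _ → refl) , (λ _ → refl) , (λ _ → refl) , λ x → sym (¬true⇒false λ e → none (x , e))
      ; good = [] ; flat = (λ _ → 0v _) , (λ _ _ → sym (⊕-self _)) , λ { {[]} h≢0 → ⊥-elim (h≢0 refl) } }
... | yes (x , Ex) = record { j = 1 ; head = 0 ; ps = (M , 0) ∷ []
      ; iso = Iso-trans {M} {M ⊗ Loops 0} {Loops 0 ⊗ (M ⊗ Loops 0)} (⊗-identityʳ M) (⊗-identityˡ (M ⊗ Loops 0))
      ; good = g ∷ []
      ; flat = extendBy (λ _ → 0v _) x , extendBy-linear {0} _ x (λ _ _ → sym (⊕-self _)) ,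
          λ { {false ∷ []} h≢0 → ⊥-elim (h≢0 refl)
            ; {true ∷ []} _ → trans (cong (E M) (⊕-identityˡ x)) Ex } }

-- The direct sum of the two flats stays inside E of the lift-join, so the numbers of non-loop terms
-- add up like dimensions.
chain-⊗ : ∀ {k M} A B → Iso M (A ⊗ B) → Chain k A → Chain k B → Chain k M
chain-⊗ {k} {M} A B (φ , φ⁻¹ , φ-lin , φ⁻¹φ , φφ⁻¹ , φ-E) CA CB = record
  { j = CA.j + CB.j ; head = appendHead CA.head CA.ps CB.head ; ps = append CA.ps CB.head CB.ps
  ; iso = Iso-trans {M} {A ⊗ B} {joinChain _ (append CA.ps CB.head CB.ps)} (φ , φ⁻¹ , φ-lin , φ⁻¹φ , φφ⁻¹ , φ-E)
      (Iso-trans {A ⊗ B} {joinChain CA.head CA.ps ⊗ joinChain CB.head CB.ps} {joinChain _ (append CA.ps CB.head CB.ps)}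
        (⊗-cong {A} {joinChain CA.head CA.ps} {B} {joinChain CB.head CB.ps} CA.iso CB.iso)
        (joinChain-append CA.head CA.ps CB.head CB.ps))
  ; good = append-Good CA.good CB.good
  ; flat = φ⁻¹ ∘ G , G-linear , λ {h} h≢0 → trans (trans (sym (φ-E (φ⁻¹ (G h)))) (cong (E (A ⊗ B)) (φφ⁻¹ (G h)))) (ones h≢0) }
  where
  module CA = Chain CA
  module CB = Chain CB
  GA = proj₁ CA.flat
  GB = proj₁ CB.flat
  G : V (CA.j + CB.j) → V (dim A + dim B)
  G h = GA (take CA.j h) ++ GB (drop CA.j h)
  φ⁻¹-linear : IsLinear φ⁻¹
  φ⁻¹-linear = proj₁ (proj₂ (proj₂ (Iso-sym {M} {A ⊗ B} (φ , φ⁻¹ , φ-lin , φ⁻¹φ , φφ⁻¹ , φ-E))))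
  G-linear : IsLinear (φ⁻¹ ∘ G)
  G-linear x y = trans (cong φ⁻¹ (trans
    (cong₂ _++_ (trans (cong GA (take-⊕ CA.j x y)) (proj₁ (proj₂ CA.flat) _ _)) (trans (cong GB (drop-⊕ CA.j x y)) (proj₁ (proj₂ CB.flat) _ _)))
    (sym (++-⊕ (GA (take CA.j x)) (GA (take CA.j y)) (GB (drop CA.j x)) (GB (drop CA.j y)))))) (φ⁻¹-linear (G x) (G y))
  ones : ∀ {h} → h ≢ 0v (CA.j + CB.j) → E (A ⊗ B) (G h) ≡ true
  ones {h} h≢0 = trans (⊗-E A B (G h)) (trans (cong₂ (join-E A B) (take-++ (GA (take CA.j h)) _) (drop-++ (GA (take CA.j h)) _)) value)
    where
    value : join-E A B (GA (take CA.j h)) (GB (drop CA.j h)) ≡ true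
    value with drop CA.j h ≟ᵥ 0v CB.j
    ... | no d≢0 = trans (cong (λ c → if c then E B (GB (drop CA.j h)) else E A (GA (take CA.j h))) (≢0⇒nz λ e →
            true≢false (proj₂ (proj₂ CB.flat) d≢0) (trans (cong (E B) e) (0∉E B)))) (proj₂ (proj₂ CB.flat) d≢0)
    ... | yes d≡0 = trans (cong (λ c → if c then E B (GB (drop CA.j h)) else E A (GA (take CA.j h)))
            (trans (cong nz (trans (cong GB d≡0) (linear-0 GB (proj₁ (proj₂ CB.flat))))) (nz-0 (dim B))))
            (proj₂ (proj₂ CA.flat) λ t≡0 → h≢0 (trans (sym (Vecₚ.take++drop≡id CA.j h)) (trans (cong₂ _++_ t≡0 d≡0) (0++0 CA.j CB.j))))

positive : ∀ {m} (x : V m) → x ≢ 0v m → 0 < m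
positive [] x≢0 = ⊥-elim (x≢0 refl)
positive (_ ∷ _) _ = s≤s z≤n

-- `m` bounds the recursion, since both parts of a split are smaller. They are restrictions of `f`
-- and inherit claw-freeness and the exclusion of flats with the same `s`, so one constant serves at
-- every level.
chain : ∀ s m {n} → n ≤ m → (f : V n → Bool) (f0 : f (0v n) ≡ false) → ClawFreeFun f → NoFlat f (suc s) →
  Chain (2 + ramsey-bound (suc s) (suc s)) (mkMatroid n f f0)
chain s zero z≤n f f0 cf none = chain-single (inj₂ z≤n)
chain s (suc m) {n} n≤m f f0 cf none with n ≤? 2 + ramsey-bound (suc s) (suc s)
... | yes n≤k = chain-single (inj₂ n≤k)
... | no n≰k = from (decompose-or-quadratic s f f0 cf none (≤-trans (m≤n+m _ 3) (≰⇒> n≰k)))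
  where
  k = 2 + ramsey-bound (suc s) (suc s)
  from : Decomposer f ⊎ (∀ x y z → cubic f x y z ≡ false) → Chain k (mkMatroid n f f0)
  from (inj₂ q) = chain-single (inj₁ (quadratic⇒even-plane {mkMatroid n f f0} q))
  from (inj₁ D) = chain-⊗ A B iso
      (chain s m (≤-pred (≤-trans (subst (a <_) a+b≡n (m<m+n a 0<b)) n≤m)) (f ∘ i₁) (0∉E A)
        (ClawFreeFun-∘ {f = f} i₁ i₁-linear i₁-injective cf) (NoFlat-∘ {f = f} i₁ i₁-linear none))
      (chain s m (≤-pred (≤-trans (subst (b <_) a+b≡n (m<n+m b 0<a)) n≤m)) (f ∘ i₂) (0∉E B)
        (ClawFreeFun-∘ {f = f} i₂ i₂-linear i₂-injective cf) (NoFlat-∘ {f = f} i₂ i₂-linear none))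
    where
    open Decomposer D
    open Splitting (split W)
    i₁ : V a → V n
    i₁ u = i u (0v b)
    i₂ : V b → V n
    i₂ v = i (0v a) v
    i₁-linear : IsLinear i₁
    i₁-linear x y = trans (cong (i (x ⊕ y)) (sym (⊕-self (0v b)))) (sym (i-linear x _ y _))
    i₂-linear : IsLinear i₂
    i₂-linear x y = trans (cong (λ t → i t (x ⊕ y)) (sym (⊕-self (0v a)))) (sym (i-linear _ x _ y))
    i₁-injective : IsInjective i₁
    i₁-injective x y e = trans (sym (p-i x (0v b))) (trans (cong p e) (p-i y (0v b)))
    i₂-injective : IsInjective i₂
    i₂-injective x y e = trans (sym (q-i (0v a) x)) (trans (cong q e) (q-i (0v a) y))
    A B : Matroid
    A = mkMatroid a (f ∘ i₁) (trans (cong f (linear-0 i₁ i₁-linear)) f0)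
    B = mkMatroid b (f ∘ i₂) (trans (cong f (linear-0 i₂ i₂-linear)) f0)
    f≡ : ∀ x → join-E A B (p x) (q x) ≡ f x
    f≡ x with nz (q x) in nzq
    ... | false = cong f (trans (cong (i (p x)) (sym (nz-false (q x) nzq))) (i-pq x))
    -- `x` is `i₂ (q x)`, outside `W`, plus `i₁ (p x)`, inside `W`; invariance removes the second
    -- summand.
    ... | true = trans (sym (invariant {w = i₁ (p x)} (λ m → nz-true nzq (trans (sym (q-i (0v a) (q x))) (W⇒q m))) (q⇒W (q-i (p x) (0v b)))))
            (cong f (trans (i-linear (0v a) (q x) (p x) (0v b)) (trans (cong₂ i (⊕-identityˡ (p x)) (⊕-identityʳ (q x))) (i-pq x))))
    iso : Iso (mkMatroid n f f0) (A ⊗ B)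
    iso = Iso-⊗ {mkMatroid n f f0} A B p q i p-linear q-linear i-pq p-i q-i f≡
    0<b : 0 < b
    0<b = positive (q outside) λ e → outside∉ (q⇒W e)
    0<a : 0 < a
    0<a = positive (p inside) λ e → inside≢0 (trans (sym (i-pq inside)) (trans (cong₂ i e (W⇒q inside∈)) (linear-0 i₁ i₁-linear)))

-- Exactly 2s + 1 terms

double : ℕ → ℕ
double zero = 0
double (suc j) = suc (suc (double j))

double≡2* : ∀ j → double j ≡ 2 * j
double≡2* zero = refl
double≡2* (suc j) = cong suc (trans (cong suc (double≡2* j)) (sym (+-suc j (j + 0))))

terms : ∀ {j} → Vec (Matroid × ℕ) j → Vec Matroid (double j)
terms [] = []
terms ((N , e) ∷ ps) = N ∷ Loops e ∷ terms ps

joinAll : {j : ℕ} → Matroid → Vec Matroid j → Matroid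
joinAll acc [] = acc
joinAll acc (N ∷ Ns) = joinAll (acc ⊗ N) Ns

-- iterGo is the local function inside iterJoin, which has no name outside its definition; the
-- refl below, in which all its arguments have become distinct variables, determines it.
mutual
  iterGo : (p : ℕ) (M : Matroid) (P : Vec Matroid p) (j : ℕ) → Matroid → Vec Matroid j → Matroid
  iterGo = _

  iterJoin-unfold : ∀ {m} (M N : Matroid) (Ns : Vec Matroid m) →
    iterJoin (M ∷ N ∷ Ns) ≡ iterGo (suc m) M (N ∷ Ns) m (M ⊗ N) Ns
  iterJoin-unfold {m} M N Ns with suc m | Vec._∷_ N Ns | M ⊗ N
  ... | p | P | acc = refl

iterGo≡joinAll : ∀ p M P j acc Ns → iterGo p M P j acc Ns ≡ joinAll acc Ns
iterGo≡joinAll p M P zero acc [] = refl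
iterGo≡joinAll p M P (suc j) acc (N ∷ Ns) = iterGo≡joinAll p M P j (acc ⊗ N) Ns

joinAll-terms : ∀ {j} acc e (ps : Vec (Matroid × ℕ) j) → Iso (acc ⊗ joinChain e ps) (joinAll (acc ⊗ Loops e) (terms ps))
joinAll-terms acc e [] = Iso-refl {acc ⊗ Loops e}
joinAll-terms acc e ((N , e′) ∷ ps) =
  Iso-trans {acc ⊗ (L ⊗ (N ⊗ X))} {(acc ⊗ L) ⊗ (N ⊗ X)} {T} (Iso-sym {(acc ⊗ L) ⊗ (N ⊗ X)} {acc ⊗ (L ⊗ (N ⊗ X))} (⊗-assoc acc L (N ⊗ X)))
    (Iso-trans {(acc ⊗ L) ⊗ (N ⊗ X)} {((acc ⊗ L) ⊗ N) ⊗ X} {T} (Iso-sym {((acc ⊗ L) ⊗ N) ⊗ X} {(acc ⊗ L) ⊗ (N ⊗ X)} (⊗-assoc (acc ⊗ L) N X))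
      (joinAll-terms ((acc ⊗ L) ⊗ N) e′ ps))
  where
  L = Loops e
  X = joinChain e′ ps
  T = joinAll (((acc ⊗ L) ⊗ N) ⊗ Loops e′) (terms ps)

iterJoin-terms : ∀ {j} e (ps : Vec (Matroid × ℕ) j) → Iso (joinChain e ps) (iterJoin (Loops e ∷ terms ps))
iterJoin-terms e ps = subst (Iso (joinChain e ps)) (sym (iterGo≡joinAll _ (Loops e) (terms ps) _ (Loops e) (terms ps))) (iso ps)
  where
  iso : ∀ {j} (ps : Vec (Matroid × ℕ) j) → Iso (joinChain e ps) (joinAll (Loops e) (terms ps))
  iso [] = Iso-refl {Loops e}
  iso ((N , e′) ∷ ps) = Iso-trans {Loops e ⊗ (N ⊗ X)} {(Loops e ⊗ N) ⊗ X} {joinAll ((Loops e ⊗ N) ⊗ Loops e′) (terms ps)}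
    (Iso-sym {(Loops e ⊗ N) ⊗ X} {Loops e ⊗ (N ⊗ X)} (⊗-assoc (Loops e) N X)) (joinAll-terms (Loops e ⊗ N) e′ ps)
    where X = joinChain e′ ps

Loops-Good : ∀ {k} e → Good k (Loops e)
Loops-Good e = inj₁ λ L _ _ → 2 ∣0

terms-Good : ∀ {k j} {ps : Vec (Matroid × ℕ) j} → All (Good k ∘ proj₁) ps → All (Good k) (terms ps)
terms-Good [] = []
terms-Good {ps = (N , e) ∷ ps} (g ∷ gs) = g ∷ Loops-Good e ∷ terms-Good gs

-- Zero-dimensional loops are units of the lift-join and bring the number of pairs up to the
-- prescribed one.
pad : ∀ d {j} → ℕ → Vec (Matroid × ℕ) j → ℕ × Vec (Matroid × ℕ) (d + j)
pad zero e ps = e , ps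
pad (suc d) e ps = 0 , (Loops 0 , proj₁ (pad d e ps)) ∷ proj₂ (pad d e ps)

pad-iso : ∀ d {j} e (ps : Vec (Matroid × ℕ) j) → Iso (joinChain e ps) (joinChain (proj₁ (pad d e ps)) (proj₂ (pad d e ps)))
pad-iso zero e ps = Iso-refl {joinChain e ps}
pad-iso (suc d) e ps = Iso-trans {joinChain e ps} {X} {Loops 0 ⊗ (Loops 0 ⊗ X)} (pad-iso d e ps)
  (Iso-trans {X} {Loops 0 ⊗ X} {Loops 0 ⊗ (Loops 0 ⊗ X)} (⊗-identityˡ X) (⊗-identityˡ (Loops 0 ⊗ X)))
  where X = joinChain (proj₁ (pad d e ps)) (proj₂ (pad d e ps))

pad-Good : ∀ {k} d {j} e {ps : Vec (Matroid × ℕ) j} → All (Good k ∘ proj₁) ps → All (Good k ∘ proj₁) (proj₂ (pad d e ps))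
pad-Good zero e gs = gs
pad-Good (suc d) e gs = inj₂ z≤n ∷ pad-Good d e gs

theorem1p4 : (s : ℕ) → 1 ≤ s →
    Σ ℕ λ k → 2 ≤ k ×
    ((M : Matroid) → ClawFree M → ω≤ M s →
    Σ (Vec Matroid (suc (2 * s))) λ Ms →
    Iso M (iterJoin Ms) × All (λ Mi → EvenPlane Mi ⊎ dim Mi ≤ k) Ms)
theorem1p4 s _ = k , m≤m+n 2 _ , decompose
  where
  -- The summand 2 secures `2 ≤ k`.
  k = 2 + ramsey-bound (suc s) (suc s)
  decompose : (M : Matroid) → ClawFree M → ω≤ M s →
    Σ (Vec Matroid (suc (2 * s))) λ Ms → Iso M (iterJoin Ms) × All (Good k) Ms
  decompose M cf ω = subst (λ m → Σ (Vec Matroid (suc m)) λ Ms → Iso M (iterJoin Ms) × All (Good k) Ms) length≡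
      ( Loops (proj₁ padded) ∷ terms (proj₂ padded)
      , Iso-trans {M} {joinChain head ps} {iterJoin (Loops (proj₁ padded) ∷ terms (proj₂ padded))} iso
          (Iso-trans {joinChain head ps} {joinChain (proj₁ padded) (proj₂ padded)} {iterJoin (Loops (proj₁ padded) ∷ terms (proj₂ padded))}
            (pad-iso d head ps) (iterJoin-terms (proj₁ padded) (proj₂ padded)))
      , Loops-Good (proj₁ padded) ∷ terms-Good (pad-Good d head good))
    where
    no-flat : NoFlat (E M) (suc s)
    no-flat G G-lin ones = 1+n≰n (flat-≤ω {M} ω G G-lin ones)
    open Chain (chain s (dim M) ≤-refl (E M) (0∉E M) (claw-free-function {M} cf) no-flat)
    j≤s : j ≤ s
    j≤s = flat-≤ω {M} ω (proj₁ flat) (proj₁ (proj₂ flat)) (proj₂ (proj₂ flat))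
    d = s ∸ j
    padded = pad d head ps
    length≡ : double (d + j) ≡ 2 * s
    length≡ = trans (cong double (m∸n+n≡m j≤s)) (double≡2* s)
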